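{- Let $k,n$ be positive integers and let $c_1,\dots,c_n$ be non-negative integers with $n=c_1+2c_2+\cdots+nc_n$. Consider the formal power series in the variables $t_1,t_2,\dots$ \[ E=\exp\left(\sum_{\ell\ge 1}\sum_{g\in G_k(\ell)}\frac{\ell^{g-1}}{g}t_\ell^g\right),\qquad D=\exp\left(\sum_{\ell\ge 1}\sum_{g\in G_k(\ell)}(-1)^{\ell g+1}\frac{\ell^{g-1}}{g}t_\ell^g\right). \] Then the coefficient of $\frac{t_1^{c_1}\cdots t_n^{c_n}}{c_1!\cdots c_n!}$ in $\frac12 E+\frac12 D$ equals the number of even $k$th roots of a permutation of cycle type $(c_1,\dots,c_n)$, and the coefficient of $\frac{t_1^{c_1}\cdots t_n^{c_n}}{c_1!\cdots c_n!}$ in $\frac12 E-\frac12 D$ equals the number of odd $k$th roots of a permutation of cycle type $(c_1,\dots,c_n)$.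
   Context: For $k,\ell\in\mathbb{N}$ (positive integers), $G_k(\ell)=\{g\in\mathbb{N}:\gcd(g\ell,k)=g\}$ (a finite set of divisors of $k$). The cycle type of a permutation of $\{1,\dots,n\}$ is the vector $(c_1,\dots,c_n)$ where $c_i$ is the number of cycles of length $i$ in its disjoint cycle factorization. For $\sigma\in S_n$, a $k$th root of $\sigma$ is a permutation $\tau\in S_n$ with $\tau^k=\sigma$; it is an even (resp. odd) $k$th root if $\tau$ is an even (resp. odd) permutation. -}

module Defs where

open import Data.Nat as ℕ using (ℕ; zero; suc; _∸_; _^_; _!; _%_)
open import Data.Nat.Properties using (_!≢0)
open import Data.Nat.GCD using (gcd)
open import Data.Fin as Fin using (Fin; toℕ)
open import Data.Vec as Vec using (Vec; []; _∷_; lookup; tabulate; toList; zipWith; replicate; _[_]≔_)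
import Data.Vec.Properties as VecP
open import Data.List as List using (List; []; _∷_; length; filter; concatMap; upTo; allFin; cartesianProduct; foldr)
import Data.List.Relation.Unary.Unique.DecPropositional as UniqueDec
open import Data.Integer as ℤ using (ℤ; +_)
open import Data.Rational as ℚ using (ℚ; 0ℚ; 1ℚ; _+_; _*_; -_)
open import Data.Product using (_×_; _,_; proj₁; proj₂)
open import Relation.Binary.PropositionalEquality using (_≡_)
open import Relation.Nullary using (Dec; yes; no; _×-dec_)

InG : ℕ → ℕ → ℕ → Set
InG k ℓ g = gcd (g ℕ.* ℓ) k ≡ g

-- Self-maps of {0,…,n-1} (standing for {1,…,n}) as vectors,
-- f ↦ (f 0, …, f (n-1)).

Fun : ℕ → Set
Fun n = Vec (Fin n) n

-- a self-map of a finite set is a permutation iff it is injective,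
-- i.e. its list of values has no repetition
IsPerm : ∀ {n} → Fun n → Set
IsPerm {n} τ = UniqueDec.Unique (Fin._≟_ {n}) (toList τ)

isPerm? : ∀ {n} (τ : Fun n) → Dec (IsPerm τ)
isPerm? {n} τ = UniqueDec.unique? (Fin._≟_ {n}) (toList τ)

idF : ∀ {n} → Fun n
idF = tabulate (λ i → i)

_∘F_ : ∀ {n} → Fun n → Fun n → Fun n
τ ∘F ρ = tabulate (λ i → lookup τ (lookup ρ i))

_^F_ : ∀ {n} → Fun n → ℕ → Fun n
τ ^F zero = idF
τ ^F suc m = τ ∘F (τ ^F m)

allVecs : ∀ {n} m → List (Vec (Fin n) m)
allVecs zero = [] ∷ []
allVecs {n} (suc m) = concatMap (λ x → List.map (x ∷_) (allVecs m)) (allFin n)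

inversions : ∀ {n} → Fun n → ℕ
inversions {n} τ =
  length (filter (λ p → (proj₁ p Fin.<? proj₂ p) ×-dec (lookup τ (proj₂ p) Fin.<? lookup τ (proj₁ p)))
                 (cartesianProduct (allFin n) (allFin n)))

IsEven : ∀ {n} → Fun n → Set
IsEven τ = inversions τ % 2 ≡ 0

IsOdd : ∀ {n} → Fun n → Set
IsOdd τ = inversions τ % 2 ≡ 1

IsRoot : ∀ {n} → ℕ → Fun n → Fun n → Set
IsRoot k σ τ = IsPerm τ × (τ ^F k ≡ σ)

isRoot? : ∀ {n} k (σ τ : Fun n) → Dec (IsRoot k σ τ)
isRoot? k σ τ = isPerm? τ ×-dec VecP.≡-dec Fin._≟_ (τ ^F k) σ

numEvenRoots : ∀ {n} → ℕ → Fun n → ℕ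
numEvenRoots {n} k σ =
  length (filter (λ τ → isRoot? k σ τ ×-dec (inversions τ % 2 ℕ.≟ 0)) (allVecs n))

numOddRoots : ∀ {n} → ℕ → Fun n → ℕ
numOddRoots {n} k σ =
  length (filter (λ τ → isRoot? k σ τ ×-dec (inversions τ % 2 ℕ.≟ 1)) (allVecs n))

-- Cycle type.  The length of the cycle of σ through x is the least
-- m ≥ 1 with σ^m x = x (it is ≤ n for a permutation).

cycleLength : ∀ {n} → Fun n → Fin n → ℕ
cycleLength {n} σ x = go 1 n
  where
  go : ℕ → ℕ → ℕ
  go m zero = 0
  go m (suc fuel) with lookup (σ ^F m) x Fin.≟ x
  ... | yes _ = m
  ... | no  _ = go (suc m) fuel

-- c = (c_1,…,c_n) stored as a vector with lookup c i = c_{i+1}.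
-- σ has cycle type c iff for every length i the elements lying on
-- cycles of length i are exactly i·c_i many (i.e. there are c_i cycles
-- of length i).
HasCycleType : ∀ {n} → Fun n → Vec ℕ n → Set
HasCycleType {n} σ c =
  ∀ (i : Fin n) →
    suc (toℕ i) ℕ.* lookup c i
      ≡ length (filter (λ x → cycleLength σ x ℕ.≟ suc (toℕ i)) (allFin n))

weightedSum : ∀ {n} → Vec ℕ n → ℕ
weightedSum {n} c = foldr ℕ._+_ 0 (List.map (λ i → suc (toℕ i) ℕ.* lookup c i) (allFin n))

-- Formal power series over ℚ in the variables t_1,…,t_n,
-- represented by their coefficient function on exponent vectors
-- (a ∈ ℕⁿ stands for t_1^{a_1}⋯t_n^{a_n}).

Series : ℕ → Set
Series n = Vec ℕ n → ℚ

sumℚ : List ℚ → ℚ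
sumℚ = foldr _+_ 0ℚ

below : ∀ {n} → Vec ℕ n → List (Vec ℕ n)
below [] = [] ∷ []
below (x ∷ c) = concatMap (λ a → List.map (a ∷_) (below c)) (upTo (suc x))

monomial : ∀ {n} → Vec ℕ n → Series n
monomial a c with VecP.≡-dec ℕ._≟_ c a
... | yes _ = 1ℚ
... | no  _ = 0ℚ

oneS : ∀ {n} → Series n
oneS = monomial (replicate _ 0)

_+S_ : ∀ {n} → Series n → Series n → Series n
(f +S g) c = f c + g c

_·S_ : ∀ {n} → ℚ → Series n → Series n
(q ·S f) c = q * f c

_*S_ : ∀ {n} → Series n → Series n → Series n
(f *S g) c = sumℚ (List.map (λ a → f a * g (zipWith _∸_ c a)) (below c))

_^S_ : ∀ {n} → Series n → ℕ → Series n
f ^S zero = oneS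
f ^S suc m = f *S (f ^S m)

totalDegree : ∀ {n} → Vec ℕ n → ℕ
totalDegree = Vec.sum

-- exp f = Σ_{m ≥ 0} f^m / m!  (for f without constant term; the
-- coefficient at c only receives contributions from m ≤ |c|)
expS : ∀ {n} → Series n → Series n
expS f c = sumℚ (List.map (λ m → ((+ 1) ℚ./ (m !)) {{m !≢0}} * (f ^S m) c)
                          (upTo (suc (totalDegree c))))

signℚ : ℕ → ℚ
signℚ zero = 1ℚ
signℚ (suc m) = - signℚ m

-- Σ_{ℓ=1}^{n} Σ_{g ∈ G_k(ℓ)} w(ℓ,g) · ℓ^{g-1}/g · t_ℓ^g.
-- Every g ∈ G_k(ℓ) divides k, so 1 ≤ g ≤ k.
inner : ∀ {n} → ℕ → (ℕ → ℕ → ℚ) → Series n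
inner {n} k w c =
  sumℚ (List.map (λ i → sumℚ (List.map (λ g′ → term i g′) (upTo k))) (allFin n))
  where
  -- term i g′ is the term for ℓ = i+1 and g = g′+1
  term : Fin n → ℕ → ℚ
  term i g′ with gcd (suc g′ ℕ.* suc (toℕ i)) k ℕ.≟ suc g′
  ... | no  _ = 0ℚ
  ... | yes _ = w (suc (toℕ i)) (suc g′)
                * (+ (suc (toℕ i) ^ g′) ℚ./ suc g′)
                * monomial (replicate n 0 [ i ]≔ suc g′) c

E-series : ∀ {n} → ℕ → Series n
E-series k = expS (inner k (λ ℓ g → 1ℚ))

D-series : ∀ {n} → ℕ → Series n
D-series k = expS (inner k (λ ℓ g → signℚ (ℓ ℕ.* g ℕ.+ 1)))

half : ℚ
half = (+ 1) ℚ./ 2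

-- coefficient of t^c / (c_1! ⋯ c_n!)  =  c_1! ⋯ c_n! · [t^c]
expCoeff : ∀ {n} → Series n → Vec ℕ n → ℚ
expCoeff f c = (+ (Vec.foldr _ ℕ._*_ 1 (Vec.map _! c)) ℚ./ 1) * f c

{-# OPTIONS --safe #-}

-- For a σ-closed set S let W(S) be the sum of χ(τ) over the permutations τ that
-- are the identity off S and satisfy τ^k = σ on S, where χ is 1 (for E) or the
-- sign (for D).  If S has cᵢ cycles of length i, then W(S) = c! [t^c] exp(…).
--
-- Fix x in S on a cycle of length ℓ, and follow τ from x.  As τ commutes with σ,
-- the points x, τ x, τ² x, … lie on σ-cycles of length ℓ, distinct until the
-- σ-cycle of x is met again, say at τ^g x.  Then g divides k, and with k = q g
-- one gets τ^g x = σ^u x with u q ≡ 1 (mod ℓ), which is solvable exactly when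
-- gcd(g ℓ, k) = g; the whole τ-cycle, of length g ℓ, is determined by its first g
-- points, and removing it leaves an element counted by W of the remaining set.
-- Choosing the g - 1 intermediate points one after the other yields
--   W(c) = Σ_g w(ℓ,g) ℓ^(g-1) (cₗ-1)⋯(cₗ-g+1) W(c - g eₗ),
-- which is the recurrence obtained by applying tₗ ∂/∂tₗ to the exponential.
module Submission where

-- Counting all ways to complete a τ-cycle at once would need a count of sequences of points on
-- distinct σ-cycles. The sum `V` over the roots with a prescribed chain Y 0, ..., Y r avoids this:
-- the next point either lies on one of the p remaining σ-cycles of length ℓ, which leaves ℓ p
-- choices of equal worth, or it closes the τ-cycle. This one-step relation is Horner's scheme for
-- the sum over g, with the factorials of the cycle counts absorbed into it, so no falling factorial
-- has to be handled explicitly. E and D are treated together. The weights χ and w stay abstract;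
-- apart from χ(id) = 1, what links them is that composing with a cycle of g ℓ points multiplies χ
-- by w(ℓ,g). For the sign this factor is (-1)^(gℓ-1), since such a cycle is a product of gℓ-1
-- transpositions; hence the exponent ℓg+1 in D. At the end (1 ± sgn)/2 separates even from odd
-- roots.

-- Finite sums with values in a commutative semiring.

module Summation where
  open import Defs using (below; allVecs)
  open import Algebra.Structures using (IsCommutativeSemiring)
  open import Data.Bool using (if_then_else_)
  open import Data.Empty using (⊥-elim)
  open import Data.Fin as Fin using (Fin)
  open import Data.List using (List; []; _∷_; _++_; map; foldr; concatMap; allFin; applyUpTo; upTo)
  open import Data.List.Properties using (map-tabulate)
  open import Data.List.Relation.Unary.All as All using (All; []; _∷_)
  import Data.List.Relation.Unary.All.Properties as Allₚ
  open import Data.Nat as ℕ using (ℕ; zero; suc; _∸_; _≤_; _<_; z≤n; s≤s)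
  import Data.Nat.Properties as ℕₚ
  open import Data.Product using (_,_)
  open import Data.Unit using (tt)
  open import Data.Vec using (Vec; []; _∷_; zipWith)
  import Data.Vec.Properties as Vecₚ
  open import Data.Vec.Relation.Binary.Pointwise.Inductive as PW using (Pointwise; []; _∷_)
  open import Function using (_∘_; id)
  open import Relation.Binary.Definitions using (DecidableEquality)
  open import Relation.Binary.PropositionalEquality using (_≡_; refl; sym; trans; cong; cong₂; subst; module ≡-Reasoning)
  open import Relation.Nullary using (¬_; Dec; yes; no; does; _×-dec_)

  _∸ᵛ_ : ∀ {m} → Vec ℕ m → Vec ℕ m → Vec ℕ m
  _∸ᵛ_ = zipWith _∸_

  ∸ᵛ-comm : ∀ {m} (c a b : Vec ℕ m) → (c ∸ᵛ a) ∸ᵛ b ≡ (c ∸ᵛ b) ∸ᵛ a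
  ∸ᵛ-comm []      []      []      = refl
  ∸ᵛ-comm (x ∷ c) (y ∷ a) (z ∷ b) = cong₂ _∷_
    (trans (ℕₚ.∸-+-assoc x y z) (trans (cong (x ∸_) (ℕₚ.+-comm y z)) (sym (ℕₚ.∸-+-assoc x z y))))
    (∸ᵛ-comm c a b)

  below-≤ : ∀ {m} (c : Vec ℕ m) → All (λ a → Pointwise _≤_ a c) (below c)
  below-≤ []      = [] ∷ []
  below-≤ (x ∷ c) = Allₚ.concat⁺ (Allₚ.map⁺ (Allₚ.applyUpTo⁺₁ id (suc x)
    (λ a≤x → Allₚ.map⁺ (All.map (ℕ.s≤s⁻¹ a≤x ∷_) (below-≤ c)))))

  module Sum {A : Set} {_+_ _*_ : A → A → A} {0# 1# : A} (isCSR : IsCommutativeSemiring _≡_ _+_ _*_ 0# 1#) where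
    open IsCommutativeSemiring isCSR using (+-identityˡ; +-identityʳ; +-assoc; +-comm; zeroˡ; zeroʳ; distribˡ; *-comm)
    open ≡-Reasoning

    private
      variable
        I J : Set
        P Q : Set
        a b : A
        n : ℕ

    -- Testing only the boolean `does d` lets `when` compute on `_×-dec_` as a conjunction and on
    -- `_≟_` at distinct constructors.
    when : Dec P → A → A
    when d a = if does d then a else 0#

    when-yes : (d : Dec P) → P → when d a ≡ a
    when-yes (yes _) _ = refl
    when-yes (no ¬p) p = ⊥-elim (¬p p)

    when-no : (d : Dec P) → ¬ P → when d a ≡ 0#
    when-no (yes p) ¬p = ⊥-elim (¬p p)
    when-no (no _)  _  = refl

    when-cong : (d : Dec P) (e : Dec Q) → (P → Q) → (Q → P) → (P → a ≡ b) → when d a ≡ when e b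
    when-cong (yes p) e f g eq = trans (eq p) (sym (when-yes e (f p)))
    when-cong (no ¬p) e f g eq = sym (when-no e (¬p ∘ g))

    when-congʳ : (d : Dec P) → (P → a ≡ b) → when d a ≡ when d b
    when-congʳ d = when-cong d d id id

    when-redundant : (d : Dec P) → (¬ P → a ≡ 0#) → when d a ≡ a
    when-redundant (yes _) _  = refl
    when-redundant (no ¬p) eq = sym (eq ¬p)

    when-× : (d : Dec P) (e : Dec Q) → when (d ×-dec e) a ≡ when d (when e a)
    when-× (yes _) (yes _) = refl
    when-× (yes _) (no _)  = refl
    when-× (no _)  _       = refl

    when-+ : (d : Dec P) → when d (a + b) ≡ when d a + when d b
    when-+ (yes _) = refl
    when-+ (no _)  = sym (+-identityˡ 0#)

    when-0 : (d : Dec P) → when d 0# ≡ 0#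
    when-0 (yes _) = refl
    when-0 (no _)  = refl

    *-when : ∀ c (d : Dec P) → c * when d a ≡ when d (c * a)
    *-when c (yes _) = refl
    *-when c (no _)  = zeroʳ c

    when-* : ∀ (d : Dec P) c → when d a * c ≡ when d (a * c)
    when-* (yes _) c = refl
    when-* (no _)  c = zeroˡ c

    ∑ : List I → (I → A) → A
    ∑ xs f = foldr _+_ 0# (map f xs)

    ∑-cong : ∀ (xs : List I) {f g : I → A} → (∀ x → f x ≡ g x) → ∑ xs f ≡ ∑ xs g
    ∑-cong []       f≡g = refl
    ∑-cong (x ∷ xs) f≡g = cong₂ _+_ (f≡g x) (∑-cong xs f≡g)

    ∑-cong-All : ∀ {xs : List I} {f g : I → A} → All (λ x → f x ≡ g x) xs → ∑ xs f ≡ ∑ xs g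
    ∑-cong-All []          = refl
    ∑-cong-All (eq ∷ eqs) = cong₂ _+_ eq (∑-cong-All eqs)

    ∑-0 : (xs : List I) → ∑ xs (λ _ → 0#) ≡ 0#
    ∑-0 []       = refl
    ∑-0 (x ∷ xs) = trans (+-identityˡ _) (∑-0 xs)

    ∑-zero : ∀ (xs : List I) {f : I → A} → (∀ x → f x ≡ 0#) → ∑ xs f ≡ 0#
    ∑-zero xs f≡0 = trans (∑-cong xs f≡0) (∑-0 xs)

    ∑-+ : ∀ (xs : List I) {f g : I → A} → ∑ xs (λ x → f x + g x) ≡ ∑ xs f + ∑ xs g
    ∑-+ []               = sym (+-identityˡ _)
    ∑-+ (x ∷ xs) {f} {g} = begin
      (f x + g x) + ∑ xs (λ y → f y + g y) ≡⟨ cong ((f x + g x) +_) (∑-+ xs) ⟩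
      (f x + g x) + (F + G)                ≡⟨ +-assoc (f x) (g x) (F + G) ⟩
      f x + (g x + (F + G))                ≡⟨ cong (f x +_) (+-assoc (g x) F G) ⟨
      f x + ((g x + F) + G)                ≡⟨ cong (λ e → f x + (e + G)) (+-comm (g x) F) ⟩
      f x + ((F + g x) + G)                ≡⟨ cong (f x +_) (+-assoc F (g x) G) ⟩
      f x + (F + (g x + G))                ≡⟨ +-assoc (f x) F (g x + G) ⟨
      (f x + F) + (g x + G)                ∎
      where
      F = ∑ xs f
      G = ∑ xs g

    *-∑ : ∀ c (xs : List I) {f : I → A} → c * ∑ xs f ≡ ∑ xs (λ x → c * f x)
    *-∑ c []           = zeroʳ c
    *-∑ c (x ∷ xs) {f} = trans (distribˡ c (f x) _) (cong (_ +_) (*-∑ c xs))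

    ∑-* : ∀ (xs : List I) {f : I → A} c → ∑ xs f * c ≡ ∑ xs (λ x → f x * c)
    ∑-* xs c = trans (*-comm _ c) (trans (*-∑ c xs) (∑-cong xs (λ x → *-comm c _)))

    ∑-swap : ∀ (xs : List I) (ys : List J) {f : I → J → A} →
             ∑ xs (λ x → ∑ ys (f x)) ≡ ∑ ys (λ y → ∑ xs (λ x → f x y))
    ∑-swap []       ys     = sym (∑-0 ys)
    ∑-swap (x ∷ xs) ys {f} = trans (cong (∑ ys (f x) +_) (∑-swap xs ys)) (sym (∑-+ ys))

    ∑-++ : ∀ (xs ys : List I) {f : I → A} → ∑ (xs ++ ys) f ≡ ∑ xs f + ∑ ys f
    ∑-++ []       ys     = sym (+-identityˡ _)
    ∑-++ (x ∷ xs) ys {f} = trans (cong (f x +_) (∑-++ xs ys)) (sym (+-assoc _ _ _))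

    ∑-map : ∀ (h : I → J) xs {f : J → A} → ∑ (map h xs) f ≡ ∑ xs (f ∘ h)
    ∑-map h []           = refl
    ∑-map h (x ∷ xs) {f} = cong (f (h x) +_) (∑-map h xs)

    ∑-concatMap : ∀ (h : I → List J) xs {f : J → A} → ∑ (concatMap h xs) f ≡ ∑ xs (λ x → ∑ (h x) f)
    ∑-concatMap h []       = refl
    ∑-concatMap h (x ∷ xs) = trans (∑-++ (h x) _) (cong (_ +_) (∑-concatMap h xs))

    ∑-∷ : ∀ {m} xs (ys : List (Vec I m)) {f : Vec I (suc m) → A} →
          ∑ (concatMap (λ x → map (x ∷_) ys) xs) f ≡ ∑ xs (λ x → ∑ ys (λ y → f (x ∷ y)))
    ∑-∷ xs ys = trans (∑-concatMap _ xs) (∑-cong xs (λ x → ∑-map (x ∷_) ys))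

    ∑-allFin-suc : ∀ n {f : Fin (suc n) → A} → ∑ (allFin (suc n)) f ≡ f Fin.zero + ∑ (allFin n) (f ∘ Fin.suc)
    ∑-allFin-suc n {f} = cong (f Fin.zero +_)
      (trans (cong (λ l → ∑ l f) (sym (map-tabulate id Fin.suc))) (∑-map Fin.suc (allFin n)))

    ∑-applyUpTo : ∀ (h : ℕ → I) n {f : I → A} → ∑ (applyUpTo h n) f ≡ ∑ (upTo n) (f ∘ h)
    ∑-applyUpTo h zero        = refl
    ∑-applyUpTo h (suc n) {f} = cong (f (h 0) +_)
      (trans (∑-applyUpTo (h ∘ suc) n) (sym (∑-applyUpTo suc n)))

    ∑-upTo-suc : ∀ n {f : ℕ → A} → ∑ (upTo (suc n)) f ≡ f 0 + ∑ (upTo n) (f ∘ suc)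
    ∑-upTo-suc n = cong (_ +_) (∑-applyUpTo suc n)

    -- xs lists every element of I exactly once.
    record Enumerates {I : Set} (xs : List I) (_≟_ : DecidableEquality I) : Set where
      field
        ∑-≟ : ∀ x₀ a → ∑ xs (λ x → when (x ≟ x₀) a) ≡ a

    open Enumerates

    enum-pick : ∀ {xs : List I} {_≟_} → Enumerates xs _≟_ → ∀ x₀ (f : I → A) →
                ∑ xs (λ x → when (x ≟ x₀) (f x)) ≡ f x₀
    enum-pick {xs = xs} {_≟_} en x₀ f =
      trans (∑-cong xs (λ x → when-congʳ (x ≟ x₀) (cong f))) (∑-≟ en x₀ (f x₀))

    ∑-allFin-≟ : ∀ n (x₀ : Fin n) a → ∑ (allFin n) (λ x → when (x Fin.≟ x₀) a) ≡ a
    ∑-allFin-≟ (suc n) Fin.zero a = begin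
      ∑ (allFin (suc n)) (λ x → when (x Fin.≟ Fin.zero) a) ≡⟨ ∑-allFin-suc n ⟩
      a + ∑ (allFin n) (λ _ → 0#)                          ≡⟨ cong (a +_) (∑-0 (allFin n)) ⟩
      a + 0#                                               ≡⟨ +-identityʳ a ⟩
      a                                                    ∎
    ∑-allFin-≟ (suc n) (Fin.suc i) a = begin
      ∑ (allFin (suc n)) (λ x → when (x Fin.≟ Fin.suc i) a)    ≡⟨ ∑-allFin-suc n ⟩
      0# + ∑ (allFin n) (λ x → when (Fin.suc x Fin.≟ Fin.suc i) a)
        ≡⟨ +-identityˡ _ ⟩
      ∑ (allFin n) (λ x → when (Fin.suc x Fin.≟ Fin.suc i) a)
        ≡⟨ ∑-cong (allFin n) (λ x → when-cong (Fin.suc x Fin.≟ Fin.suc i) (x Fin.≟ i) (λ { refl → refl }) (cong Fin.suc) (λ _ → refl)) ⟩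
      ∑ (allFin n) (λ x → when (x Fin.≟ i) a)                  ≡⟨ ∑-allFin-≟ n i a ⟩
      a                                                        ∎

    enum-allFin : ∀ n → Enumerates (allFin n) Fin._≟_
    enum-allFin n .∑-≟ = ∑-allFin-≟ n

    pick-upTo : ∀ n m (f : ℕ → A) → ∑ (upTo n) (λ i → when (i ℕ.≟ m) (f i)) ≡ when (m ℕ.<? n) (f m)
    pick-upTo zero    m       f = refl
    pick-upTo (suc n) zero    f = begin
      ∑ (upTo (suc n)) (λ i → when (i ℕ.≟ 0) (f i)) ≡⟨ ∑-upTo-suc n ⟩
      f 0 + ∑ (upTo n) (λ _ → 0#)                   ≡⟨ cong (f 0 +_) (∑-0 (upTo n)) ⟩
      f 0 + 0#                                      ≡⟨ +-identityʳ _ ⟩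
      f 0                                           ∎
    pick-upTo (suc n) (suc m) f = begin
      ∑ (upTo (suc n)) (λ i → when (i ℕ.≟ suc m) (f i)) ≡⟨ ∑-upTo-suc n ⟩
      0# + ∑ (upTo n) (λ i → when (suc i ℕ.≟ suc m) (f (suc i))) ≡⟨ +-identityˡ _ ⟩
      ∑ (upTo n) (λ i → when (suc i ℕ.≟ suc m) (f (suc i)))
        ≡⟨ ∑-cong (upTo n) (λ i → when-cong (suc i ℕ.≟ suc m) (i ℕ.≟ m) ℕₚ.suc-injective (cong suc) (λ _ → refl)) ⟩
      ∑ (upTo n) (λ i → when (i ℕ.≟ m) (f (suc i))) ≡⟨ pick-upTo n m (f ∘ suc) ⟩
      when (m ℕ.<? n) (f (suc m))
        ≡⟨ when-cong (m ℕ.<? n) (suc m ℕ.<? suc n) ℕ.s≤s ℕ.s≤s⁻¹ (λ _ → refl) ⟩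
      when (suc m ℕ.<? suc n) (f (suc m))           ∎

    -- The indicator of y = h x sums to 1 over y; inserting it and exchanging the sums splits the
    -- sum over `xs` by the value of h. Later h is the image of one point under the permutation
    -- summed over.
    ∑-fibre : ∀ (xs : List I) {ys : List J} {_≟_} → Enumerates ys _≟_ → ∀ (h : I → J) {f : I → A} →
              ∑ xs f ≡ ∑ ys (λ y → ∑ xs (λ x → when (y ≟ h x) (f x)))
    ∑-fibre xs {ys} en h {f} =
      trans (∑-cong xs (λ x → sym (∑-≟ en (h x) (f x)))) (∑-swap xs ys)

    module _ {xs : List I} {ys : List J} {_≟ᴵ_ : DecidableEquality I} {_≟ᴶ_ : DecidableEquality J}
             (enˣ : Enumerates xs _≟ᴵ_) (enʸ : Enumerates ys _≟ᴶ_)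
             {P : I → Set} {Q : J → Set} (P? : ∀ x → Dec (P x)) (Q? : ∀ y → Dec (Q y))
             (φ : I → J) (ψ : J → I) where

      -- The maps need to be inverse to each other only on P and Q: the pairs with y = φ x and P x
      -- are those with x = ψ y and Q y, and the sum over these pairs is read off in both orders.
      ∑-bijection : (∀ {x} → P x → Q (φ x)) → (∀ {y} → Q y → P (ψ y)) →
                    (∀ {x} → P x → ψ (φ x) ≡ x) → (∀ {y} → Q y → φ (ψ y) ≡ y) →
                    {f : I → A} {g : J → A} → (∀ {x} → P x → f x ≡ g (φ x)) →
                    ∑ xs (λ x → when (P? x) (f x)) ≡ ∑ ys (λ y → when (Q? y) (g y))
      ∑-bijection PQ QP ψφ φψ {f} {g} fg = begin
        ∑ xs (λ x → when (P? x) (f x))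
          ≡⟨ ∑-fibre xs enʸ φ ⟩
        ∑ ys (λ y → ∑ xs (λ x → when (y ≟ᴶ φ x) (when (P? x) (f x))))
          ≡⟨ ∑-cong ys (λ y → ∑-cong xs (λ x → pointwise x y)) ⟩
        ∑ ys (λ y → ∑ xs (λ x → when (x ≟ᴵ ψ y) (when (Q? y) (g y))))
          ≡⟨ ∑-cong ys (λ y → ∑-≟ enˣ (ψ y) _) ⟩
        ∑ ys (λ y → when (Q? y) (g y)) ∎
        where
        pointwise : ∀ x y → when (y ≟ᴶ φ x) (when (P? x) (f x)) ≡ when (x ≟ᴵ ψ y) (when (Q? y) (g y))
        pointwise x y = begin
          when (y ≟ᴶ φ x) (when (P? x) (f x)) ≡⟨ when-× (y ≟ᴶ φ x) (P? x) ⟨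
          when ((y ≟ᴶ φ x) ×-dec P? x) (f x)
            ≡⟨ when-cong ((y ≟ᴶ φ x) ×-dec P? x) ((x ≟ᴵ ψ y) ×-dec Q? y)
                 (λ { (refl , p) → sym (ψφ p) , PQ p })
                 (λ { (refl , q) → sym (φψ q) , QP q })
                 (λ { (refl , p) → fg p }) ⟩
          when ((x ≟ᴵ ψ y) ×-dec Q? y) (g y)  ≡⟨ when-× (x ≟ᴵ ψ y) (Q? y) ⟩
          when (x ≟ᴵ ψ y) (when (Q? y) (g y)) ∎

    ∑-reindex : ∀ {n} (φ ψ : Fin n → Fin n) → (∀ x → ψ (φ x) ≡ x) → (∀ x → φ (ψ x) ≡ x) →
                ∀ {f : Fin n → A} → ∑ (allFin n) (f ∘ φ) ≡ ∑ (allFin n) f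
    ∑-reindex {n} φ ψ ψφ φψ =
      ∑-bijection (enum-allFin n) (enum-allFin n) (λ _ → yes tt) (λ _ → yes tt) φ ψ
        (λ _ → tt) (λ _ → tt) (λ _ → ψφ _) (λ _ → φψ _) (λ _ → refl)

    ∑-upTo-cong : ∀ n {f g : ℕ → A} → (∀ m → m < n → f m ≡ g m) → ∑ (upTo n) f ≡ ∑ (upTo n) g
    ∑-upTo-cong n f≡g = ∑-cong-All (Allₚ.applyUpTo⁺₁ id n (λ {m} m<n → f≡g m m<n))

    ∑-upTo-restrict : ∀ {m n} → m ≤ n → (f : ℕ → A) →
                      ∑ (upTo m) f ≡ ∑ (upTo n) (λ i → when (i ℕ.<? m) (f i))
    ∑-upTo-restrict {n = n} z≤n f = sym (∑-zero (upTo n) (λ i → when-no {a = f i} (i ℕ.<? 0) (λ ())))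
    ∑-upTo-restrict {suc m} {suc n} (s≤s m≤n) f = begin
      ∑ (upTo (suc m)) f
        ≡⟨ ∑-upTo-suc m ⟩
      f 0 + ∑ (upTo m) (f ∘ suc)
        ≡⟨ cong (f 0 +_) (∑-upTo-restrict m≤n (f ∘ suc)) ⟩
      f 0 + ∑ (upTo n) (λ i → when (i ℕ.<? m) (f (suc i)))
        ≡⟨ cong (f 0 +_) (∑-cong (upTo n) (λ i → when-cong (i ℕ.<? m) (suc i ℕ.<? suc m) s≤s ℕ.s≤s⁻¹ (λ _ → refl))) ⟩
      f 0 + ∑ (upTo n) (λ i → when (suc i ℕ.<? suc m) (f (suc i)))
        ≡⟨ ∑-upTo-suc n ⟨
      ∑ (upTo (suc n)) (λ i → when (i ℕ.<? suc m) (f i)) ∎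

    ∑-upTo-extend : ∀ {m n} → m ≤ n → {f : ℕ → A} → (∀ i → m ≤ i → f i ≡ 0#) → ∑ (upTo n) f ≡ ∑ (upTo m) f
    ∑-upTo-extend {m} {n} m≤n {f} f≡0 = trans
      (∑-cong (upTo n) (λ i → sym (when-redundant (i ℕ.<? m) (λ i≮m → f≡0 i (ℕₚ.≮⇒≥ i≮m)))))
      (sym (∑-upTo-restrict m≤n f))

    -- Both sides range over the pairs with a + b ≤ x; padding the inner ranges to a full square
    -- with an indicator leaves an exchange of two fixed ranges.
    ∑-triangle : ∀ x (φ : ℕ → ℕ → A) →
                 ∑ (upTo (suc x)) (λ a → ∑ (upTo (suc (x ∸ a))) (λ b → φ a b)) ≡
                 ∑ (upTo (suc x)) (λ b → ∑ (upTo (suc (x ∸ b))) (λ a → φ a b))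
    ∑-triangle x φ = begin
      ∑ (upTo (suc x)) (λ a → ∑ (upTo (suc (x ∸ a))) (φ a))
        ≡⟨ square φ ⟩
      ∑ (upTo (suc x)) (λ a → ∑ (upTo (suc x)) (λ b → when (a ℕ.+ b ℕ.≤? x) (φ a b)))
        ≡⟨ ∑-swap (upTo (suc x)) (upTo (suc x)) ⟩
      ∑ (upTo (suc x)) (λ b → ∑ (upTo (suc x)) (λ a → when (a ℕ.+ b ℕ.≤? x) (φ a b)))
        ≡⟨ ∑-cong (upTo (suc x)) (λ b → ∑-cong (upTo (suc x)) (λ a →
             when-cong (a ℕ.+ b ℕ.≤? x) (b ℕ.+ a ℕ.≤? x) (subst (_≤ x) (ℕₚ.+-comm a b)) (subst (_≤ x) (ℕₚ.+-comm b a)) (λ _ → refl))) ⟩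
      ∑ (upTo (suc x)) (λ b → ∑ (upTo (suc x)) (λ a → when (b ℕ.+ a ℕ.≤? x) (φ a b)))
        ≡⟨ square (λ b a → φ a b) ⟨
      ∑ (upTo (suc x)) (λ b → ∑ (upTo (suc (x ∸ b))) (λ a → φ a b)) ∎
      where
      square : ∀ (φ : ℕ → ℕ → A) →
               ∑ (upTo (suc x)) (λ a → ∑ (upTo (suc (x ∸ a))) (φ a)) ≡
               ∑ (upTo (suc x)) (λ a → ∑ (upTo (suc x)) (λ b → when (a ℕ.+ b ℕ.≤? x) (φ a b)))
      square φ = ∑-upTo-cong (suc x) (λ a a≤x →
        trans (∑-upTo-restrict (s≤s (ℕₚ.m∸n≤m x a)) (φ a))
              (∑-cong (upTo (suc x)) (λ b → when-cong (b ℕ.<? suc (x ∸ a)) (a ℕ.+ b ℕ.≤? x)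
                (λ b≤ → subst (_≤ x) (ℕₚ.+-comm b a) (ℕₚ.m≤o∸n⇒m+n≤o b (ℕ.s≤s⁻¹ a≤x) (ℕ.s≤s⁻¹ b≤)))
                (λ le → s≤s (ℕₚ.m+n≤o⇒m≤o∸n b (subst (_≤ x) (ℕₚ.+-comm a b) le)))
                (λ _ → refl))))

    -- The coordinates are independent: the one-variable exchange serves the first, induction the
    -- others. This is what makes the Cauchy product left-commutative.
    ∑-below-triangle : ∀ (c : Vec ℕ n) (φ : Vec ℕ n → Vec ℕ n → A) →
                       ∑ (below c) (λ a → ∑ (below (c ∸ᵛ a)) (λ b → φ a b)) ≡
                       ∑ (below c) (λ b → ∑ (below (c ∸ᵛ b)) (λ a → φ a b))
    ∑-below-triangle []      φ = refl
    ∑-below-triangle (x ∷ c) φ = begin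
      ∑ (below (x ∷ c)) (λ a → ∑ (below ((x ∷ c) ∸ᵛ a)) (λ b → φ a b))
        ≡⟨ unfold φ ⟩
      ∑ (upTo (suc x)) (λ a → ∑ (upTo (suc (x ∸ a))) (λ b → ∑ (below c) (λ a′ → ∑ (below (c ∸ᵛ a′)) (λ b′ → φ (a ∷ a′) (b ∷ b′)))))
        ≡⟨ ∑-triangle x _ ⟩
      ∑ (upTo (suc x)) (λ b → ∑ (upTo (suc (x ∸ b))) (λ a → ∑ (below c) (λ a′ → ∑ (below (c ∸ᵛ a′)) (λ b′ → φ (a ∷ a′) (b ∷ b′)))))
        ≡⟨ ∑-cong (upTo (suc x)) (λ b → ∑-cong (upTo (suc (x ∸ b))) (λ a → ∑-below-triangle c _)) ⟩
      ∑ (upTo (suc x)) (λ b → ∑ (upTo (suc (x ∸ b))) (λ a → ∑ (below c) (λ b′ → ∑ (below (c ∸ᵛ b′)) (λ a′ → φ (a ∷ a′) (b ∷ b′)))))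
        ≡⟨ unfold (λ b a → φ a b) ⟨
      ∑ (below (x ∷ c)) (λ b → ∑ (below ((x ∷ c) ∸ᵛ b)) (λ a → φ a b)) ∎
      where
      unfold : ∀ φ →
        ∑ (below (x ∷ c)) (λ a → ∑ (below ((x ∷ c) ∸ᵛ a)) (λ b → φ a b)) ≡
        ∑ (upTo (suc x)) (λ a → ∑ (upTo (suc (x ∸ a))) (λ b → ∑ (below c) (λ a′ → ∑ (below (c ∸ᵛ a′)) (λ b′ → φ (a ∷ a′) (b ∷ b′)))))
      unfold φ = trans (∑-∷ (upTo (suc x)) (below c)) (∑-cong (upTo (suc x)) (λ a →
        trans (∑-cong (below c) (λ a′ → ∑-∷ (upTo (suc (x ∸ a))) (below (c ∸ᵛ a′))))
              (∑-swap (below c) (upTo (suc (x ∸ a))))))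

    ∑-below-cong : ∀ (c : Vec ℕ n) {f g : (Vec ℕ n → A)} → (∀ a → Pointwise _≤_ a c → f a ≡ g a) →
                   ∑ (below c) f ≡ ∑ (below c) g
    ∑-below-cong c f≡g = ∑-cong-All (All.map (f≡g _) (below-≤ c))

    -- Serves to multiply a series by the monomial t^b: only the exponent a = b survives, provided
    -- it is coordinatewise at most c.
    pick-below : ∀ (c b : Vec ℕ n) (h : (Vec ℕ n → A)) →
                 ∑ (below c) (λ a → when (Vecₚ.≡-dec ℕ._≟_ a b) (h a)) ≡ when (PW.decidable ℕ._≤?_ b c) (h b)
    pick-below []      []      h = +-identityʳ _
    pick-below (x ∷ c) (y ∷ b) h = begin
      ∑ (below (x ∷ c)) (λ a → when (Vecₚ.≡-dec ℕ._≟_ a (y ∷ b)) (h a))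
        ≡⟨ ∑-∷ (upTo (suc x)) (below c) ⟩
      ∑ (upTo (suc x)) (λ a → ∑ (below c) (λ a′ → when (Vecₚ.≡-dec ℕ._≟_ (a ∷ a′) (y ∷ b)) (h (a ∷ a′))))
        ≡⟨ ∑-cong (upTo (suc x)) (λ a → ∑-cong (below c) (λ a′ → split a a′)) ⟩
      ∑ (upTo (suc x)) (λ a → ∑ (below c) (λ a′ → when (Vecₚ.≡-dec ℕ._≟_ a′ b) (when (a ℕ.≟ y) (h (a ∷ a′)))))
        ≡⟨ ∑-cong (upTo (suc x)) (λ a → pick-below c b _) ⟩
      ∑ (upTo (suc x)) (λ a → when b≤?c (when (a ℕ.≟ y) (h (a ∷ b))))
        ≡⟨ ∑-cong (upTo (suc x)) (λ a → flip-when b≤?c (a ℕ.≟ y)) ⟩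
      ∑ (upTo (suc x)) (λ a → when (a ℕ.≟ y) (when b≤?c (h (a ∷ b))))
        ≡⟨ pick-upTo (suc x) y _ ⟩
      when (y ℕ.<? suc x) (when b≤?c (h (y ∷ b)))
        ≡⟨ when-× (y ℕ.<? suc x) b≤?c ⟨
      when ((y ℕ.<? suc x) ×-dec b≤?c) (h (y ∷ b))
        ≡⟨ when-cong ((y ℕ.<? suc x) ×-dec b≤?c) (PW.decidable ℕ._≤?_ (y ∷ b) (x ∷ c))
             (λ { (s≤s le , les) → le ∷ les }) (λ { (le ∷ les) → s≤s le , les }) (λ _ → refl) ⟩
      when (PW.decidable ℕ._≤?_ (y ∷ b) (x ∷ c)) (h (y ∷ b)) ∎
      where
      b≤?c = PW.decidable ℕ._≤?_ b c

      flip-when : ∀ {P Q : Set} (d : Dec P) (e : Dec Q) {v} → when d (when e v) ≡ when e (when d v)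
      flip-when (yes _) e = refl
      flip-when (no _)  e = sym (when-0 e)

      split : ∀ a a′ → when (Vecₚ.≡-dec ℕ._≟_ (a ∷ a′) (y ∷ b)) (h (a ∷ a′)) ≡
                       when (Vecₚ.≡-dec ℕ._≟_ a′ b) (when (a ℕ.≟ y) (h (a ∷ a′)))
      split a a′ = trans
        (when-cong (Vecₚ.≡-dec ℕ._≟_ (a ∷ a′) (y ∷ b)) (Vecₚ.≡-dec ℕ._≟_ a′ b ×-dec (a ℕ.≟ y))
          (λ { refl → refl , refl }) (λ { (refl , refl) → refl }) (λ _ → refl))
        (when-× (Vecₚ.≡-dec ℕ._≟_ a′ b) (a ℕ.≟ y))

    ∑-allVecs-≟ : ∀ m (v : Vec (Fin n) m) a → ∑ (allVecs m) (λ u → when (Vecₚ.≡-dec Fin._≟_ u v) a) ≡ a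
    ∑-allVecs-≟ zero [] a = +-identityʳ a
    ∑-allVecs-≟ {n} (suc m) (x ∷ v) a = begin
      ∑ (allVecs (suc m)) (λ u → when (Vecₚ.≡-dec Fin._≟_ u (x ∷ v)) a)
        ≡⟨ ∑-∷ (allFin n) (allVecs m) ⟩
      ∑ (allFin n) (λ y → ∑ (allVecs m) (λ u → when (Vecₚ.≡-dec Fin._≟_ (y ∷ u) (x ∷ v)) a))
        ≡⟨ ∑-cong (allFin n) (λ y → ∑-cong (allVecs m) (λ u → split y u)) ⟩
      ∑ (allFin n) (λ y → ∑ (allVecs m) (λ u → when (Vecₚ.≡-dec Fin._≟_ u v) (when (y Fin.≟ x) a)))
        ≡⟨ ∑-cong (allFin n) (λ y → ∑-allVecs-≟ m v _) ⟩
      ∑ (allFin n) (λ y → when (y Fin.≟ x) a)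
        ≡⟨ ∑-allFin-≟ n x a ⟩
      a ∎
      where
      split : ∀ y u → when (Vecₚ.≡-dec Fin._≟_ (y ∷ u) (x ∷ v)) a ≡ when (Vecₚ.≡-dec Fin._≟_ u v) (when (y Fin.≟ x) a)
      split y u = trans
        (when-cong (Vecₚ.≡-dec Fin._≟_ (y ∷ u) (x ∷ v)) (Vecₚ.≡-dec Fin._≟_ u v ×-dec (y Fin.≟ x))
          (λ { refl → refl , refl }) (λ { (refl , refl) → refl }) (λ _ → refl))
        (when-× (Vecₚ.≡-dec Fin._≟_ u v) (y Fin.≟ x))

    enum-allVecs : ∀ n m → Enumerates (allVecs {n} m) (Vecₚ.≡-dec Fin._≟_)
    enum-allVecs n m .∑-≟ = ∑-allVecs-≟ m

-- Natural numbers as rationals.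

module Cast where
  open import Data.Integer as ℤ using (+_)
  import Data.Integer.Properties as ℤₚ
  open import Data.Nat as ℕ using (ℕ; suc; NonZero)
  import Data.Nat.Properties as ℕₚ
  open import Data.Rational using (ℚ; 0ℚ; 1ℚ; toℚᵘ; _+_; _*_; _/_)
  open import Data.Rational.Properties using (toℚᵘ-fromℚᵘ; toℚᵘ-injective; toℚᵘ-homo-+; toℚᵘ-homo-*)
  import Data.Rational.Unnormalised as ℚᵘ
  import Data.Rational.Unnormalised.Properties as ℚᵘₚ
  open import Relation.Binary.PropositionalEquality using (_≡_; refl; sym; trans; cong; cong₂)

  -- Opaque, so that the normalisation of fractions does not hamper unification.
  opaque
    cast : ℕ → ℚ
    cast n = + n / 1

    cast-/ : ∀ n → cast n ≡ + n / 1
    cast-/ n = refl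

    cast-0 : cast 0 ≡ 0ℚ
    cast-0 = refl

    cast-1 : cast 1 ≡ 1ℚ
    cast-1 = refl

  -- The operations of ℚ divide out a gcd and so do not compute on variables. Identities are
  -- verified among unnormalised fractions, where equality is cross-multiplication; this is the
  -- passage between the two.
  toℚᵘ-/ : ∀ a d .{{_ : NonZero d}} → toℚᵘ (+ a / d) ℚᵘ.≃ (+ a ℚᵘ./ d)
  toℚᵘ-/ a (suc d) = toℚᵘ-fromℚᵘ (ℚᵘ.mkℚᵘ (+ a) d)

  opaque
    unfolding cast

    cast-+ : ∀ a b → cast (a ℕ.+ b) ≡ cast a + cast b
    cast-+ a b = toℚᵘ-injective (begin-equality
      toℚᵘ (cast (a ℕ.+ b))              ≃⟨ toℚᵘ-/ (a ℕ.+ b) 1 ⟩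
      + (a ℕ.+ b) ℚᵘ./ 1                 ≃⟨ ℚᵘ.*≡* (cong (ℤ._* + 1) (trans (ℤₚ.pos-+ a b) (sym (cong₂ ℤ._+_ (ℤₚ.*-identityʳ (+ a)) (ℤₚ.*-identityʳ (+ b)))))) ⟩
      (+ a ℚᵘ./ 1) ℚᵘ.+ (+ b ℚᵘ./ 1)     ≃⟨ ℚᵘₚ.+-cong (toℚᵘ-/ a 1) (toℚᵘ-/ b 1) ⟨
      toℚᵘ (cast a) ℚᵘ.+ toℚᵘ (cast b)   ≃⟨ toℚᵘ-homo-+ (cast a) (cast b) ⟨
      toℚᵘ (cast a + cast b)             ∎)
      where open ℚᵘₚ.≤-Reasoning

    cast-* : ∀ a b → cast (a ℕ.* b) ≡ cast a * cast b
    cast-* a b = toℚᵘ-injective (begin-equality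
      toℚᵘ (cast (a ℕ.* b))              ≃⟨ toℚᵘ-/ (a ℕ.* b) 1 ⟩
      + (a ℕ.* b) ℚᵘ./ 1                 ≃⟨ ℚᵘ.*≡* (cong (ℤ._* + 1) (ℤₚ.pos-* a b)) ⟩
      (+ a ℚᵘ./ 1) ℚᵘ.* (+ b ℚᵘ./ 1)     ≃⟨ ℚᵘₚ.*-cong (toℚᵘ-/ a 1) (toℚᵘ-/ b 1) ⟨
      toℚᵘ (cast a) ℚᵘ.* toℚᵘ (cast b)   ≃⟨ toℚᵘ-homo-* (cast a) (cast b) ⟨
      toℚᵘ (cast a * cast b)             ∎)
      where open ℚᵘₚ.≤-Reasoning

    /-*-cast : ∀ a d .{{_ : NonZero d}} → (+ a / d) * cast d ≡ cast a
    /-*-cast a d@(suc d-1) = toℚᵘ-injective (begin-equality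
      toℚᵘ ((+ a / d) * cast d)          ≃⟨ toℚᵘ-homo-* (+ a / d) (cast d) ⟩
      toℚᵘ (+ a / d) ℚᵘ.* toℚᵘ (cast d)  ≃⟨ ℚᵘₚ.*-cong (toℚᵘ-/ a d) (toℚᵘ-/ d 1) ⟩
      (+ a ℚᵘ./ d) ℚᵘ.* (+ d ℚᵘ./ 1)     ≃⟨ ℚᵘ.*≡* (trans (ℤₚ.*-identityʳ _) (cong (λ e → + a ℤ.* + e) (sym (ℕₚ.*-identityʳ d)))) ⟩
      + a ℚᵘ./ 1                         ≃⟨ toℚᵘ-/ a 1 ⟨
      toℚᵘ (cast a)                      ∎)
      where open ℚᵘₚ.≤-Reasoning

-- Counting as summation of indicators.

module Counting where
  open import Algebra.Structures using (IsCommutativeRing)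
  open import Data.Nat using (ℕ; suc)
  import Data.Nat.Properties as ℕₚ
  open import Data.List using (List; []; _∷_; filter; length)
  open import Data.Rational using (ℚ; 1ℚ; _*_)
  import Data.Rational as ℚ
  import Data.Rational.Properties as ℚₚ
  open import Relation.Binary.PropositionalEquality using (_≡_; refl; sym; trans; cong)
  open import Relation.Nullary using (Dec; yes; no)
  open Summation
  open Cast

  module ∑ᴺ = Sum ℕₚ.+-*-isCommutativeSemiring
  module ∑ꟴ = Sum (IsCommutativeRing.isCommutativeSemiring ℚₚ.+-*-isCommutativeRing)

  private
    variable
      I : Set

  count : {P : I → Set} → (∀ x → Dec (P x)) → List I → ℕ
  count P? xs = ∑ᴺ.∑ xs (λ x → ∑ᴺ.when (P? x) 1)

  length-filter : ∀ {P : I → Set} (P? : ∀ x → Dec (P x)) xs → length (filter P? xs) ≡ count P? xs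
  length-filter P? [] = refl
  length-filter P? (x ∷ xs) with P? x
  ... | yes _ = cong suc (length-filter P? xs)
  ... | no  _ = length-filter P? xs

  cast-∑ : ∀ (xs : List I) (f : I → ℕ) → cast (∑ᴺ.∑ xs f) ≡ ∑ꟴ.∑ xs (λ x → cast (f x))
  cast-∑ []       f = cast-0
  cast-∑ (x ∷ xs) f = trans (cast-+ (f x) _) (cong (cast (f x) ℚ.+_) (cast-∑ xs f))

  cast-when : ∀ {P : Set} (d : Dec P) a → cast (∑ᴺ.when d a) ≡ ∑ꟴ.when d (cast a)
  cast-when (yes _) a = refl
  cast-when (no  _) a = cast-0

  cast-count : ∀ {P : I → Set} (P? : ∀ x → Dec (P x)) xs → cast (count P? xs) ≡ ∑ꟴ.∑ xs (λ x → ∑ꟴ.when (P? x) 1ℚ)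
  cast-count P? xs = trans (cast-∑ xs _) (∑ꟴ.∑-cong xs (λ x → trans (cast-when (P? x) 1) (cong (∑ꟴ.when (P? x)) cast-1)))

  ∑-when-const : ∀ {P : I → Set} (P? : ∀ x → Dec (P x)) xs v →
                 ∑ꟴ.∑ xs (λ x → ∑ꟴ.when (P? x) v) ≡ cast (count P? xs) * v
  ∑-when-const P? xs v = sym (trans (cong (_* v) (cast-count P? xs))
    (trans (∑ꟴ.∑-* xs v) (∑ꟴ.∑-cong xs (λ x →
      trans (∑ꟴ.when-* (P? x) v) (cong (∑ꟴ.when (P? x)) (ℚₚ.*-identityˡ v))))))

-- Power series, the Euler operator and the exponential.

module PowerSeries where
  open import Defs
  open import Data.Fin as Fin using (Fin)
  import Data.Integer as ℤ
  open import Data.List using (upTo)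
  open import Data.List.Relation.Unary.All using ([]; _∷_)
  open import Data.Nat as ℕ using (ℕ; zero; suc; _∸_; _!; _≤_; _<_; s≤s; z<s)
  import Data.Nat.Properties as ℕₚ
  open import Data.Rational using (ℚ; 0ℚ; 1ℚ; _+_; _*_; _/_)
  import Data.Rational.Properties as ℚₚ
  open import Data.Vec using (Vec; []; _∷_; lookup; replicate)
  import Data.Vec.Properties as Vecₚ
  open import Data.Vec.Relation.Binary.Pointwise.Inductive as PW using (Pointwise; []; _∷_)
  open import Relation.Binary.PropositionalEquality using (_≡_; _≢_; refl; sym; trans; cong; cong₂; subst; module ≡-Reasoning)
  open import Relation.Nullary using (yes; no)
  open Summation
  open Cast
  open Counting using (module ∑ꟴ)
  open ∑ꟴ
  open ≡-Reasoning

  *-swap : ∀ x y z → x * (y * z) ≡ y * (x * z)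
  *-swap x y z = trans (sym (ℚₚ.*-assoc x y z)) (trans (cong (_* z) (ℚₚ.*-comm x y)) (ℚₚ.*-assoc y x z))

  private
    variable
      n : ℕ

  -- Associativity and commutativity in the combination that the rule for θ of a power uses: both
  -- sides are sums over a + b ≤ c.
  *S-leftComm : ∀ (f g h : Series n) c → (f *S (g *S h)) c ≡ (g *S (f *S h)) c
  *S-leftComm f g h c = begin
    ∑ (below c) (λ a → f a * ∑ (below (c ∸ᵛ a)) (λ b → g b * h ((c ∸ᵛ a) ∸ᵛ b)))
      ≡⟨ ∑-cong (below c) (λ a → *-∑ (f a) (below (c ∸ᵛ a))) ⟩
    ∑ (below c) (λ a → ∑ (below (c ∸ᵛ a)) (λ b → f a * (g b * h ((c ∸ᵛ a) ∸ᵛ b))))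
      ≡⟨ ∑-below-triangle c _ ⟩
    ∑ (below c) (λ b → ∑ (below (c ∸ᵛ b)) (λ a → f a * (g b * h ((c ∸ᵛ a) ∸ᵛ b))))
      ≡⟨ ∑-cong (below c) (λ b → ∑-cong (below (c ∸ᵛ b)) (λ a →
           trans (*-swap (f a) (g b) _) (cong (λ e → g b * (f a * h e)) (∸ᵛ-comm c a b)))) ⟩
    ∑ (below c) (λ b → ∑ (below (c ∸ᵛ b)) (λ a → g b * (f a * h ((c ∸ᵛ b) ∸ᵛ a))))
      ≡⟨ ∑-cong (below c) (λ b → *-∑ (g b) (below (c ∸ᵛ b))) ⟨
    ∑ (below c) (λ b → g b * ∑ (below (c ∸ᵛ b)) (λ a → f a * h ((c ∸ᵛ b) ∸ᵛ a))) ∎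

  monomial-when : ∀ (a c : Vec ℕ n) → monomial a c ≡ when (Vecₚ.≡-dec ℕ._≟_ c a) 1ℚ
  monomial-when a c with Vecₚ.≡-dec ℕ._≟_ c a
  ... | yes _ = refl
  ... | no  _ = refl

  monomial-≢ : ∀ {a c : Vec ℕ n} → c ≢ a → monomial a c ≡ 0ℚ
  monomial-≢ {a = a} {c} c≢a = trans (monomial-when a c) (when-no (Vecₚ.≡-dec ℕ._≟_ c a) c≢a)

  -- The Euler operator t_i ∂/∂t_i.
  θ : Fin n → Series n → Series n
  θ i f c = cast (lookup c i) * f c

  -- In the term indexed by a, the exponent cᵢ splits as aᵢ + (cᵢ - aᵢ), one summand for each
  -- factor; this is the Leibniz rule.
  θ-*S : ∀ i (f g : Series n) c → θ i (f *S g) c ≡ (θ i f *S g) c + (f *S θ i g) c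
  θ-*S i f g c = begin
    cast (lookup c i) * ∑ (below c) (λ a → f a * g (c ∸ᵛ a))
      ≡⟨ *-∑ (cast (lookup c i)) (below c) ⟩
    ∑ (below c) (λ a → cast (lookup c i) * (f a * g (c ∸ᵛ a)))
      ≡⟨ ∑-below-cong c leibniz ⟩
    ∑ (below c) (λ a → θ i f a * g (c ∸ᵛ a) + f a * θ i g (c ∸ᵛ a))
      ≡⟨ ∑-+ (below c) ⟩
    (θ i f *S g) c + (f *S θ i g) c ∎
    where
    leibniz : ∀ a → Pointwise _≤_ a c →
              cast (lookup c i) * (f a * g (c ∸ᵛ a)) ≡ θ i f a * g (c ∸ᵛ a) + f a * θ i g (c ∸ᵛ a)
    leibniz a a≤c = begin
      cast (lookup c i) * (f a * g (c ∸ᵛ a))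
        ≡⟨ cong (λ e → cast e * (f a * g (c ∸ᵛ a))) (sym (ℕₚ.m+[n∸m]≡n (PW.lookup a≤c i))) ⟩
      cast (lookup a i ℕ.+ (lookup c i ∸ lookup a i)) * (f a * g (c ∸ᵛ a))
        ≡⟨ cong (λ e → cast (lookup a i ℕ.+ e) * (f a * g (c ∸ᵛ a))) (sym (Vecₚ.lookup-zipWith _∸_ i c a)) ⟩
      cast (lookup a i ℕ.+ lookup (c ∸ᵛ a) i) * (f a * g (c ∸ᵛ a))
        ≡⟨ cong (_* (f a * g (c ∸ᵛ a))) (cast-+ (lookup a i) _) ⟩
      (cast (lookup a i) + cast (lookup (c ∸ᵛ a) i)) * (f a * g (c ∸ᵛ a))
        ≡⟨ ℚₚ.*-distribʳ-+ (f a * g (c ∸ᵛ a)) (cast (lookup a i)) (cast (lookup (c ∸ᵛ a) i)) ⟩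
      cast (lookup a i) * (f a * g (c ∸ᵛ a)) + cast (lookup (c ∸ᵛ a) i) * (f a * g (c ∸ᵛ a))
        ≡⟨ cong₂ _+_ (sym (ℚₚ.*-assoc (cast (lookup a i)) _ _)) (*-swap (cast (lookup (c ∸ᵛ a) i)) (f a) (g (c ∸ᵛ a))) ⟩
      θ i f a * g (c ∸ᵛ a) + f a * θ i g (c ∸ᵛ a) ∎

  θ-oneS : ∀ i (c : Vec ℕ n) → θ i oneS c ≡ 0ℚ
  θ-oneS {n} i c with Vecₚ.≡-dec ℕ._≟_ c (replicate n 0)
  ... | no  _    = ℚₚ.*-zeroʳ (cast (lookup c i))
  ... | yes refl = trans (cong (λ e → cast e * 1ℚ) (Vecₚ.lookup-replicate i 0)) (trans (cong (_* 1ℚ) cast-0) (ℚₚ.*-zeroˡ 1ℚ))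

  *S-cong : ∀ (f : Series n) {g h} → (∀ c → g c ≡ h c) → ∀ c → (f *S g) c ≡ (f *S h) c
  *S-cong f g≡h c = ∑-cong (below c) (λ a → cong (f a *_) (g≡h (c ∸ᵛ a)))

  *S-scale : ∀ (f g : Series n) q c → (f *S (q ·S g)) c ≡ q * (f *S g) c
  *S-scale f g q c = trans (∑-cong (below c) (λ a → *-swap (f a) q _)) (sym (*-∑ q (below c)))

  -- By the Leibniz rule one term has θ on the first factor; the other is, by induction, a multiple
  -- of the same product once f is moved past θ f.
  θ-^S : ∀ i (f : Series n) m c → θ i (f ^S suc m) c ≡ cast (suc m) * (θ i f *S (f ^S m)) c
  θ-^S i f zero c = begin
    θ i (f *S oneS) c                         ≡⟨ θ-*S i f oneS c ⟩
    (θ i f *S oneS) c + (f *S θ i oneS) c     ≡⟨ cong ((θ i f *S oneS) c +_) (∑-zero (below c) (λ a → trans (cong (f a *_) (θ-oneS i (c ∸ᵛ a))) (ℚₚ.*-zeroʳ (f a)))) ⟩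
    (θ i f *S oneS) c + 0ℚ                    ≡⟨ ℚₚ.+-identityʳ _ ⟩
    (θ i f *S oneS) c                         ≡⟨ ℚₚ.*-identityˡ _ ⟨
    1ℚ * (θ i f *S oneS) c                    ≡⟨ cong (_* (θ i f *S oneS) c) cast-1 ⟨
    cast 1 * (θ i f *S oneS) c                ∎
  θ-^S i f (suc m) c = begin
    θ i (f *S (f ^S suc m)) c
      ≡⟨ θ-*S i f (f ^S suc m) c ⟩
    X + (f *S θ i (f ^S suc m)) c
      ≡⟨ cong (X +_) (*S-cong f (θ-^S i f m) c) ⟩
    X + (f *S (cast (suc m) ·S (θ i f *S (f ^S m)))) c
      ≡⟨ cong (X +_) (*S-scale f (θ i f *S (f ^S m)) (cast (suc m)) c) ⟩
    X + cast (suc m) * (f *S (θ i f *S (f ^S m))) c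
      ≡⟨ cong (λ e → X + cast (suc m) * e) (*S-leftComm f (θ i f) (f ^S m) c) ⟩
    X + cast (suc m) * X
      ≡⟨ cong (_+ cast (suc m) * X) (ℚₚ.*-identityˡ X) ⟨
    1ℚ * X + cast (suc m) * X
      ≡⟨ ℚₚ.*-distribʳ-+ X 1ℚ (cast (suc m)) ⟨
    (1ℚ + cast (suc m)) * X
      ≡⟨ cong (_* X) (trans (cast-+ 1 (suc m)) (cong (_+ cast (suc m)) cast-1)) ⟨
    cast (suc (suc m)) * X ∎
    where X = (θ i f *S (f ^S suc m)) c

  totalDegree-∸ᵛ : ∀ {a c : Vec ℕ n} → Pointwise _≤_ a c → totalDegree a ℕ.+ totalDegree (c ∸ᵛ a) ≡ totalDegree c
  totalDegree-∸ᵛ []                                   = refl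
  totalDegree-∸ᵛ {a = y ∷ a} {x ∷ c} (y≤x ∷ a≤c) = begin
    (y ℕ.+ A) ℕ.+ ((x ∸ y) ℕ.+ C)   ≡⟨ ℕₚ.+-assoc y A _ ⟩
    y ℕ.+ (A ℕ.+ ((x ∸ y) ℕ.+ C))   ≡⟨ cong (y ℕ.+_) (ℕₚ.+-assoc A (x ∸ y) C) ⟨
    y ℕ.+ ((A ℕ.+ (x ∸ y)) ℕ.+ C)   ≡⟨ cong (λ e → y ℕ.+ (e ℕ.+ C)) (ℕₚ.+-comm A (x ∸ y)) ⟩
    y ℕ.+ (((x ∸ y) ℕ.+ A) ℕ.+ C)   ≡⟨ cong (y ℕ.+_) (ℕₚ.+-assoc (x ∸ y) A C) ⟩
    y ℕ.+ ((x ∸ y) ℕ.+ (A ℕ.+ C))   ≡⟨ ℕₚ.+-assoc y (x ∸ y) _ ⟨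
    (y ℕ.+ (x ∸ y)) ℕ.+ (A ℕ.+ C)   ≡⟨ cong₂ ℕ._+_ (ℕₚ.m+[n∸m]≡n y≤x) (totalDegree-∸ᵛ a≤c) ⟩
    x ℕ.+ totalDegree c             ∎
    where
    A = totalDegree a
    C = totalDegree (c ∸ᵛ a)

  totalDegree≡0 : (a : Vec ℕ n) → totalDegree a ≡ 0 → a ≡ replicate n 0
  totalDegree≡0 []         _  = refl
  totalDegree≡0 (zero ∷ a) eq = cong (0 ∷_) (totalDegree≡0 a eq)

  lookup≤totalDegree : ∀ (a : Vec ℕ n) i → lookup a i ≤ totalDegree a
  lookup≤totalDegree (x ∷ a) Fin.zero    = ℕₚ.m≤m+n x _
  lookup≤totalDegree (x ∷ a) (Fin.suc i) = ℕₚ.≤-trans (lookup≤totalDegree a i) (ℕₚ.m≤n+m _ x)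

  totalDegree-∸ᵛ-< : ∀ {a c : Vec ℕ n} → Pointwise _≤_ a c → 0 < totalDegree a → totalDegree (c ∸ᵛ a) < totalDegree c
  totalDegree-∸ᵛ-< {a = a} {c} a≤c 0<a =
    subst (totalDegree (c ∸ᵛ a) <_) (totalDegree-∸ᵛ a≤c) (ℕₚ.+-monoˡ-≤ (totalDegree (c ∸ᵛ a)) 0<a)

  -- Without a constant term, each of the m factors contributes degree at least 1. This makes the
  -- truncation in `expS` harmless.
  ^S-vanish : ∀ (f : Series n) → f (replicate n 0) ≡ 0ℚ → ∀ m c → totalDegree c < m → (f ^S m) c ≡ 0ℚ
  ^S-vanish {n} f f₀ (suc m) c (s≤s c≤m) = trans (∑-below-cong c vanish) (∑-0 (below c))
    where
    vanish : ∀ a → Pointwise _≤_ a c → f a * (f ^S m) (c ∸ᵛ a) ≡ 0ℚ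
    vanish a a≤c with totalDegree a ℕ.≟ 0
    ... | yes eq = trans (cong (_* (f ^S m) (c ∸ᵛ a)) (trans (cong f (totalDegree≡0 a eq)) f₀)) (ℚₚ.*-zeroˡ ((f ^S m) (c ∸ᵛ a)))
    ... | no neq = trans (cong (f a *_) (^S-vanish f f₀ m (c ∸ᵛ a)
                     (ℕₚ.<-≤-trans (totalDegree-∸ᵛ-< a≤c (ℕₚ.n≢0⇒n>0 neq)) c≤m))) (ℚₚ.*-zeroʳ (f a))

  1/_! : ℕ → ℚ
  1/ m ! = (ℤ.1ℤ / (m !)) {{m ℕₚ.!≢0}}

  1/!-* : ∀ m → 1/ m ! * cast (m !) ≡ 1ℚ
  1/!-* m = trans (/-*-cast 1 (m !) {{m ℕₚ.!≢0}}) cast-1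

  1/suc! : ∀ m → 1/ suc m ! * cast (suc m) ≡ 1/ m !
  1/suc! m = begin
    1/ suc m ! * cast (suc m)                          ≡⟨ ℚₚ.*-identityʳ _ ⟨
    1/ suc m ! * cast (suc m) * 1ℚ                     ≡⟨ cong (1/ suc m ! * cast (suc m) *_) (trans (ℚₚ.*-comm (cast (m !)) (1/ m !)) (1/!-* m)) ⟨
    1/ suc m ! * cast (suc m) * (cast (m !) * 1/ m !)  ≡⟨ ℚₚ.*-assoc (1/ suc m ! * cast (suc m)) (cast (m !)) (1/ m !) ⟨
    1/ suc m ! * cast (suc m) * cast (m !) * 1/ m !    ≡⟨ cong (_* 1/ m !) (ℚₚ.*-assoc (1/ suc m !) (cast (suc m)) (cast (m !))) ⟩
    1/ suc m ! * (cast (suc m) * cast (m !)) * 1/ m !  ≡⟨ cong (λ e → 1/ suc m ! * e * 1/ m !) (cast-* (suc m) (m !)) ⟨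
    1/ suc m ! * cast (suc m !) * 1/ m !               ≡⟨ cong (_* 1/ m !) (1/!-* (suc m)) ⟩
    1ℚ * 1/ m !                                        ≡⟨ ℚₚ.*-identityˡ _ ⟩
    1/ m !                                             ∎

  -- Term by term, θ sends f^m/m! to θ f · f^(m-1)/(m-1)!. The term m = 0 drops out, so the powers
  -- shift down by one and the range m ≤ |c| becomes m < |c|.
  θ-expS : ∀ i (f : Series n) → f (replicate n 0) ≡ 0ℚ → ∀ c →
           θ i (expS f) c ≡ (θ i f *S expS f) c
  θ-expS {n} i f f₀ c = begin
    cast (lookup c i) * ∑ (upTo (suc N)) (λ m → 1/ m ! * (f ^S m) c)
      ≡⟨ *-∑ (cast (lookup c i)) (upTo (suc N)) ⟩
    ∑ (upTo (suc N)) (λ m → cast (lookup c i) * (1/ m ! * (f ^S m) c))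
      ≡⟨ ∑-cong (upTo (suc N)) (λ m → *-swap (cast (lookup c i)) (1/ m !) ((f ^S m) c)) ⟩
    ∑ (upTo (suc N)) (λ m → 1/ m ! * θ i (f ^S m) c)
      ≡⟨ ∑-upTo-suc N {λ m → 1/ m ! * θ i (f ^S m) c} ⟩
    1/ 0 ! * θ i oneS c + ∑ (upTo N) (λ m → 1/ suc m ! * θ i (f ^S suc m) c)
      ≡⟨ cong₂ _+_ (trans (cong (1/ 0 ! *_) (θ-oneS i c)) (ℚₚ.*-zeroʳ (1/ 0 !))) (∑-cong (upTo N) step) ⟩
    0ℚ + ∑ (upTo N) (λ m → 1/ m ! * (θ i f *S (f ^S m)) c)
      ≡⟨ ℚₚ.+-identityˡ _ ⟩
    ∑ (upTo N) (λ m → 1/ m ! * (θ i f *S (f ^S m)) c)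
      ≡⟨ ∑-cong (upTo N) (λ m → trans (*-∑ (1/ m !) (below c)) (∑-cong (below c) (λ a → *-swap (1/ m !) (θ i f a) ((f ^S m) (c ∸ᵛ a))))) ⟩
    ∑ (upTo N) (λ m → ∑ (below c) (λ a → θ i f a * (1/ m ! * (f ^S m) (c ∸ᵛ a))))
      ≡⟨ ∑-swap (upTo N) (below c) ⟩
    ∑ (below c) (λ a → ∑ (upTo N) (λ m → θ i f a * (1/ m ! * (f ^S m) (c ∸ᵛ a))))
      ≡⟨ ∑-cong (below c) (λ a → sym (*-∑ (θ i f a) (upTo N))) ⟩
    ∑ (below c) (λ a → θ i f a * ∑ (upTo N) (λ m → 1/ m ! * (f ^S m) (c ∸ᵛ a)))
      ≡⟨ ∑-below-cong c truncate ⟩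
    (θ i f *S expS f) c ∎
    where
    N = totalDegree c

    step : ∀ m → 1/ suc m ! * θ i (f ^S suc m) c ≡ 1/ m ! * (θ i f *S (f ^S m)) c
    step m = trans (cong (1/ suc m ! *_) (θ-^S i f m c))
      (trans (sym (ℚₚ.*-assoc (1/ suc m !) (cast (suc m)) _)) (cong (_* (θ i f *S (f ^S m)) c) (1/suc! m)))

    -- `expS` at c - a has only the powers m ≤ |c - a|. If aᵢ = 0, the factor θ i f a is 0; if aᵢ >
    -- 0, then |c - a| < |c| and the additional powers vanish for degree reasons.
    truncate : ∀ a → Pointwise _≤_ a c →
               θ i f a * ∑ (upTo N) (λ m → 1/ m ! * (f ^S m) (c ∸ᵛ a)) ≡ θ i f a * expS f (c ∸ᵛ a)
    truncate a a≤c with lookup a i in aᵢ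
    ... | zero  = trans (zero* _) (sym (zero* _))
      where
      zero* : ∀ q → cast 0 * f a * q ≡ 0ℚ
      zero* q = trans (cong (_* q) (trans (cong (_* f a) cast-0) (ℚₚ.*-zeroˡ (f a)))) (ℚₚ.*-zeroˡ q)
    ... | suc y = cong (cast (suc y) * f a *_) (∑-upTo-extend
      (totalDegree-∸ᵛ-< a≤c (ℕₚ.<-≤-trans (subst (0 <_) (sym aᵢ) z<s) (lookup≤totalDegree a i)))
      (λ m lt → trans (cong (1/ m ! *_) (^S-vanish f f₀ m (c ∸ᵛ a) lt)) (ℚₚ.*-zeroʳ (1/ m !))))

-- The recurrence for the coefficients of the exponential.

module Recurrence where
  open import Defs
  open import Data.Fin as Fin using (Fin; toℕ)
  import Data.Integer as ℤ
  open import Data.List using (upTo; allFin)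
  open import Data.Nat as ℕ using (ℕ; zero; suc; _∸_; _^_; _!; _≤_; _<_; z≤n; s≤s)
  import Data.Nat.Properties as ℕₚ
  open import Data.Nat.Divisibility using (∣⇒≤)
  open import Data.Nat.GCD using (gcd; gcd[m,n]∣n)
  open import Data.Rational using (ℚ; 0ℚ; 1ℚ; _+_; _*_; _/_)
  import Data.Rational.Properties as ℚₚ
  open import Data.Vec as Vec using (Vec; []; _∷_; lookup; replicate; _[_]≔_)
  import Data.Vec.Properties as Vecₚ
  open import Data.Vec.Relation.Binary.Pointwise.Inductive as PW using (Pointwise; []; _∷_)
  open import Function using (_∘_)
  open import Relation.Binary.PropositionalEquality using (_≡_; _≢_; refl; sym; trans; cong; cong₂; subst; subst₂; module ≡-Reasoning)
  open import Relation.Nullary using (yes; no)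
  open Summation
  open Cast
  open Counting using (module ∑ꟴ)
  open ∑ꟴ
  open PowerSeries
  open ≡-Reasoning

  private
    variable
      n : ℕ

  0≤ᵛ : (c : Vec ℕ n) → Pointwise _≤_ (replicate n 0) c
  0≤ᵛ []      = []
  0≤ᵛ (_ ∷ c) = z≤n ∷ 0≤ᵛ c

  single-≤ : ∀ (c : Vec ℕ n) i {g} → g ≤ lookup c i → Pointwise _≤_ (replicate n 0 [ i ]≔ g) c
  single-≤ (x ∷ c) Fin.zero    g≤ = g≤ ∷ 0≤ᵛ c
  single-≤ (x ∷ c) (Fin.suc i) g≤ = z≤n ∷ single-≤ c i g≤

  ∸ᵛ-0 : (c : Vec ℕ n) → c ∸ᵛ replicate n 0 ≡ c
  ∸ᵛ-0 []      = refl
  ∸ᵛ-0 (x ∷ c) = cong (x ∷_) (∸ᵛ-0 c)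

  ∸ᵛ-single : ∀ (d : Vec ℕ n) i x g → (d [ i ]≔ x) ∸ᵛ (replicate n 0 [ i ]≔ g) ≡ d [ i ]≔ (x ∸ g)
  ∸ᵛ-single (_ ∷ d) Fin.zero    x g = cong (_ ∷_) (∸ᵛ-0 d)
  ∸ᵛ-single (y ∷ d) (Fin.suc i) x g = cong (y ∷_) (∸ᵛ-single d i x g)

  vfact : Vec ℕ n → ℕ
  vfact c = Vec.foldr _ ℕ._*_ 1 (Vec.map _! c)

  vfact-suc : ∀ (d : Vec ℕ n) i p → vfact (d [ i ]≔ suc p) ≡ suc p ℕ.* vfact (d [ i ]≔ p)
  vfact-suc (_ ∷ d) Fin.zero    p = ℕₚ.*-assoc (suc p) (p !) (vfact d)
  vfact-suc (y ∷ d) (Fin.suc i) p = begin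
    y ! ℕ.* vfact (d [ i ]≔ suc p)             ≡⟨ cong (y ! ℕ.*_) (vfact-suc d i p) ⟩
    y ! ℕ.* (suc p ℕ.* vfact (d [ i ]≔ p))     ≡⟨ ℕₚ.*-assoc (y !) (suc p) _ ⟨
    y ! ℕ.* suc p ℕ.* vfact (d [ i ]≔ p)       ≡⟨ cong (ℕ._* vfact (d [ i ]≔ p)) (ℕₚ.*-comm (y !) (suc p)) ⟩
    suc p ℕ.* y ! ℕ.* vfact (d [ i ]≔ p)       ≡⟨ ℕₚ.*-assoc (suc p) (y !) _ ⟩
    suc p ℕ.* (y ! ℕ.* vfact (d [ i ]≔ p))     ∎

  -- u p g = Σ_h κ(g+h) ℓ^h F(p-h), in Horner form.
  module Horner (κ : ℕ → ℚ) (ℓ : ℕ) (F : ℕ → ℚ) where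

    u : ℕ → ℕ → ℚ
    u zero    g = κ g * F 0
    u (suc p) g = κ g * F (suc p) + cast ℓ * u p (suc g)

    u-0 : ∀ p g → (∀ h → κ (g ℕ.+ h) ≡ 0ℚ) → u p g ≡ 0ℚ
    u-0 p g κ≡0 with subst (λ e → κ e ≡ 0ℚ) (ℕₚ.+-identityʳ g) (κ≡0 0)
    u-0 zero    g κ≡0 | κg = trans (cong (_* F 0) κg) (ℚₚ.*-zeroˡ (F 0))
    u-0 (suc p) g κ≡0 | κg = trans (cong₂ _+_
      (trans (cong (_* F (suc p)) κg) (ℚₚ.*-zeroˡ (F (suc p))))
      (trans (cong (cast ℓ *_) (u-0 p (suc g) (λ h → subst (λ e → κ e ≡ 0ℚ) (ℕₚ.+-suc g h) (κ≡0 (suc h))))) (ℚₚ.*-zeroʳ (cast ℓ))))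
      (ℚₚ.+-identityˡ 0ℚ)

    summand : ℕ → ℕ → ℕ → ℚ
    summand p g h = κ (g ℕ.+ h) * cast (ℓ ^ h) * when (h ℕ.≤? p) (F (p ∸ h))

    summand-0 : ∀ p g → summand p g 0 ≡ κ g * F p
    summand-0 p g = cong (_* F p) (trans (cong₂ _*_ (cong κ (ℕₚ.+-identityʳ g)) cast-1) (ℚₚ.*-identityʳ (κ g)))

    -- Two cut-offs meet: the sum stops at N, from where on κ vanishes, and `u` stops at h = p,
    -- beyond which there is no F(p-h). Neither loses a term. Taking out h = 0 and a factor ℓ from
    -- the rest is the Horner step.
    u-expand : ∀ N p g → (∀ h → N ≤ h → κ (g ℕ.+ h) ≡ 0ℚ) → ∑ (upTo N) (summand p g) ≡ u p g
    u-expand zero    p       g κ≡0 = sym (u-0 p g (λ h → κ≡0 h z≤n))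
    u-expand (suc N) zero    g κ≡0 = begin
      ∑ (upTo (suc N)) (summand 0 g)                   ≡⟨ ∑-upTo-suc N {summand 0 g} ⟩
      summand 0 g 0 + ∑ (upTo N) (summand 0 g ∘ suc)   ≡⟨ cong₂ _+_ (summand-0 0 g) (∑-zero (upTo N) (λ h → ℚₚ.*-zeroʳ (κ (g ℕ.+ suc h) * cast (ℓ ^ suc h)))) ⟩
      κ g * F 0 + 0ℚ                                   ≡⟨ ℚₚ.+-identityʳ _ ⟩
      κ g * F 0                                        ∎
    u-expand (suc N) (suc p) g κ≡0 = begin
      ∑ (upTo (suc N)) (summand (suc p) g)
        ≡⟨ ∑-upTo-suc N {summand (suc p) g} ⟩
      summand (suc p) g 0 + ∑ (upTo N) (summand (suc p) g ∘ suc)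
        ≡⟨ cong₂ _+_ (summand-0 (suc p) g) (∑-cong (upTo N) shift) ⟩
      κ g * F (suc p) + ∑ (upTo N) (λ h → cast ℓ * summand p (suc g) h)
        ≡⟨ cong (κ g * F (suc p) +_) (sym (*-∑ (cast ℓ) (upTo N) {summand p (suc g)})) ⟩
      κ g * F (suc p) + cast ℓ * ∑ (upTo N) (summand p (suc g))
        ≡⟨ cong (λ e → κ g * F (suc p) + cast ℓ * e)
             (u-expand N p (suc g) (λ h N≤h → subst (λ e → κ e ≡ 0ℚ) (ℕₚ.+-suc g h) (κ≡0 (suc h) (s≤s N≤h)))) ⟩
      κ g * F (suc p) + cast ℓ * u p (suc g) ∎
      where
      shift : ∀ h → summand (suc p) g (suc h) ≡ cast ℓ * summand p (suc g) h
      shift h = begin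
        κ (g ℕ.+ suc h) * cast (ℓ ℕ.* ℓ ^ h) * when (suc h ℕ.≤? suc p) (F (p ∸ h))
          ≡⟨ cong₂ _*_ (cong₂ _*_ (cong κ (ℕₚ.+-suc g h)) (cast-* ℓ (ℓ ^ h)))
               (when-cong (suc h ℕ.≤? suc p) (h ℕ.≤? p) ℕ.s≤s⁻¹ s≤s (λ _ → refl)) ⟩
        K * (cast ℓ * L) * W    ≡⟨ cong (_* W) (*-swap K (cast ℓ) L) ⟩
        cast ℓ * (K * L) * W    ≡⟨ ℚₚ.*-assoc (cast ℓ) (K * L) W ⟩
        cast ℓ * (K * L * W)    ∎
        where
        K = κ (suc g ℕ.+ h)
        L = cast (ℓ ^ h)
        W = when (h ℕ.≤? p) (F (p ∸ h))

  module _ (k : ℕ) .{{_ : ℕ.NonZero k}} (w : ℕ → ℕ → ℚ) where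

    -- The weight restricted to G_k(ℓ) and extended by zero, so that sums over g need no side
    -- condition.
    κ : ℕ → ℕ → ℚ
    κ ℓ g = when (gcd (g ℕ.* ℓ) k ℕ.≟ g) (w ℓ g)

    κ-vanish : ∀ ℓ g → k < g → κ ℓ g ≡ 0ℚ
    κ-vanish ℓ g k<g = when-no (gcd (g ℕ.* ℓ) k ℕ.≟ g)
      (λ eq → ℕₚ.<⇒≱ k<g (subst (_≤ k) eq (∣⇒≤ (gcd[m,n]∣n (g ℕ.* ℓ) k))))

    single : Fin n → ℕ → Vec ℕ n
    single {n} i g = replicate n 0 [ i ]≔ g

    coeff : Fin n → ℕ → ℚ
    coeff i g′ = κ (suc (toℕ i)) (suc g′) * (ℤ.+ (suc (toℕ i) ^ g′) / suc g′)

    -- The local function `term` of `inner`, named by unification.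
    mutual
      innerTerm : ∀ n → Vec ℕ n → Fin n → ℕ → ℚ
      innerTerm = _

      inner-∑ : ∀ n (c : Vec ℕ n) → inner k w c ≡ ∑ (allFin n) (λ i → ∑ (upTo k) (λ g′ → innerTerm n c i g′))
      inner-∑ n c = refl

    innerTerm-coeff : ∀ (c : Vec ℕ n) i g′ → innerTerm n c i g′ ≡ coeff i g′ * monomial (single i (suc g′)) c
    innerTerm-coeff c i g′ with gcd (suc g′ ℕ.* suc (toℕ i)) k ℕ.≟ suc g′
    ... | yes p = cong (λ e → e * R * M) (sym (when-yes (gcd (suc g′ ℕ.* suc (toℕ i)) k ℕ.≟ suc g′) p))
      where
      R = ℤ.+ (suc (toℕ i) ^ g′) / suc g′
      M = monomial (single i (suc g′)) c
    ... | no ¬p = sym (trans (cong (λ e → e * R * M) (when-no (gcd (suc g′ ℕ.* suc (toℕ i)) k ℕ.≟ suc g′) ¬p))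
                        (trans (cong (_* M) (ℚₚ.*-zeroˡ R)) (ℚₚ.*-zeroˡ M)))
      where
      R = ℤ.+ (suc (toℕ i) ^ g′) / suc g′
      M = monomial (single i (suc g′)) c

    inner-coeff : ∀ (c : Vec ℕ n) →
                  inner k w c ≡ ∑ (allFin n) (λ i → ∑ (upTo k) (λ g′ → coeff i g′ * monomial (single i (suc g′)) c))
    inner-coeff {n} c = trans (inner-∑ n c) (∑-cong (allFin n) (λ i → ∑-cong (upTo k) (innerTerm-coeff c i)))

    single≢0 : ∀ (i : Fin n) g → replicate n 0 ≢ single i (suc g)
    single≢0 {n} i g eq = ℕₚ.0≢1+n (begin
      0                          ≡⟨ Vecₚ.lookup-replicate i 0 ⟨
      lookup (replicate n 0) i   ≡⟨ cong (λ v → lookup v i) eq ⟩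
      lookup (single i (suc g)) i ≡⟨ Vecₚ.lookup∘update i (replicate n 0) (suc g) ⟩
      suc g                      ∎)

    inner-0 : ∀ n → inner k w (replicate n 0) ≡ 0ℚ
    inner-0 n = trans (inner-coeff (replicate n 0)) (∑-zero (allFin n) (λ i → ∑-zero (upTo k) (λ g′ →
      trans (cong (coeff i g′ *_) (monomial-≢ (single≢0 i g′))) (ℚₚ.*-zeroʳ (coeff i g′)))))

    θ-monomial : ∀ i j g (a : Vec ℕ n) →
                 cast (lookup a i) * monomial (single j g) a ≡ when (j Fin.≟ i) (cast g * monomial (single j g) a)
    θ-monomial {n} i j g a with Vecₚ.≡-dec ℕ._≟_ a (single j g)
    ... | no  _    = trans (ℚₚ.*-zeroʳ (cast (lookup a i))) (sym (trans (cong (when (j Fin.≟ i)) (ℚₚ.*-zeroʳ (cast g))) (when-0 (j Fin.≟ i))))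
    ... | yes refl with j Fin.≟ i
    ...   | yes refl = cong (λ e → cast e * 1ℚ) (Vecₚ.lookup∘update i (replicate n 0) g)
    ...   | no  j≢i  = trans (cong (λ e → cast e * 1ℚ) (trans (Vecₚ.lookup∘update′ (j≢i ∘ sym) (replicate n 0) g) (Vecₚ.lookup-replicate i 0)))
                         (trans (cong (_* 1ℚ) cast-0) (ℚₚ.*-zeroˡ 1ℚ))

    coeff-* : ∀ (i : Fin n) g′ → coeff i g′ * cast (suc g′) ≡ κ (suc (toℕ i)) (suc g′) * cast (suc (toℕ i) ^ g′)
    coeff-* i g′ = trans (ℚₚ.*-assoc (κ (suc (toℕ i)) (suc g′)) _ (cast (suc g′)))
      (cong (κ (suc (toℕ i)) (suc g′) *_) (/-*-cast (suc (toℕ i) ^ g′) (suc g′)))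

    -- θ multiplies t_ℓ^g by g, which cancels the denominator of ℓ^(g-1)/g, and it kills the powers
    -- of all other variables.
    θ-inner : ∀ i (a : Vec ℕ n) → θ i (inner k w) a ≡
              ∑ (upTo k) (λ g′ → κ (suc (toℕ i)) (suc g′) * cast (suc (toℕ i) ^ g′) * monomial (single i (suc g′)) a)
    θ-inner {n} i a = begin
      cast (lookup a i) * inner k w a
        ≡⟨ cong (cast (lookup a i) *_) (inner-coeff a) ⟩
      cast (lookup a i) * ∑ (allFin n) (λ j → ∑ (upTo k) (λ g′ → coeff j g′ * mon j g′))
        ≡⟨ *-∑ (cast (lookup a i)) (allFin n) ⟩
      ∑ (allFin n) (λ j → cast (lookup a i) * ∑ (upTo k) (λ g′ → coeff j g′ * mon j g′))
        ≡⟨ ∑-cong (allFin n) (λ j → *-∑ (cast (lookup a i)) (upTo k)) ⟩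
      ∑ (allFin n) (λ j → ∑ (upTo k) (λ g′ → cast (lookup a i) * (coeff j g′ * mon j g′)))
        ≡⟨ ∑-cong (allFin n) (λ j → ∑-cong (upTo k) (λ g′ → pointwise j g′)) ⟩
      ∑ (allFin n) (λ j → ∑ (upTo k) (λ g′ → when (j Fin.≟ i) (C j g′ * mon j g′)))
        ≡⟨ ∑-swap (allFin n) (upTo k) ⟩
      ∑ (upTo k) (λ g′ → ∑ (allFin n) (λ j → when (j Fin.≟ i) (C j g′ * mon j g′)))
        ≡⟨ ∑-cong (upTo k) (λ g′ → enum-pick (enum-allFin n) i (λ j → C j g′ * mon j g′)) ⟩
      ∑ (upTo k) (λ g′ → C i g′ * mon i g′) ∎
      where
      mon : Fin n → ℕ → ℚ
      mon j g′ = monomial (single j (suc g′)) a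
      C : Fin n → ℕ → ℚ
      C j g′ = κ (suc (toℕ j)) (suc g′) * cast (suc (toℕ j) ^ g′)

      pointwise : ∀ j g′ → cast (lookup a i) * (coeff j g′ * mon j g′) ≡ when (j Fin.≟ i) (C j g′ * mon j g′)
      pointwise j g′ = begin
        cast (lookup a i) * (coeff j g′ * mon j g′)             ≡⟨ *-swap (cast (lookup a i)) (coeff j g′) (mon j g′) ⟩
        coeff j g′ * (cast (lookup a i) * mon j g′)             ≡⟨ cong (coeff j g′ *_) (θ-monomial i j (suc g′) a) ⟩
        coeff j g′ * when (j Fin.≟ i) (cast (suc g′) * mon j g′) ≡⟨ *-when (coeff j g′) (j Fin.≟ i) ⟩
        when (j Fin.≟ i) (coeff j g′ * (cast (suc g′) * mon j g′))
          ≡⟨ cong (when (j Fin.≟ i)) (trans (sym (ℚₚ.*-assoc (coeff j g′) (cast (suc g′)) (mon j g′))) (cong (_* mon j g′) (coeff-* j g′))) ⟩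
        when (j Fin.≟ i) (C j g′ * mon j g′)                     ∎

    exp-inner : Series n
    exp-inner = expS (inner k w)

    expc : Vec ℕ n → ℚ
    expc c = cast (vfact c) * exp-inner c

    module _ (d : Vec ℕ n) (i : Fin n) where
      private
        ℓ : ℕ
        ℓ = suc (toℕ i)

      open Horner (κ ℓ) ℓ (λ p → exp-inner (d [ i ]≔ p)) public using (u)
      open Horner (κ ℓ) ℓ (λ p → exp-inner (d [ i ]≔ p)) using (u-expand)

      -- The argument g stands for the exponent g + 1, which lowers p + 1 to p - g; hence the
      -- condition g ≤ p.
      pick-monomial : ∀ p g → ∑ (below (d [ i ]≔ suc p)) (λ a → monomial (single i (suc g)) a * exp-inner ((d [ i ]≔ suc p) ∸ᵛ a)) ≡
                      when (g ℕ.≤? p) (exp-inner (d [ i ]≔ (p ∸ g)))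
      pick-monomial p g = begin
        ∑ (below c) (λ a → monomial e a * exp-inner (c ∸ᵛ a))
          ≡⟨ ∑-cong (below c) (λ a → trans (cong (_* exp-inner (c ∸ᵛ a)) (monomial-when e a))
               (trans (when-* (Vecₚ.≡-dec ℕ._≟_ a e) (exp-inner (c ∸ᵛ a)))
                      (cong (when (Vecₚ.≡-dec ℕ._≟_ a e)) (ℚₚ.*-identityˡ (exp-inner (c ∸ᵛ a)))))) ⟩
        ∑ (below c) (λ a → when (Vecₚ.≡-dec ℕ._≟_ a e) (exp-inner (c ∸ᵛ a)))
          ≡⟨ pick-below c e (λ a → exp-inner (c ∸ᵛ a)) ⟩
        when (PW.decidable ℕ._≤?_ e c) (exp-inner (c ∸ᵛ e))
          ≡⟨ when-cong (PW.decidable ℕ._≤?_ e c) (g ℕ.≤? p)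
               (λ e≤c → ℕ.s≤s⁻¹ (subst₂ _≤_ (Vecₚ.lookup∘update i (replicate n 0) (suc g)) cᵢ (PW.lookup e≤c i)))
               (λ g≤p → single-≤ c i (subst (suc g ≤_) (sym cᵢ) (s≤s g≤p)))
               (λ _ → cong exp-inner (∸ᵛ-single d i (suc p) (suc g))) ⟩
        when (g ℕ.≤? p) (exp-inner (d [ i ]≔ (p ∸ g))) ∎
        where
        c = d [ i ]≔ suc p
        e = single i (suc g)
        cᵢ : lookup c i ≡ suc p
        cᵢ = Vecₚ.lookup∘update i d (suc p)

      -- Compares the coefficients in θ exp(f) = θ f · exp(f) where t_ℓ has exponent p + 1; each g
      -- in G_k(ℓ) lowers this exponent by g.
      exp-recurrence : ∀ p → cast (suc p) * exp-inner (d [ i ]≔ suc p) ≡ u p 1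
      exp-recurrence p = begin
        cast (suc p) * exp-inner c
          ≡⟨ cong (λ e → cast e * exp-inner c) (Vecₚ.lookup∘update i d (suc p)) ⟨
        θ i exp-inner c
          ≡⟨ θ-expS i (inner k w) (inner-0 n) c ⟩
        ∑ (below c) (λ a → θ i (inner k w) a * exp-inner (c ∸ᵛ a))
          ≡⟨ ∑-cong (below c) (λ a → trans (cong (_* exp-inner (c ∸ᵛ a)) (θ-inner i a)) (∑-* (upTo k) (exp-inner (c ∸ᵛ a)))) ⟩
        ∑ (below c) (λ a → ∑ (upTo k) (λ g → C g * monomial (single i (suc g)) a * exp-inner (c ∸ᵛ a)))
          ≡⟨ ∑-swap (below c) (upTo k) ⟩
        ∑ (upTo k) (λ g → ∑ (below c) (λ a → C g * monomial (single i (suc g)) a * exp-inner (c ∸ᵛ a)))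
          ≡⟨ ∑-cong (upTo k) (λ g → trans
               (∑-cong (below c) (λ a → ℚₚ.*-assoc (C g) (monomial (single i (suc g)) a) (exp-inner (c ∸ᵛ a))))
               (sym (*-∑ (C g) (below c) {λ a → monomial (single i (suc g)) a * exp-inner (c ∸ᵛ a)}))) ⟩
        ∑ (upTo k) (λ g → C g * ∑ (below c) (λ a → monomial (single i (suc g)) a * exp-inner (c ∸ᵛ a)))
          ≡⟨ ∑-cong (upTo k) (λ g → cong (C g *_) (pick-monomial p g)) ⟩
        ∑ (upTo k) (λ g → C g * when (g ℕ.≤? p) (exp-inner (d [ i ]≔ (p ∸ g))))
          ≡⟨ u-expand k p 1 (λ h k≤h → κ-vanish ℓ (suc h) (s≤s k≤h)) ⟩
        u p 1 ∎
        where
        c = d [ i ]≔ suc p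
        C : ℕ → ℚ
        C g = κ ℓ (suc g) * cast (ℓ ^ g)

      -- The value that the sum over roots with a prescribed chain turns out to have when g points
      -- are chosen and p cycles of length ℓ remain; the factorials are those of the remaining cycle
      -- counts.
      v : ℕ → ℕ → ℚ
      v p g = cast (vfact (d [ i ]≔ p)) * u p g

      v-zero : ∀ g → v 0 g ≡ κ ℓ g * expc (d [ i ]≔ 0)
      v-zero g = *-swap (cast (vfact (d [ i ]≔ 0))) (κ ℓ g) (exp-inner (d [ i ]≔ 0))

      -- In ℓ (p + 1), the ℓ comes from the Horner step and p + 1 from the factorial. Their product
      -- is the number of points on p + 1 cycles of length ℓ, that is, of choices for the next point
      -- of the chain.
      v-suc : ∀ p g → v (suc p) g ≡ κ ℓ g * expc (d [ i ]≔ suc p) + cast (ℓ ℕ.* suc p) * v p (suc g)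
      v-suc p g = begin
        V * (κ ℓ g * F + cast ℓ * U)
          ≡⟨ ℚₚ.*-distribˡ-+ V (κ ℓ g * F) (cast ℓ * U) ⟩
        V * (κ ℓ g * F) + V * (cast ℓ * U)
          ≡⟨ cong₂ _+_ (*-swap V (κ ℓ g) F) (*-swap V (cast ℓ) U) ⟩
        κ ℓ g * (V * F) + cast ℓ * (V * U)
          ≡⟨ cong (λ e → κ ℓ g * (V * F) + cast ℓ * (e * U)) (trans (cong cast (vfact-suc d i p)) (cast-* (suc p) (vfact (d [ i ]≔ p)))) ⟩
        κ ℓ g * (V * F) + cast ℓ * (cast (suc p) * V′ * U)
          ≡⟨ cong (κ ℓ g * (V * F) +_) (trans (cong (cast ℓ *_) (ℚₚ.*-assoc (cast (suc p)) V′ U)) (sym (ℚₚ.*-assoc (cast ℓ) (cast (suc p)) (V′ * U)))) ⟩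
        κ ℓ g * (V * F) + cast ℓ * cast (suc p) * (V′ * U)
          ≡⟨ cong (λ e → κ ℓ g * (V * F) + e * (V′ * U)) (cast-* ℓ (suc p)) ⟨
        κ ℓ g * (V * F) + cast (ℓ ℕ.* suc p) * (V′ * U) ∎
        where
        V = cast (vfact (d [ i ]≔ suc p))
        V′ = cast (vfact (d [ i ]≔ p))
        F = exp-inner (d [ i ]≔ suc p)
        U = u p (suc g)

      -- The first point of a chain uses up one of p + 1 cycles, so p remain; the factor p + 1 in
      -- `exp-recurrence` restores the factorial.
      v-start : ∀ p → v p 1 ≡ expc (d [ i ]≔ suc p)
      v-start p = begin
        V′ * u p 1                      ≡⟨ cong (V′ *_) (exp-recurrence p) ⟨
        V′ * (cast (suc p) * F)         ≡⟨ *-swap V′ (cast (suc p)) F ⟩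
        cast (suc p) * (V′ * F)         ≡⟨ ℚₚ.*-assoc (cast (suc p)) V′ F ⟨
        cast (suc p) * V′ * F           ≡⟨ cong (_* F) (trans (cong cast (vfact-suc d i p)) (cast-* (suc p) (vfact (d [ i ]≔ p)))) ⟨
        expc (d [ i ]≔ suc p)           ∎
        where
        V′ = cast (vfact (d [ i ]≔ p))
        F = exp-inner (d [ i ]≔ suc p)

-- Iterates of self-maps and permutations of a finite set.

module Iteration where
  open import Defs
  open import Data.Fin as Fin using (Fin)
  open import Data.Nat using (ℕ; zero; suc; _+_; _*_; _∸_; _<_; z≤n; s≤s)
  import Data.Nat.Properties as ℕₚ
  open import Data.Fin.Properties as Finₚ using (pigeonhole)
  open import Data.List.Relation.Unary.All using (All; []; _∷_)
  open import Data.List.Relation.Unary.AllPairs using ([]; _∷_)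
  open import Data.Product using (∃; _×_; _,_; proj₁; proj₂)
  open import Data.Vec using (Vec; []; _∷_; lookup; toList)
  import Data.Vec.Properties as Vecₚ
  open import Data.List.Relation.Unary.Unique.Propositional using (Unique)
  open import Data.Empty using (⊥-elim)
  open import Function using (_∘_)
  open import Relation.Binary.PropositionalEquality using (_≡_; refl; sym; trans; cong; module ≡-Reasoning)

  private
    variable
      A : Set
      n : ℕ

  iter : (A → A) → ℕ → A → A
  iter f zero    x = x
  iter f (suc m) x = f (iter f m x)

  iter-+ : ∀ (f : A → A) a b x → iter f (a + b) x ≡ iter f a (iter f b x)
  iter-+ f zero    b x = refl
  iter-+ f (suc a) b x = cong f (iter-+ f a b x)

  iter-comm : ∀ {f g : A → A} {x} m → (∀ y → f (g y) ≡ g (f y)) → iter f m (g x) ≡ g (iter f m x)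
  iter-comm     zero    fg = refl
  iter-comm {f = f} (suc m) fg = trans (cong f (iter-comm m fg)) (fg _)

  iter-suc : ∀ (f : A → A) m x → iter f (suc m) x ≡ iter f m (f x)
  iter-suc f m x = sym (iter-comm {g = f} m (λ _ → refl))

  iter-swap : ∀ (f : A → A) a b x → iter f a (iter f b x) ≡ iter f b (iter f a x)
  iter-swap f a b x = trans (sym (iter-+ f a b x)) (trans (cong (λ e → iter f e x) (ℕₚ.+-comm a b)) (iter-+ f b a x))

  iter-* : ∀ {f : A → A} {x} a b → iter f b x ≡ x → iter f (a * b) x ≡ x
  iter-* zero    b eq = refl
  iter-* {f = f} {x} (suc a) b eq = trans (iter-+ f b (a * b) x) (trans (cong (iter f b) (iter-* a b eq)) eq)

  lookup-∘F : ∀ (τ ρ : Fun n) x → lookup (τ ∘F ρ) x ≡ lookup τ (lookup ρ x)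
  lookup-∘F τ ρ x = Vecₚ.lookup∘tabulate _ x

  lookup-^F : ∀ (τ : Fun n) m x → lookup (τ ^F m) x ≡ iter (lookup τ) m x
  lookup-^F τ zero    x = Vecₚ.lookup∘tabulate _ x
  lookup-^F τ (suc m) x = trans (lookup-∘F τ (τ ^F m) x) (cong (lookup τ) (lookup-^F τ m x))

  lookup-ext : ∀ {m} {u v : Vec A m} → (∀ i → lookup u i ≡ lookup v i) → u ≡ v
  lookup-ext {u = u} {v} eq = trans (sym (Vecₚ.tabulate∘lookup u)) (trans (Vecₚ.tabulate-cong eq) (Vecₚ.tabulate∘lookup v))

  Inj : (Fin n → Fin n) → Set
  Inj f = ∀ {x y} → f x ≡ f y → x ≡ y

  IsPerm⇒Inj : (τ : Fun n) → IsPerm τ → Inj (lookup τ)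
  IsPerm⇒Inj τ uniq {x} {y} = unique⇒inj τ uniq x y
    where
    all-lookup : ∀ {m} {P : A → Set} (v : Vec A m) → All P (toList v) → ∀ i → P (lookup v i)
    all-lookup (_ ∷ v) (p ∷ ps) Fin.zero    = p
    all-lookup (_ ∷ v) (p ∷ ps) (Fin.suc i) = all-lookup v ps i

    unique⇒inj : ∀ {m} (v : Vec A m) → Unique (toList v) → ∀ x y → lookup v x ≡ lookup v y → x ≡ y
    unique⇒inj (_ ∷ v) (ne ∷ u) Fin.zero    Fin.zero    eq = refl
    unique⇒inj (_ ∷ v) (ne ∷ u) Fin.zero    (Fin.suc y) eq = ⊥-elim (all-lookup v ne y eq)
    unique⇒inj (_ ∷ v) (ne ∷ u) (Fin.suc x) Fin.zero    eq = ⊥-elim (all-lookup v ne x (sym eq))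
    unique⇒inj (_ ∷ v) (ne ∷ u) (Fin.suc x) (Fin.suc y) eq = cong Fin.suc (unique⇒inj v u x y eq)

  Inj⇒IsPerm : (τ : Fun n) → Inj (lookup τ) → IsPerm τ
  Inj⇒IsPerm τ inj = inj⇒unique τ (λ x y → inj)
    where
    lookup-all : ∀ {m} {P : A → Set} (v : Vec A m) → (∀ i → P (lookup v i)) → All P (toList v)
    lookup-all []      p = []
    lookup-all (_ ∷ v) p = p Fin.zero ∷ lookup-all v (p ∘ Fin.suc)

    inj⇒unique : ∀ {m} (v : Vec A m) → (∀ x y → lookup v x ≡ lookup v y → x ≡ y) → Unique (toList v)
    inj⇒unique []      inj = []
    inj⇒unique (_ ∷ v) inj = lookup-all v (λ i eq → Finₚ.0≢1+n (inj Fin.zero (Fin.suc i) eq)) ∷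
                             inj⇒unique v (λ x y eq → Finₚ.suc-injective (inj (Fin.suc x) (Fin.suc y) eq))

  iter-inj : ∀ {f : Fin n → Fin n} → Inj f → ∀ m {x y} → iter f m x ≡ iter f m y → x ≡ y
  iter-inj inj zero    eq = eq
  iter-inj inj (suc m) eq = iter-inj inj m (inj eq)

  -- Two of the n + 1 iterates with exponents 0, ..., n coincide at x, and injectivity cancels the
  -- common initial iterations. The bound m < n later keeps the search of `cycleLength` within its
  -- fuel.
  period : ∀ {f : Fin n → Fin n} → Inj f → ∀ x → ∃ λ m → m < n × iter f (suc m) x ≡ x
  period {n} {f} inj x with pigeonhole (ℕₚ.n<1+n n) (λ i → iter f (Fin.toℕ i) x)
  ... | i , j , i<j , eq = Fin.toℕ j ∸ suc (Fin.toℕ i) , bound , iter-inj inj (Fin.toℕ i) (begin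
    iter f (Fin.toℕ i) (iter f (suc d) x)  ≡⟨ iter-+ f (Fin.toℕ i) (suc d) x ⟨
    iter f (Fin.toℕ i + suc d) x           ≡⟨ cong (λ e → iter f e x) (trans (ℕₚ.+-suc (Fin.toℕ i) d) (ℕₚ.m+[n∸m]≡n i<j)) ⟩
    iter f (Fin.toℕ j) x                   ≡⟨ eq ⟨
    iter f (Fin.toℕ i) x                   ∎)
    where
    open ≡-Reasoning
    d = Fin.toℕ j ∸ suc (Fin.toℕ i)
    bound : d < n
    bound = ℕₚ.<-≤-trans (ℕₚ.∸-monoʳ-< (s≤s z≤n) i<j) (ℕₚ.≤-pred (Finₚ.toℕ<n j))

  -- From f^(m+1) x = x, the preimage of x is f^m x; the exponent m may depend on x.
  inverse : ∀ {f : Fin n → Fin n} → Inj f → Fin n → Fin n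
  inverse {f = f} inj x = iter f (proj₁ (period inj x)) x

  inverseʳ : ∀ {f : Fin n → Fin n} (inj : Inj f) x → f (inverse inj x) ≡ x
  inverseʳ inj x = proj₂ (proj₂ (period inj x))

  inverseˡ : ∀ {f : Fin n → Fin n} (inj : Inj f) x → inverse inj (f x) ≡ x
  inverseˡ {f = f} inj x = inj (inverseʳ inj (f x))

-- Cycles of a permutation and their lengths.

module Orbits where
  open import Defs
  open import Data.Bool using (if_then_else_)
  open import Data.Empty using (⊥-elim)
  open import Data.Fin as Fin using (Fin)
  open import Data.List using (allFin; upTo)
  open import Data.Nat using (ℕ; zero; suc; _+_; _*_; _∸_; _≤_; _<_; z≤n; s≤s; _/_; _%_; NonZero; >-nonZero)
  import Data.Nat as ℕ
  import Data.Nat.Properties as ℕₚ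
  open import Data.Nat.Divisibility using (_∣_; ∣-antisym; m%n≡0⇒n∣m)
  open import Data.Nat.DivMod using (m≡m%n+[m/n]*n; m%n<n)
  open import Data.Product using (∃; _×_; _,_; proj₁; proj₂)
  open import Data.Sum using (inj₁; inj₂)
  open import Data.Vec using (_∷_; lookup; tabulate)
  open import Relation.Binary.PropositionalEquality using (_≡_; refl; sym; trans; cong; subst; module ≡-Reasoning)
  open import Relation.Nullary using (Dec; yes; no; does)
  open import Relation.Nullary.Decidable using (map′)
  open Summation
  open Counting
  open Iteration

  -- The local function `go` of `cycleLength`, named by unification; the
  -- with-abstractions turn its arguments into distinct variables.
  mutual
    cycleLengthFrom : ∀ n (σ : Fun n) (x : Fin n) → ℕ → ℕ → ℕ
    cycleLengthFrom = _

    cycleLength-step : ∀ n (σ : Fun (suc n)) x → cycleLength σ x ≡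
                       (if does (lookup (σ ^F 1) x Fin.≟ x) then 1 else cycleLengthFrom (suc n) σ x 2 n)
    cycleLength-step n σ x with lookup (σ ^F 1) x Fin.≟ x
    ... | yes _ = refl
    ... | no  _ with lookup (lookup σ Fin.zero ∷ tabulate (λ y → lookup σ (lookup (tabulate Fin.suc) y))) x
    ...   | _ with suc n | 2
    ...     | _ | _ = refl

  module _ {n} (σ : Fun n) (inj : Inj (lookup σ)) where
    open ≡-Reasoning

    private
      s : Fin n → Fin n
      s = lookup σ

    -- The known return time p lies below m + fuel, so the search succeeds before it reaches its
    -- default value 0.
    cycleLengthFrom-spec : ∀ x m fuel p → m ≤ p → p < m + fuel → iter s p x ≡ x →
      let r = cycleLengthFrom n σ x m fuel in
      m ≤ r × iter s r x ≡ x × (∀ q → m ≤ q → iter s q x ≡ x → r ≤ q)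
    cycleLengthFrom-spec x m zero p m≤p p<m fix =
      ⊥-elim (ℕₚ.<⇒≱ (subst (p <_) (ℕₚ.+-identityʳ m) p<m) m≤p)
    cycleLengthFrom-spec x m (suc fuel) p m≤p p<m fix with lookup (σ ^F m) x Fin.≟ x
    ... | yes eq = ℕₚ.≤-refl , trans (sym (lookup-^F σ m x)) eq , λ q m≤q _ → m≤q
    ... | no neq =
      let m<r , fixᵣ , min = cycleLengthFrom-spec x (suc m) fuel p (later p m≤p fix) (subst (p <_) (ℕₚ.+-suc m fuel) p<m) fix
      in ℕₚ.<⇒≤ m<r , fixᵣ , λ q m≤q fix′ → min q (later q m≤q fix′) fix′
      where
      later : ∀ q → m ≤ q → iter s q x ≡ x → suc m ≤ q
      later q m≤q fix with ℕₚ.m≤n⇒m<n∨m≡n m≤q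
      ... | inj₁ m<q  = m<q
      ... | inj₂ refl = ⊥-elim (neq (trans (lookup-^F σ m x) fix))

    len : Fin n → ℕ
    len = cycleLength σ

    len-spec : ∀ x → 1 ≤ len x × iter s (len x) x ≡ x × (∀ q → 1 ≤ q → iter s q x ≡ x → len x ≤ q)
    len-spec x with period inj x
    ... | m , m<n , fix = cycleLengthFrom-spec x 1 n (suc m) (s≤s z≤n) (s≤s m<n) fix

    len-pos : ∀ x → 1 ≤ len x
    len-pos x = proj₁ (len-spec x)

    len-≤ : ∀ x → len x ≤ n
    len-≤ x with period inj x
    ... | m , m<n , fix = ℕₚ.≤-trans (proj₂ (proj₂ (len-spec x)) (suc m) (s≤s z≤n) fix) m<n

    iter-len : ∀ x → iter s (len x) x ≡ x
    iter-len x = proj₁ (proj₂ (len-spec x))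

    instance
      len-nonZero : ∀ {x} → NonZero (len x)
      len-nonZero {x} = >-nonZero (len-pos x)

    iter-% : ∀ x a → iter s (a % len x) x ≡ iter s a x
    iter-% x a = begin
      iter s (a % len x) x                                     ≡⟨ cong (iter s (a % len x)) (iter-* (a / len x) (len x) (iter-len x)) ⟨
      iter s (a % len x) (iter s ((a / len x) * len x) x)      ≡⟨ iter-+ s (a % len x) _ x ⟨
      iter s (a % len x + (a / len x) * len x) x               ≡⟨ cong (λ e → iter s e x) (m≡m%n+[m/n]*n a (len x)) ⟨
      iter s a x                                               ∎

    -- The remainder of a modulo the cycle length is a return time as well, so minimality leaves
    -- only 0.
    len-∣ : ∀ x a → iter s a x ≡ x → len x ∣ a
    len-∣ x a fix with a % len x in eq
    ... | zero  = m%n≡0⇒n∣m a (len x) eq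
    ... | suc r = ⊥-elim (ℕₚ.<⇒≱ (subst (_< len x) eq (m%n<n a (len x)))
                    (proj₂ (proj₂ (len-spec x)) (suc r) (s≤s z≤n)
                      (trans (cong (λ e → iter s e x) (sym eq)) (trans (iter-% x a) fix))))

    iter-cancel : ∀ x a b → iter s (a + b) x ≡ iter s a x → iter s b x ≡ x
    iter-cancel x a b eq = iter-inj inj a (trans (sym (iter-+ s a b x)) eq)

    iter-injective-≤ : ∀ x {a b} → a ≤ b → b < len x → iter s a x ≡ iter s b x → a ≡ b
    iter-injective-≤ x {a} {b} a≤b b<len eq with b ∸ a in d
    ... | zero  = ℕₚ.≤-antisym a≤b (ℕₚ.m∸n≡0⇒m≤n d)
    ... | suc e = ⊥-elim (ℕₚ.<⇒≱ b<len (ℕₚ.≤-trans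
        (proj₂ (proj₂ (len-spec x)) (suc e) (s≤s z≤n) (iter-cancel x a (suc e)
          (trans (cong (λ m → iter s m x) (trans (cong (a +_) (sym d)) (ℕₚ.m+[n∸m]≡n a≤b))) (sym eq))))
        (subst (_≤ b) d (ℕₚ.m∸n≤m b a))))

    iter-injective : ∀ x {a b} → a < len x → b < len x → iter s a x ≡ iter s b x → a ≡ b
    iter-injective x {a} {b} a< b< eq with ℕₚ.≤-total a b
    ... | inj₁ a≤b = iter-injective-≤ x a≤b b< eq
    ... | inj₂ b≤a = sym (iter-injective-≤ x b≤a a< (sym eq))

    -- With the same return times, each of the two lengths divides the other.
    len-cong : ∀ {x y} → (∀ a → iter s a x ≡ x → iter s a y ≡ y) → (∀ a → iter s a y ≡ y → iter s a x ≡ x) → len x ≡ len y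
    len-cong {x} {y} xy yx = ∣-antisym (len-∣ x (len y) (yx (len y) (iter-len y))) (len-∣ y (len x) (xy (len x) (iter-len x)))

    -- Forward iterates suffice for an equivalence relation, because x returns after `len x` steps.
    _~_ : Fin n → Fin n → Set
    x ~ y = ∃ λ e → y ≡ iter s e x

    _~?_ : ∀ x y → Dec (x ~ y)
    x ~? y = map′ (λ { (e , _ , eq) → e , eq })
                  (λ { (e , eq) → e % len x , m%n<n e (len x) , trans eq (sym (iter-% x e)) })
                  (ℕₚ.anyUpTo? (λ e → y Fin.≟ iter s e x) (len x))

    ~-sym : ∀ {x y} → x ~ y → y ~ x
    ~-sym {x} (e , refl) = e * (len x ∸ 1) , sym (begin
      iter s (e * (len x ∸ 1)) (iter s e x)   ≡⟨ iter-+ s (e * (len x ∸ 1)) e x ⟨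
      iter s (e * (len x ∸ 1) + e) x          ≡⟨ cong (λ m → iter s m x) multiple ⟩
      iter s (e * len x) x                    ≡⟨ iter-* e (len x) (iter-len x) ⟩
      x                                       ∎)
      where
      multiple : e * (len x ∸ 1) + e ≡ e * len x
      multiple = begin
        e * (len x ∸ 1) + e    ≡⟨ ℕₚ.+-comm (e * (len x ∸ 1)) e ⟩
        e + e * (len x ∸ 1)    ≡⟨ ℕₚ.*-suc e (len x ∸ 1) ⟨
        e * suc (len x ∸ 1)    ≡⟨ cong (e *_) (ℕₚ.m+[n∸m]≡n (len-pos x)) ⟩
        e * len x              ∎

    ~-trans : ∀ {x y z} → x ~ y → y ~ z → x ~ z
    ~-trans {x} (a , refl) (b , refl) = b + a , sym (iter-+ s b a x)

    ~-step : ∀ {x} → x ~ s x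
    ~-step = 1 , refl

    ~-len : ∀ {x y} → x ~ y → len x ≡ len y
    ~-len {x} (e , refl) = len-cong
      (λ a eq → trans (iter-swap s a e x) (cong (iter s e) eq))
      (λ a eq → iter-inj inj e (trans (sym (iter-swap s a e x)) eq))

    -- Every point of the orbit is σ^e x for exactly one e below the length; its indicator is
    -- therefore a sum over e, and the double sum can be exchanged.
    orbit-size : ∀ x → count (x ~?_) (allFin n) ≡ len x
    orbit-size x = begin
      ∑ (allFin n) (λ y → when (x ~? y) 1)
        ≡⟨ ∑-cong (allFin n) (λ y → indicator y (x ~? y)) ⟩
      ∑ (allFin n) (λ y → ∑ (upTo (len x)) (λ e → when (y Fin.≟ iter s e x) 1))
        ≡⟨ ∑-swap (allFin n) (upTo (len x)) ⟩
      ∑ (upTo (len x)) (λ e → ∑ (allFin n) (λ y → when (y Fin.≟ iter s e x) 1))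
        ≡⟨ ∑-cong (upTo (len x)) (λ e → ∑-allFin-≟ n (iter s e x) 1) ⟩
      ∑ (upTo (len x)) (λ _ → 1)
        ≡⟨ ∑-upTo-1 (len x) ⟩
      len x ∎
      where
      open ∑ᴺ
      ∑-upTo-1 : ∀ m → ∑ (upTo m) (λ _ → 1) ≡ m
      ∑-upTo-1 zero    = refl
      ∑-upTo-1 (suc m) = trans (∑-upTo-suc m {λ _ → 1}) (cong suc (∑-upTo-1 m))

      indicator : ∀ y (d : Dec (x ~ y)) → when d 1 ≡ ∑ (upTo (len x)) (λ e → when (y Fin.≟ iter s e x) 1)
      indicator y (no ¬x~y) = sym (∑-zero (upTo (len x)) (λ e → when-no (y Fin.≟ iter s e x) (λ eq → ¬x~y (e , eq))))
      indicator y (yes (e₀ , refl)) = sym (begin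
        ∑ (upTo (len x)) (λ e → when (iter s e₀ x Fin.≟ iter s e x) 1)
          ≡⟨ ∑-upTo-cong (len x) (λ e e<len → when-cong (iter s e₀ x Fin.≟ iter s e x) (e ℕ.≟ e₀ % len x)
               (λ eq → sym (iter-injective x (m%n<n e₀ (len x)) e<len (trans (iter-% x e₀) eq)))
               (λ eq → trans (sym (iter-% x e₀)) (cong (λ m → iter s m x) (sym eq))) (λ _ → refl)) ⟩
        ∑ (upTo (len x)) (λ e → when (e ℕ.≟ e₀ % len x) 1)
          ≡⟨ pick-upTo (len x) (e₀ % len x) (λ _ → 1) ⟩
        when (e₀ % len x ℕ.<? len x) 1
          ≡⟨ when-yes (e₀ % len x ℕ.<? len x) (m%n<n e₀ (len x)) ⟩
        1 ∎)

-- Transpositions and cycles.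

module Swaps where
  open import Data.Empty using (⊥-elim)
  open import Data.Fin as Fin using (Fin)
  open import Data.Nat as ℕ using (ℕ; zero; suc; _≤_; _<_; s≤s)
  import Data.Nat.Properties as ℕₚ
  open import Relation.Binary.PropositionalEquality using (_≡_; _≢_; refl; sym; trans; cong)
  open import Relation.Nullary using (yes; no)
  open Iteration

  private
    variable
      n : ℕ

  swap : Fin n → Fin n → Fin n → Fin n
  swap a b x with x Fin.≟ a
  ... | yes _ = b
  ... | no  _ with x Fin.≟ b
  ...   | yes _ = a
  ...   | no  _ = x

  swap-fst : (a b : Fin n) → swap a b a ≡ b
  swap-fst a b with a Fin.≟ a
  ... | yes _ = refl
  ... | no ¬p = ⊥-elim (¬p refl)

  swap-snd : (a b : Fin n) → swap a b b ≡ a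
  swap-snd a b with b Fin.≟ a
  ... | yes b≡a = b≡a
  ... | no  _ with b Fin.≟ b
  ...   | yes _ = refl
  ...   | no ¬p = ⊥-elim (¬p refl)

  swap-other : ∀ {a b x : Fin n} → x ≢ a → x ≢ b → swap a b x ≡ x
  swap-other {a = a} {b} {x} x≢a x≢b with x Fin.≟ a
  ... | yes p = ⊥-elim (x≢a p)
  ... | no  _ with x Fin.≟ b
  ...   | yes p = ⊥-elim (x≢b p)
  ...   | no  _ = refl

  swap-involutive : ∀ (a b x : Fin n) → swap a b (swap a b x) ≡ x
  swap-involutive a b x with x Fin.≟ a
  ... | yes refl = swap-snd a b
  ... | no  x≢a with x Fin.≟ b
  ...   | yes refl = swap-fst a b
  ...   | no  x≢b = swap-other x≢a x≢b

  swap-inj : ∀ (a b : Fin n) → Inj (swap a b)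
  swap-inj a b {x} {y} eq = trans (sym (swap-involutive a b x)) (trans (cong (swap a b) eq) (swap-involutive a b y))

  swap-conj : ∀ {f : Fin n → Fin n} → Inj f → ∀ a b x → swap (f a) (f b) (f x) ≡ f (swap a b x)
  swap-conj {f = f} inj a b x with x Fin.≟ a
  ... | yes refl = swap-fst (f a) (f b)
  ... | no  x≢a with x Fin.≟ b
  ...   | yes refl = swap-snd (f a) (f b)
  ...   | no  x≢b = swap-other (λ eq → x≢a (inj eq)) (λ eq → x≢b (inj eq))

  -- For distinct points this is the cycle z 0 → z 1 → ... → z m → z 0. As a product of m
  -- transpositions it has an inverse and a sign that come by induction on m.
  cyc : (ℕ → Fin n) → ℕ → Fin n → Fin n
  cyc z zero    x = x
  cyc z (suc m) x = cyc z m (swap (z m) (z (suc m)) x)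

  cyc⁻¹ : (ℕ → Fin n) → ℕ → Fin n → Fin n
  cyc⁻¹ z zero    x = x
  cyc⁻¹ z (suc m) x = swap (z m) (z (suc m)) (cyc⁻¹ z m x)

  cyc-inverseˡ : ∀ (z : ℕ → Fin n) m x → cyc⁻¹ z m (cyc z m x) ≡ x
  cyc-inverseˡ z zero    x = refl
  cyc-inverseˡ z (suc m) x = trans (cong (swap (z m) (z (suc m))) (cyc-inverseˡ z m _)) (swap-involutive (z m) (z (suc m)) x)

  cyc-inverseʳ : ∀ (z : ℕ → Fin n) m x → cyc z m (cyc⁻¹ z m x) ≡ x
  cyc-inverseʳ z zero    x = refl
  cyc-inverseʳ z (suc m) x = trans (cong (cyc z m) (swap-involutive (z m) (z (suc m)) (cyc⁻¹ z m x))) (cyc-inverseʳ z m x)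

  cyc-inj : ∀ (z : ℕ → Fin n) m → Inj (cyc z m)
  cyc-inj z m {x} {y} eq = trans (sym (cyc-inverseˡ z m x)) (trans (cong (cyc⁻¹ z m) eq) (cyc-inverseˡ z m y))

  cyc⁻¹-inj : ∀ (z : ℕ → Fin n) m → Inj (cyc⁻¹ z m)
  cyc⁻¹-inj z m {x} {y} eq = trans (sym (cyc-inverseʳ z m x)) (trans (cong (cyc z m) eq) (cyc-inverseʳ z m y))

  cyc-other : ∀ (z : ℕ → Fin n) m {x} → (∀ i → i ≤ m → x ≢ z i) → cyc z m x ≡ x
  cyc-other z zero    x≢ = refl
  cyc-other z (suc m) x≢ = trans (cong (cyc z m) (swap-other (x≢ m (ℕₚ.n≤1+n m)) (x≢ (suc m) ℕₚ.≤-refl)))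
                             (cyc-other z m (λ i i≤m → x≢ i (ℕₚ.m≤n⇒m≤1+n i≤m)))

  InjUpTo : (ℕ → Fin n) → ℕ → Set
  InjUpTo z m = ∀ {i j} → i ≤ m → j ≤ m → z i ≡ z j → i ≡ j

  injUpTo-pred : ∀ {z : ℕ → Fin n} {m} → InjUpTo z (suc m) → InjUpTo z m
  injUpTo-pred inj i≤m j≤m = inj (ℕₚ.m≤n⇒m≤1+n i≤m) (ℕₚ.m≤n⇒m≤1+n j≤m)

  cyc-last : ∀ (z : ℕ → Fin n) m → cyc z m (z m) ≡ z 0
  cyc-last z zero    = refl
  cyc-last z (suc m) = trans (cong (cyc z m) (swap-snd (z m) (z (suc m)))) (cyc-last z m)

  -- The transposition applied first sends z m to z (m + 1), which the shorter cycle fixes, and it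
  -- leaves the earlier points to the shorter cycle.
  cyc-step : ∀ (z : ℕ → Fin n) m → InjUpTo z m → ∀ {i} → i < m → cyc z m (z i) ≡ z (suc i)
  cyc-step z (suc m) inj {i} (s≤s i≤m) with i ℕ.≟ m
  ... | yes refl = trans (cong (cyc z m) (swap-fst (z m) (z (suc m))))
                     (cyc-other z m (λ j j≤m eq → ℕₚ.<-irrefl (sym (inj ℕₚ.≤-refl (ℕₚ.m≤n⇒m≤1+n j≤m) eq)) (s≤s j≤m)))
  ... | no  i≢m  = trans (cong (cyc z m) (swap-other
                       (λ eq → i≢m (inj (ℕₚ.m≤n⇒m≤1+n i≤m) (ℕₚ.n≤1+n m) eq))
                       (λ eq → ℕₚ.<-irrefl (inj (ℕₚ.m≤n⇒m≤1+n i≤m) ℕₚ.≤-refl eq) (s≤s i≤m))))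
                     (cyc-step z m (injUpTo-pred inj) (ℕₚ.≤∧≢⇒< i≤m i≢m))

-- The sign as the parity of the number of inversions.

module Sign where
  open import Defs
  open import Data.Bool using (Bool; true; false; not; _xor_; if_then_else_)
  open import Data.Empty using (⊥-elim)
  open import Data.Fin as Fin using (Fin; zero; suc)
  import Data.Fin.Properties as Finₚ
  open import Data.List using (List; []; _∷_; allFin; cartesianProduct)
  open import Data.Nat as ℕ using (ℕ; zero; suc; _+_; _<_; z≤n; s≤s)
  import Data.Nat.Properties as ℕₚ
  open import Data.Product using (_×_; _,_; proj₁; proj₂)
  open import Data.Rational using (ℚ; 1ℚ; -_; _*_)
  import Data.Rational.Properties as ℚₚ
  open import Data.Vec using (lookup)
  open import Function using (_∘_; id)
  open import Relation.Binary.Definitions using (tri<; tri≈; tri>)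
  open import Relation.Binary.PropositionalEquality using (_≡_; _≢_; refl; sym; trans; cong; cong₂; module ≡-Reasoning)
  open import Relation.Nullary using (Dec; yes; no; does; _×-dec_)
  open import Relation.Nullary.Decidable using (dec-true; dec-false)
  open Summation
  open Counting
  open ∑ᴺ
  open Iteration
  open Swaps
  open ≡-Reasoning

  private
    variable
      n : ℕ
      I J : Set

  signℚ-+ : ∀ a b → signℚ (a + b) ≡ signℚ a * signℚ b
  signℚ-+ zero    b = sym (ℚₚ.*-identityˡ (signℚ b))
  signℚ-+ (suc a) b = trans (cong -_ (signℚ-+ a b)) (ℚₚ.neg-distribˡ-* (signℚ a) (signℚ b))

  -‿involutive : ∀ q → - (- q) ≡ q
  -‿involutive = GroupProperties.⁻¹-involutive
    where
    import Algebra.Properties.Group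
    module GroupProperties = Algebra.Properties.Group ℚₚ.+-0-group

  signℚ² : ∀ a → signℚ a * signℚ a ≡ 1ℚ
  signℚ² zero    = refl
  signℚ² (suc a) = trans (sym (ℚₚ.neg-distribˡ-* (signℚ a) (- signℚ a)))
    (trans (cong -_ (sym (ℚₚ.neg-distribʳ-* (signℚ a) (signℚ a)))) (trans (-‿involutive _) (signℚ² a)))

  signℚ-∑ : ∀ (xs : List I) {f g : I → ℕ} → (∀ x → signℚ (f x) ≡ signℚ (g x)) → signℚ (∑ xs f) ≡ signℚ (∑ xs g)
  signℚ-∑ []       eq = refl
  signℚ-∑ (x ∷ xs) {f} {g} eq = begin
    signℚ (f x + ∑ xs f)          ≡⟨ signℚ-+ (f x) (∑ xs f) ⟩
    signℚ (f x) * signℚ (∑ xs f)  ≡⟨ cong₂ _*_ (eq x) (signℚ-∑ xs eq) ⟩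
    signℚ (g x) * signℚ (∑ xs g)  ≡⟨ signℚ-+ (g x) (∑ xs g) ⟨
    signℚ (g x + ∑ xs g)          ∎

  ∑-cartesianProduct : ∀ (xs : List I) (ys : List J) {f : I × J → ℕ} →
                       ∑ (cartesianProduct xs ys) f ≡ ∑ xs (λ x → ∑ ys (λ y → f (x , y)))
  ∑-cartesianProduct []       ys = refl
  ∑-cartesianProduct (x ∷ xs) ys = trans (∑-++ (Data.List.map (x ,_) ys) _)
    (cong₂ _+_ (∑-map (x ,_) ys) (∑-cartesianProduct xs ys))

  ∑∑ : (Fin n → Fin n → ℕ) → ℕ
  ∑∑ {n} f = ∑ (allFin n) (λ i → ∑ (allFin n) (f i))

  ∑∑-cong : {f g : Fin n → Fin n → ℕ} → (∀ i j → f i j ≡ g i j) → ∑∑ f ≡ ∑∑ g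
  ∑∑-cong {n} eq = ∑-cong (allFin n) (λ i → ∑-cong (allFin n) (eq i))

  inversion? : ∀ (f : Fin n → Fin n) i j → Dec (i Fin.< j × f j Fin.< f i)
  inversion? f i j = (i Fin.<? j) ×-dec (f j Fin.<? f i)

  inv : (Fin n → Fin n) → ℕ
  inv f = ∑∑ (λ i j → when (inversion? f i j) 1)

  sgn : (Fin n → Fin n) → ℚ
  sgn f = signℚ (inv f)

  inversions-inv : (τ : Fun n) → inversions τ ≡ inv (lookup τ)
  inversions-inv {n} τ = trans (length-filter (λ p → inversion? (lookup τ) (proj₁ p) (proj₂ p)) (cartesianProduct (allFin n) (allFin n)))
    (∑-cartesianProduct (allFin n) (allFin n))

  sgn-cong : {f g : Fin n → Fin n} → (∀ x → f x ≡ g x) → sgn f ≡ sgn g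
  sgn-cong eq = cong signℚ (∑∑-cong (λ i j → cong₂ (λ a b → when ((i Fin.<? j) ×-dec (a Fin.<? b)) 1) (eq j) (eq i)))

  sgn² : (f : Fin n → Fin n) → sgn f * sgn f ≡ 1ℚ
  sgn² f = signℚ² (inv f)

  <ᵇ-not : {a b : Fin n} → a ≢ b → does (b Fin.<? a) ≡ not (does (a Fin.<? b))
  <ᵇ-not {a = a} {b} a≢b with Finₚ.<-cmp a b
  ... | tri< a<b _ b≮a = trans (dec-false (b Fin.<? a) b≮a) (cong not (sym (dec-true (a Fin.<? b) a<b)))
  ... | tri≈ _ a≡b _   = ⊥-elim (a≢b a≡b)
  ... | tri> a≮b _ b<a = trans (dec-true (b Fin.<? a) b<a) (cong not (sym (dec-false (a Fin.<? b) a≮b)))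

  bit : Bool → ℕ
  bit b = if b then 1 else 0

  -- Relabelling does not preserve the range i < j, but it does preserve the range of all pairs; for
  -- symmetric H with zero diagonal the full sum is twice the sum over i < j.
  half-sum : (H : Fin n → Fin n → ℕ) → (∀ i j → H i j ≡ H j i) → (∀ i → H i i ≡ 0) →
             let N = ∑∑ (λ i j → when (i Fin.<? j) (H i j)) in N + N ≡ ∑∑ H
  half-sum {n} H sym-H diag = begin
    N + N
      ≡⟨ cong (N +_) (∑-swap (allFin n) (allFin n)) ⟩
    N + ∑∑ (λ i j → when (j Fin.<? i) (H j i))
      ≡⟨ ∑-+ (allFin n) ⟨
    ∑ (allFin n) (λ i → ∑ (allFin n) (λ j → when (i Fin.<? j) (H i j)) + ∑ (allFin n) (λ j → when (j Fin.<? i) (H j i)))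
      ≡⟨ ∑-cong (allFin n) (λ i → sym (∑-+ (allFin n))) ⟩
    ∑∑ (λ i j → when (i Fin.<? j) (H i j) + when (j Fin.<? i) (H j i))
      ≡⟨ ∑∑-cong pointwise ⟩
    ∑∑ H ∎
    where
    N = ∑∑ (λ i j → when (i Fin.<? j) (H i j))

    pointwise : ∀ i j → when (i Fin.<? j) (H i j) + when (j Fin.<? i) (H j i) ≡ H i j
    pointwise i j with Finₚ.<-cmp i j
    ... | tri< i<j _ j≮i = trans (cong₂ _+_ (when-yes (i Fin.<? j) i<j) (when-no (j Fin.<? i) j≮i)) (ℕₚ.+-identityʳ _)
    ... | tri≈ i≮i refl _ = trans (cong₂ _+_ (when-no (i Fin.<? i) i≮i) (when-no (i Fin.<? i) i≮i)) (sym (diag i))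
    ... | tri> i≮j _ j<i = trans (cong₂ _+_ (when-no (i Fin.<? j) i≮j) (when-yes (j Fin.<? i) j<i)) (sym-H j i)

  -- Whether π reverses the order of a pair {a,b} does not depend on the order of
  -- a and b, so the number of reversed pairs is unchanged by the relabelling τ.
  sgn-∘ : ∀ {π τ : Fin n → Fin n} → Inj π → Inj τ → sgn (π ∘ τ) ≡ sgn π * sgn τ
  sgn-∘ {n} {π} {τ} injπ injτ = begin
    signℚ (∑∑ (λ i j → when (inversion? (π ∘ τ) i j) 1))
      ≡⟨ signℚ-∑ (allFin n) (λ i → signℚ-∑ (allFin n) (parity i)) ⟩
    signℚ (∑∑ (λ i j → when (i Fin.<? j) (h (τ i) (τ j)) + when (inversion? τ i j) 1))
      ≡⟨ cong signℚ (trans (∑-cong (allFin n) (λ i → ∑-+ (allFin n))) (∑-+ (allFin n))) ⟩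
    signℚ (∑∑ (λ i j → when (i Fin.<? j) (h (τ i) (τ j))) + inv τ)
      ≡⟨ cong (λ e → signℚ (e + inv τ)) relabel ⟩
    signℚ (inv π + inv τ)
      ≡⟨ signℚ-+ (inv π) (inv τ) ⟩
    sgn π * sgn τ ∎
    where
    -- Equals 1 if π reverses the order of a and b, whichever of the two is smaller, and 0
    -- otherwise.
    h : Fin n → Fin n → ℕ
    h a b = bit (does (b Fin.<? a) xor does (π b Fin.<? π a))

    h-sym : ∀ a b → h a b ≡ h b a
    h-sym a b with a Fin.≟ b
    ... | yes refl = refl
    ... | no  a≢b = cong bit (trans (cong₂ _xor_ (<ᵇ-not a≢b) (<ᵇ-not (a≢b ∘ injπ)))
                      (not-xor (does (a Fin.<? b)) (does (π a Fin.<? π b))))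
      where
      not-xor : ∀ x y → not x xor not y ≡ x xor y
      not-xor true  true  = refl
      not-xor true  false = refl
      not-xor false true  = refl
      not-xor false false = refl

    h-diag : ∀ a → h a a ≡ 0
    h-diag a = cong bit (cong₂ _xor_ (dec-false (a Fin.<? a) (Finₚ.<-irrefl refl)) (dec-false (π a Fin.<? π a) (Finₚ.<-irrefl refl)))

    -- A pair i < j is an inversion of π ∘ τ exactly if one but not both of these hold: τ reverses
    -- it, π reverses its image. Both together give 2, which has the parity of 0.
    parity : ∀ i j → signℚ (when (inversion? (π ∘ τ) i j) 1) ≡
                     signℚ (when (i Fin.<? j) (h (τ i) (τ j)) + when (inversion? τ i j) 1)
    parity i j = bits (does (i Fin.<? j)) (does (τ j Fin.<? τ i)) (does (π (τ j) Fin.<? π (τ i)))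
      where
      open import Data.Bool using (_∧_)
      bits : ∀ x y z → signℚ (bit (x ∧ z)) ≡ signℚ ((if x then bit (y xor z) else 0) + bit (x ∧ y))
      bits false y     z     = refl
      bits true  true  true  = refl
      bits true  true  false = refl
      bits true  false true  = refl
      bits true  false false = refl

    pairs : (Fin n → Fin n) → ℕ
    pairs ρ = ∑∑ (λ i j → when (i Fin.<? j) (h (ρ i) (ρ j)))

    pairs-τ : pairs τ ≡ pairs id
    pairs-τ = ℕₚ.*-cancelˡ-≡ (pairs τ) (pairs id) 2 (begin
      2 ℕ.* pairs τ                        ≡⟨ cong (pairs τ +_) (ℕₚ.+-identityʳ (pairs τ)) ⟩
      pairs τ + pairs τ                    ≡⟨ half-sum (λ i j → h (τ i) (τ j)) (λ i j → h-sym (τ i) (τ j)) (λ i → h-diag (τ i)) ⟩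
      ∑∑ (λ i j → h (τ i) (τ j))           ≡⟨ ∑-cong (allFin n) (λ i → ∑-reindex τ (inverse injτ) (inverseˡ injτ) (inverseʳ injτ)) ⟩
      ∑ (allFin n) (λ i → ∑ (allFin n) (h (τ i))) ≡⟨ ∑-reindex τ (inverse injτ) (inverseˡ injτ) (inverseʳ injτ) ⟩
      ∑∑ h                                 ≡⟨ half-sum h h-sym h-diag ⟨
      pairs id + pairs id                  ≡⟨ cong (pairs id +_) (ℕₚ.+-identityʳ (pairs id)) ⟨
      2 ℕ.* pairs id                       ∎)

    relabel : pairs τ ≡ inv π
    relabel = trans pairs-τ (∑∑-cong (λ i j → trans
      (when-congʳ (i Fin.<? j) (λ i<j → cong (λ e → bit (e xor does (π j Fin.<? π i))) (dec-false (j Fin.<? i) (Finₚ.<-asym i<j))))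
      (sym (when-× (i Fin.<? j) (π j Fin.<? π i)))))

  sgn-id : ∀ n → sgn {n} id ≡ 1ℚ
  sgn-id n = cong signℚ (trans (∑-cong (allFin n) (λ i → ∑-zero (allFin n) (λ j →
    when-no (inversion? id i j) (λ { (i<j , j<i) → Finₚ.<-asym i<j j<i })))) (∑-0 (allFin n)))

  sgn-swap₀₁ : ∀ n → sgn (swap {suc (suc n)} zero (suc zero)) ≡ - 1ℚ
  sgn-swap₀₁ n = cong signℚ (begin
    ∑∑ (λ i j → when (inversion? t i j) 1)
      ≡⟨ ∑∑-cong pointwise ⟩
    ∑∑ {suc (suc n)} (λ i j → when (i Fin.≟ zero) (when (j Fin.≟ suc zero) 1))
      ≡⟨ ∑-swap (allFin (suc (suc n))) (allFin (suc (suc n))) {λ i j → when (i Fin.≟ zero) (when (j Fin.≟ suc zero) 1)} ⟩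
    ∑∑ {suc (suc n)} (λ j i → when (i Fin.≟ zero) (when (j Fin.≟ suc zero) 1))
      ≡⟨ ∑-cong (allFin (suc (suc n))) (λ j → ∑-allFin-≟ (suc (suc n)) zero (when (j Fin.≟ suc zero) 1)) ⟩
    ∑ (allFin (suc (suc n))) (λ j → when (j Fin.≟ suc zero) 1)
      ≡⟨ ∑-allFin-≟ (suc (suc n)) (suc zero) 1 ⟩
    1 ∎)
    where
    t : Fin (suc (suc n)) → Fin (suc (suc n))
    t = swap zero (suc zero)

    only : ∀ i j → i Fin.< j × t j Fin.< t i → i ≡ zero × j ≡ suc zero
    only zero          (suc zero)    _ = refl , refl
    only zero          (suc (suc j)) (_ , s≤s ())
    only (suc zero)    (suc (suc j)) (_ , ())
    only (suc zero)    (suc zero)    (s≤s () , _)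
    only (suc (suc i)) (suc zero)    (s≤s () , _)
    only (suc (suc i)) (suc (suc j)) (i<j , j<i) = ⊥-elim (ℕₚ.<-asym i<j j<i)

    pointwise : ∀ i j → when (inversion? t i j) 1 ≡ when (i Fin.≟ zero) (when (j Fin.≟ suc zero) 1)
    pointwise i j = trans
      (when-cong (inversion? t i j) ((i Fin.≟ zero) ×-dec (j Fin.≟ suc zero)) (only i j)
        (λ { (refl , refl) → s≤s z≤n , s≤s z≤n }) (λ _ → refl))
      (when-× (i Fin.≟ zero) (j Fin.≟ suc zero))

  -- A permutation ρ with 0 ↦ a and 1 ↦ b conjugates the swap of 0 and 1 into the swap of a and b;
  -- sgn ρ then occurs twice and cancels.
  sgn-swap : ∀ {a b : Fin n} → a ≢ b → sgn (swap a b) ≡ - 1ℚ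
  sgn-swap {suc zero} {zero} {zero} a≢b = ⊥-elim (a≢b refl)
  sgn-swap {suc (suc n)} {a} {b} a≢b = begin
    sgn (swap a b)                               ≡⟨ ℚₚ.*-identityʳ _ ⟨
    sgn (swap a b) * 1ℚ                          ≡⟨ cong (sgn (swap a b) *_) (sgn² ρ) ⟨
    sgn (swap a b) * (sgn ρ * sgn ρ)             ≡⟨ ℚₚ.*-assoc (sgn (swap a b)) (sgn ρ) (sgn ρ) ⟨
    sgn (swap a b) * sgn ρ * sgn ρ               ≡⟨ cong (_* sgn ρ) (sgn-∘ (swap-inj a b) ρ-inj) ⟨
    sgn (swap a b ∘ ρ) * sgn ρ                   ≡⟨ cong (_* sgn ρ) (sgn-cong conj) ⟩
    sgn (ρ ∘ swap zero one) * sgn ρ              ≡⟨ cong (_* sgn ρ) (sgn-∘ ρ-inj (swap-inj zero one)) ⟩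
    sgn ρ * sgn (swap zero one) * sgn ρ          ≡⟨ cong (_* sgn ρ) (ℚₚ.*-comm (sgn ρ) (sgn (swap zero one))) ⟩
    sgn (swap zero one) * sgn ρ * sgn ρ          ≡⟨ ℚₚ.*-assoc (sgn (swap zero one)) (sgn ρ) (sgn ρ) ⟩
    sgn (swap zero one) * (sgn ρ * sgn ρ)        ≡⟨ cong₂ _*_ (sgn-swap₀₁ n) (sgn² ρ) ⟩
    - 1ℚ * 1ℚ                                    ∎
    where
    one b′ : Fin (suc (suc n))
    one = suc zero
    -- The preimage of b under the swap of 0 and a, so that this swap, applied last in ρ, carries it
    -- to b. As a ≠ b, it is not 0.
    b′ = swap zero a b

    ρ : Fin (suc (suc n)) → Fin (suc (suc n))
    ρ = swap zero a ∘ swap one b′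

    ρ-inj : Inj ρ
    ρ-inj = swap-inj one b′ ∘ swap-inj zero a

    ρ0 : ρ zero ≡ a
    ρ0 = trans (cong (swap zero a) (swap-other {a = one} {b′} {zero} (λ ()) (λ 0≡b′ → a≢b (begin
        a                        ≡⟨ swap-fst zero a ⟨
        swap zero a zero         ≡⟨ cong (swap zero a) 0≡b′ ⟩
        swap zero a b′           ≡⟨ swap-involutive zero a b ⟩
        b                        ∎)))) (swap-fst zero a)

    ρ1 : ρ one ≡ b
    ρ1 = trans (cong (swap zero a) (swap-fst one b′)) (swap-involutive zero a b)

    conj : ∀ x → swap a b (ρ x) ≡ ρ (swap zero one x)
    conj x = trans (cong₂ (λ c d → swap c d (ρ x)) (sym ρ0) (sym ρ1)) (swap-conj ρ-inj zero one x)

  sgn-cyc : ∀ (z : ℕ → Fin n) m → InjUpTo z m → sgn (cyc z m) ≡ signℚ m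
  sgn-cyc {n} z zero _  = sgn-id n
  sgn-cyc z (suc m) inj = begin
    sgn (cyc z m ∘ swap (z m) (z (suc m)))      ≡⟨ sgn-∘ (cyc-inj z m) (swap-inj (z m) (z (suc m))) ⟩
    sgn (cyc z m) * sgn (swap (z m) (z (suc m))) ≡⟨ cong₂ _*_ (sgn-cyc z m (injUpTo-pred inj))
                                                       (sgn-swap (λ eq → ℕₚ.1+n≢n (sym (inj (ℕₚ.n≤1+n m) ℕₚ.≤-refl eq)))) ⟩
    signℚ m * (- 1ℚ)                            ≡⟨ ℚₚ.neg-distribʳ-* (signℚ m) 1ℚ ⟨
    - (signℚ m * 1ℚ)                            ≡⟨ cong -_ (ℚₚ.*-identityʳ (signℚ m)) ⟩
    - signℚ m                                   ∎

-- The gcd condition as invertibility modulo ℓ.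

module ModularInverse where
  open import Data.Nat using (ℕ; suc; _+_; _*_; NonZero)
  import Data.Nat.Properties as ℕₚ
  open import Data.Nat.Coprimality using (coprime-Bézout; gcd≡1⇒coprime)
  open import Data.Nat.Divisibility using (_∣_; divides)
  open import Data.Nat.GCD using (gcd; gcd[m,n]∣n; c*gcd[m,n]≡gcd[cm,cn]; module Bézout)
  open import Data.Nat.Tactic.RingSolver using (solve-∀)
  open import Relation.Binary.PropositionalEquality using (_≡_; refl; sym; trans; cong; subst; module ≡-Reasoning)
  open ≡-Reasoning

  -- uq≡1 is u q ≡ 1 (mod ℓ), written without subtraction.
  record Inverse (k g ℓ : ℕ) : Set where
    constructor mkInverse
    field
      q u a b : ℕ
      k≡qg    : k ≡ q * g
      uq≡1    : u * q + a * ℓ ≡ 1 + b * ℓ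

  -- With k = q g, cancelling g from gcd(g ℓ, k) = g leaves gcd(ℓ, q) = 1, and Bézout supplies an
  -- inverse u of q modulo ℓ.
  gcd≡⇒Inverse : ∀ k g ℓ′ .{{_ : NonZero g}} → gcd (g * suc ℓ′) k ≡ g → Inverse k g (suc ℓ′)
  gcd≡⇒Inverse k g ℓ′ eq with subst (_∣ k) eq (gcd[m,n]∣n (g * suc ℓ′) k)
  ... | divides q refl with coprime-Bézout (gcd≡1⇒coprime {suc ℓ′} {q} (ℕₚ.*-cancelˡ-≡ _ _ g (begin
        g * gcd (suc ℓ′) q          ≡⟨ c*gcd[m,n]≡gcd[cm,cn] g (suc ℓ′) q ⟩
        gcd (g * suc ℓ′) (g * q)    ≡⟨ cong (gcd (g * suc ℓ′)) (ℕₚ.*-comm g q) ⟩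
        gcd (g * suc ℓ′) (q * g)    ≡⟨ eq ⟩
        g                           ≡⟨ ℕₚ.*-identityʳ g ⟨
        g * 1                       ∎)))
  ...   | Bézout.-+ x y eq′ = mkInverse q y 0 x refl (trans (ℕₚ.+-identityʳ (y * q)) (sym eq′))
  -- Here 1 + y q = x ℓ, so the inverse of q is -y; it is represented by y (ℓ - 1).
  ...   | Bézout.+- x y eq′ = mkInverse q (y * ℓ′) x (y * q) refl (begin
    y * ℓ′ * q + x * suc ℓ′      ≡⟨ cong (y * ℓ′ * q +_) eq′ ⟨
    y * ℓ′ * q + (1 + y * q)     ≡⟨ arith y ℓ′ q ⟩
    1 + y * q * suc ℓ′           ∎)
    where
    arith : ∀ y ℓ q → y * ℓ * q + (1 + y * q) ≡ 1 + y * q * suc ℓ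
    arith = solve-∀

-- Roots on closed sets and the τ-cycle through a point.

module Roots where
  open import Defs
  open import Data.Bool as Bool using (Bool; true; false)
  open import Data.Empty using (⊥-elim)
  open import Data.Fin as Fin using (Fin)
  import Data.Fin.Properties as Finₚ
  open import Data.Nat as ℕ using (ℕ; zero; suc; _+_; _*_; _≤_; _<_; z≤n; s≤s; _/_; _%_)
  import Data.Nat.Properties as ℕₚ
  open import Data.Nat.Divisibility using (_∣_; divides; ∣-trans; ∣1⇒≡1; ∣m+n∣m⇒∣n; m%n≡0⇒n∣m; n∣n; ∣m⇒∣m*n)
  open import Data.Nat.DivMod
  open import Data.Nat.GCD using (gcd; gcd[m,n]∣m; gcd[m,n]∣n; c*gcd[m,n]≡gcd[cm,cn])
  open import Data.Product using (∃; _×_; _,_; proj₁; proj₂)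
  open import Data.Sum using (_⊎_; inj₁; inj₂)
  open import Data.Vec using (lookup; tabulate)
  import Data.Vec.Properties as Vecₚ
  open import Function using (_∘_)
  open import Relation.Binary.PropositionalEquality using (_≡_; _≢_; refl; sym; trans; cong; cong₂; subst; module ≡-Reasoning)
  open import Relation.Nullary using (¬_; Dec; yes; no; _×-dec_; _→-dec_)
  open Iteration
  open Swaps
  open ModularInverse
  open ≡-Reasoning

  iter-iter-comm : ∀ {A : Set} {f g : A → A} a b {x} → (∀ y → f (g y) ≡ g (f y)) →
                   iter f a (iter g b x) ≡ iter g b (iter f a x)
  iter-iter-comm a zero    fg = refl
  iter-iter-comm {g = g} a (suc b) fg = trans (iter-comm a fg) (cong g (iter-iter-comm a b fg))

  iter-multiple : ∀ {A : Set} {f g : A → A} {a b x} → (∀ y → f (g y) ≡ g (f y)) →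
                  iter f a x ≡ iter g b x → ∀ m → iter f (m * a) x ≡ iter g (m * b) x
  iter-multiple fg eq zero = refl
  iter-multiple {f = f} {g} {a} {b} {x} fg eq (suc m) = begin
    iter f (a + m * a) x           ≡⟨ iter-+ f a (m * a) x ⟩
    iter f a (iter f (m * a) x)    ≡⟨ cong (iter f a) (iter-multiple {a = a} {b} fg eq m) ⟩
    iter f a (iter g (m * b) x)    ≡⟨ iter-iter-comm a (m * b) fg ⟩
    iter g (m * b) (iter f a x)    ≡⟨ cong (iter g (m * b)) eq ⟩
    iter g (m * b) (iter g b x)    ≡⟨ iter-+ g (m * b) b x ⟨
    iter g (m * b + b) x           ≡⟨ cong (λ e → iter g e x) (ℕₚ.+-comm (m * b) b) ⟩
    iter g (b + m * b) x           ∎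

  module Fixed (k : ℕ) {n : ℕ} (σ : Fun n) (injσ : Inj (lookup σ)) where
    private
      s : Fin n → Fin n
      s = lookup σ

    len : Fin n → ℕ
    len = Orbits.len σ injσ

    infix 4 _~_ _~?_
    _~_ : Fin n → Fin n → Set
    _~_ = Orbits._~_ σ injσ

    _~?_ : ∀ x y → Dec (x ~ y)
    _~?_ = Orbits._~?_ σ injσ

    iter-inverse : ∀ {g ℓ} (U : Inverse k g ℓ) → let open Inverse U in ∀ y → len y ≡ ℓ → iter s (u * q) y ≡ s y
    iter-inverse U y refl = begin
      iter s (u * q) y                            ≡⟨ cong (iter s (u * q)) (iter-* a (len y) (Orbits.iter-len σ injσ y)) ⟨
      iter s (u * q) (iter s (a * len y) y)       ≡⟨ iter-+ s (u * q) (a * len y) y ⟨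
      iter s (u * q + a * len y) y                ≡⟨ cong (λ e → iter s e y) uq≡1 ⟩
      s (iter s (b * len y) y)                    ≡⟨ cong s (iter-* b (len y) (Orbits.iter-len σ injσ y)) ⟩
      s y                                         ∎
      where open Inverse U

    iter-inverse-* : ∀ {g ℓ} (U : Inverse k g ℓ) → let open Inverse U in
                     ∀ y → len y ≡ ℓ → ∀ m → iter s (m * (u * q)) y ≡ iter s m y
    iter-inverse-* U y eq m = trans (iter-multiple {a = u * q} {b = 1} (λ _ → refl) (iter-inverse U y eq) m)
      (cong (λ e → iter s e y) (ℕₚ.*-identityʳ m))
      where open Inverse U

    Closed : (Fin n → Bool) → Set
    Closed S = ∀ x → S (s x) ≡ S x

    closed-~ : ∀ {S} → Closed S → ∀ {x y} → x ~ y → S y ≡ S x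
    closed-~ {S} closed {x} (e , refl) = closed-iter e
      where
      closed-iter : ∀ e → S (iter s e x) ≡ S x
      closed-iter zero    = refl
      closed-iter (suc e) = trans (closed _) (closed-iter e)

    Root : (Fin n → Bool) → Fun n → Set
    Root S τ = IsPerm τ × (∀ x → S x ≡ false → lookup τ x ≡ x) × (∀ x → S x ≡ true → iter (lookup τ) k x ≡ s x)

    root? : ∀ S τ → Dec (Root S τ)
    root? S τ = isPerm? τ
      ×-dec Finₚ.all? (λ x → (S x Bool.≟ false) →-dec (lookup τ x Fin.≟ x))
      ×-dec Finₚ.all? (λ x → (S x Bool.≟ true) →-dec (iter (lookup τ) k x Fin.≟ s x))

    true≢false : ∀ {b : Bool} {X : Set} → b ≡ true → b ≡ false → X
    true≢false refl ()

    module _ {S : Fin n → Bool} (closed : Closed S) {τ : Fun n} (root : Root S τ) where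
      private
        t : Fin n → Fin n
        t = lookup τ

      root-inj : Inj t
      root-inj = IsPerm⇒Inj τ (proj₁ root)

      -- If τ x were outside S, τ would fix it; then τ (τ x) = τ x gives τ x = x by injectivity,
      -- against x ∈ S.
      root-stays : ∀ {x} → S x ≡ true → S (t x) ≡ true
      root-stays {x} Sx with S (t x) in eq
      ... | true  = refl
      ... | false = true≢false Sx (subst (λ y → S y ≡ false) (root-inj (proj₁ (proj₂ root) (t x) eq)) eq)

      -- On S both sides are τ^(k+1) x. Off S, τ fixes x as well as σ x.
      root-comm : ∀ x → t (s x) ≡ s (t x)
      root-comm x with S x in eq
      ... | false = trans (proj₁ (proj₂ root) (s x) (trans (closed x) eq)) (cong s (sym (proj₁ (proj₂ root) x eq)))
      ... | true  = begin
        t (s x)          ≡⟨ cong t (proj₂ (proj₂ root) x eq) ⟨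
        iter t (suc k) x ≡⟨ iter-suc t k x ⟩
        iter t k (t x)   ≡⟨ proj₂ (proj₂ root) (t x) (root-stays eq) ⟩
        s (t x)          ∎

      root-len : ∀ x → len (t x) ≡ len x
      root-len x = Orbits.len-cong σ injσ
        (λ a eq → root-inj (trans (sym (iter-comm a (sym ∘ root-comm))) eq))
        (λ a eq → trans (iter-comm a (sym ∘ root-comm)) (cong t eq))

    -- The orbits of Y 0, …, Y r are distinct, and T is S with these orbits removed.
    record State (S T : Fin n → Bool) (ℓ : ℕ) (Y : ℕ → Fin n) (r : ℕ) : Set where
      field
        closedS  : Closed S
        closedT  : Closed T
        T⊆S      : ∀ {x} → T x ≡ true → S x ≡ true
        disjoint : ∀ {x i} → T x ≡ true → i ≤ r → ¬ (Y i ~ x)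
        cover    : ∀ {x} → S x ≡ true → T x ≡ false → ∃ λ i → i ≤ r × Y i ~ x
        Y∈S      : ∀ {i} → i ≤ r → S (Y i) ≡ true
        Y-len    : ∀ {i} → i ≤ r → len (Y i) ≡ ℓ
        Y-dist   : ∀ {i j} → i ≤ r → j ≤ r → Y i ~ Y j → i ≡ j

    Compat : ℕ → (ℕ → Fin n) → Fun n → Set
    Compat r Y τ = ∀ {i} → i < r → lookup τ (Y i) ≡ Y (suc i)

    compat? : ∀ r Y τ → Dec (Compat r Y τ)
    compat? r Y τ = ℕₚ.allUpTo? (λ i → lookup τ (Y i) Fin.≟ Y (suc i)) r

    module _ {S T ℓ Y r} (st : State S T ℓ Y r) where
      open State st

      private
        g : ℕ
        g = suc r
        x₀ : Fin n
        x₀ = Y 0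

      module _ {τ : Fun n} (root : Root S τ) (compat : Compat r Y τ) where
        private
          t : Fin n → Fin n
          t = lookup τ

          ts : ∀ y → t (s y) ≡ s (t y)
          ts = root-comm closedS root

        Y-iter : ∀ {i} → i ≤ r → Y i ≡ iter t i x₀
        Y-iter {zero}  _   = refl
        Y-iter {suc i} i<r = trans (sym (compat i<r)) (cong t (Y-iter (ℕₚ.<⇒≤ i<r)))

        module Closing {j} (back : t (Y r) ≡ iter s j x₀) where

          iter-g : iter t g x₀ ≡ iter s j x₀
          iter-g = trans (cong t (sym (Y-iter ℕₚ.≤-refl))) back

          -- Up to σ-orbits, τ^g acts trivially at x₀, so σ x₀ = τ^k x₀ puts the orbit of x₀ equal
          -- to that of Y (k mod g). The orbits of the chain are distinct, hence k mod g = 0.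
          g∣k : g ∣ k
          g∣k = m%n≡0⇒n∣m k g (Y-dist (ℕₚ.≤-pred (m%n<n k g)) z≤n
            (Orbits.~-trans σ injσ (k / g * j , trans s-step (cong (iter s (k / g * j)) (sym (Y-iter (ℕₚ.≤-pred (m%n<n k g)))))) (Orbits.~-sym σ injσ (Orbits.~-step σ injσ))))
            where
            s-step : s x₀ ≡ iter s (k / g * j) (iter t (k % g) x₀)
            s-step = begin
              s x₀                                         ≡⟨ proj₂ (proj₂ root) x₀ (Y∈S z≤n) ⟨
              iter t k x₀                                  ≡⟨ cong (λ e → iter t e x₀) (m≡m%n+[m/n]*n k g) ⟩
              iter t (k % g + k / g * g) x₀                ≡⟨ iter-+ t (k % g) (k / g * g) x₀ ⟩
              iter t (k % g) (iter t (k / g * g) x₀)       ≡⟨ cong (iter t (k % g)) (iter-multiple {a = g} {b = j} ts iter-g (k / g)) ⟩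
              iter t (k % g) (iter s (k / g * j) x₀)       ≡⟨ iter-iter-comm (k % g) (k / g * j) ts ⟩
              iter s (k / g * j) (iter t (k % g) x₀)       ∎

          -- The congruence q j ≡ 1 (mod ℓ), expressed at x₀ without subtraction.
          s-power : ∀ q → k ≡ q * g → s x₀ ≡ iter s (q * j) x₀
          s-power q k≡qg = begin
            s x₀                  ≡⟨ proj₂ (proj₂ root) x₀ (Y∈S z≤n) ⟨
            iter t k x₀           ≡⟨ cong (λ e → iter t e x₀) k≡qg ⟩
            iter t (q * g) x₀     ≡⟨ iter-multiple {a = g} {b = j} ts iter-g q ⟩
            iter s (q * j) x₀     ∎

          -- Both j and u are inverse to q modulo ℓ: as exponents of σ at x₀, j = j (u q) = u (q j)
          -- = u.
          unique : (U : Inverse k g ℓ) → t (Y r) ≡ iter s (Inverse.u U) x₀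
          unique U = begin
            t (Y r)                       ≡⟨ back ⟩
            iter s j x₀                   ≡⟨ iter-inverse-* U x₀ (Y-len z≤n) j ⟨
            iter s (j * (u * q)) x₀       ≡⟨ cong (λ e → iter s e x₀) (trans (ℕₚ.*-comm j (u * q)) (ℕₚ.*-assoc u q j)) ⟩
            iter s (u * (q * j)) x₀       ≡⟨ iter-multiple {a = q * j} {b = 1} (λ _ → refl) (sym (s-power q k≡qg)) u ⟩
            iter s (u * 1) x₀             ≡⟨ cong (λ e → iter s e x₀) (ℕₚ.*-identityʳ u) ⟩
            iter s u x₀                   ∎
            where open Inverse U

          -- By q j ≡ 1 (mod ℓ), a common divisor of ℓ and q divides both q j and q j - 1. If q j =
          -- 0, then σ fixes x₀ and ℓ itself divides 1.
          ∣1 : ∀ q d → k ≡ q * g → d ∣ ℓ → d ∣ q → d ∣ 1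
          ∣1 q d k≡qg d∣ℓ d∣q = go (q * j) (∣m⇒∣m*n j d∣q) (s-power q k≡qg)
            where
            ℓ∣ : ∀ a → iter s a x₀ ≡ x₀ → d ∣ a
            ℓ∣ a eq = ∣-trans d∣ℓ (subst (_∣ a) (Y-len z≤n) (Orbits.len-∣ σ injσ x₀ a eq))

            go : ∀ m → d ∣ m → s x₀ ≡ iter s m x₀ → d ∣ 1
            go zero    _   eq = ℓ∣ 1 eq
            go (suc m) d∣m eq = ∣m+n∣m⇒∣n (subst (d ∣_) (ℕₚ.+-comm 1 m) d∣m) (ℓ∣ m (sym (injσ eq)))

          gcd≡g : gcd (g * ℓ) k ≡ g
          gcd≡g with g∣k
          ... | divides q k≡qg = begin
            gcd (g * ℓ) k          ≡⟨ cong (gcd (g * ℓ)) (trans k≡qg (ℕₚ.*-comm q g)) ⟩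
            gcd (g * ℓ) (g * q)    ≡⟨ c*gcd[m,n]≡gcd[cm,cn] g ℓ q ⟨
            g * gcd ℓ q            ≡⟨ cong (g *_) (∣1⇒≡1 (∣1 q (gcd ℓ q) k≡qg (gcd[m,n]∣m ℓ q) (gcd[m,n]∣n ℓ q))) ⟩
            g * 1                  ≡⟨ ℕₚ.*-identityʳ g ⟩
            g                      ∎

        -- The chain cannot close on a later point: if τ (Y r) lay in the orbit of Y (i + 1) = τ (Y
        -- i), injectivity and commutation with σ would put Y r in the orbit of Y i. So an image
        -- outside T lies in the orbit of Y 0.
        next : (T (t (Y r)) ≡ true × len (t (Y r)) ≡ ℓ) ⊎
               (gcd (g * ℓ) k ≡ g × (∀ (U : Inverse k g ℓ) → t (Y r) ≡ iter s (Inverse.u U) x₀))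
        next with T (t (Y r)) in eq
        ... | true  = inj₁ (refl , trans (root-len closedS root (Y r)) (Y-len ℕₚ.≤-refl))
        ... | false with cover (root-stays closedS root (Y∈S ℕₚ.≤-refl)) eq
        ...   | zero  , _     , j , back = inj₂ (Closing.gcd≡g {j} back , Closing.unique {j} back)
        ...   | suc i , i<r , e , eq′ = ⊥-elim (ℕₚ.<-irrefl (Y-dist (ℕₚ.<⇒≤ i<r) ℕₚ.≤-refl
                  (e , root-inj closedS root (begin
                    t (Y r)                ≡⟨ eq′ ⟩
                    iter s e (Y (suc i))   ≡⟨ cong (iter s e) (compat i<r) ⟨
                    iter s e (t (Y i))     ≡⟨ iter-comm e (sym ∘ ts) ⟩
                    t (iter s e (Y i))     ∎))) i<r)

    -- Given Y 0, …, Y r and τ (Y r) = σ^u (Y 0), the τ-cycle through Y 0 is forced to be z 0, z 1, ….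
    module ForcedCycle {S T ℓ′ Y r} (st : State S T (suc ℓ′) Y r) (U : Inverse k (suc r) (suc ℓ′)) where
      open State st
      open Inverse U

      private
        g ℓ : ℕ
        g = suc r
        ℓ = suc ℓ′

      -- One less than the length g ℓ, written so that `suc M` reduces to `g * ℓ`.
      M : ℕ
      M = ℓ′ + r * ℓ

      -- A turn of g steps amounts to σ^u, because step g reaches σ^u (Y 0) and τ commutes with σ.
      z : ℕ → Fin n
      z i = iter s (u * (i / g)) (Y (i % g))

      %≤ : ∀ i → i % g ≤ r
      %≤ i = ℕₚ.≤-pred (m%n<n i g)

      z-small : ∀ {i} → i ≤ r → z i ≡ Y i
      z-small {i} i≤r = begin
        iter s (u * (i / g)) (Y (i % g))   ≡⟨ cong₂ (λ a b → iter s (u * a) (Y b)) (m<n⇒m/n≡0 (s≤s i≤r)) (m<n⇒m%n≡m (s≤s i≤r)) ⟩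
        iter s (u * 0) (Y i)               ≡⟨ cong (λ e → iter s e (Y i)) (ℕₚ.*-zeroʳ u) ⟩
        Y i                                ∎

      z-shift : ∀ i → z (i + g) ≡ iter s u (z i)
      z-shift i = begin
        iter s (u * ((i + g) / g)) (Y ((i + g) % g))
          ≡⟨ cong₂ (λ a b → iter s (u * a) (Y b)) (trans (+-distrib-/-∣ʳ i n∣n) (trans (cong (i / g +_) (n/n≡1 g)) (ℕₚ.+-comm (i / g) 1))) ([m+n]%n≡m%n i g) ⟩
        iter s (u * suc (i / g)) (Y (i % g))
          ≡⟨ cong (λ e → iter s e (Y (i % g))) (ℕₚ.*-suc u (i / g)) ⟩
        iter s (u + u * (i / g)) (Y (i % g))
          ≡⟨ iter-+ s u (u * (i / g)) (Y (i % g)) ⟩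
        iter s u (z i) ∎

      z-shift-* : ∀ m i → z (i + m * g) ≡ iter s (m * u) (z i)
      z-shift-* zero    i = cong z (ℕₚ.+-identityʳ i)
      z-shift-* (suc m) i = begin
        z (i + (g + m * g))            ≡⟨ cong z (trans (cong (i +_) (ℕₚ.+-comm g (m * g))) (sym (ℕₚ.+-assoc i (m * g) g))) ⟩
        z (i + m * g + g)              ≡⟨ z-shift (i + m * g) ⟩
        iter s u (z (i + m * g))       ≡⟨ cong (iter s u) (z-shift-* m i) ⟩
        iter s u (iter s (m * u) (z i)) ≡⟨ iter-+ s u (m * u) (z i) ⟨
        iter s (u + m * u) (z i)       ∎

      Y~z : ∀ i → Y (i % g) ~ z i
      Y~z i = u * (i / g) , refl

      z-len : ∀ i → len (z i) ≡ ℓ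
      z-len i = trans (sym (Orbits.~-len σ injσ (Y~z i))) (Y-len (%≤ i))

      z∈S : ∀ i → S (z i) ≡ true
      z∈S i = trans (closed-~ closedS (Y~z i)) (Y∈S (%≤ i))

      z∉T : ∀ i → T (z i) ≡ false
      z∉T i with T (z i) in eq
      ... | false = refl
      ... | true  = ⊥-elim (disjoint eq (%≤ i) (Y~z i))

      -- k steps are q turns, hence σ^(u q), which is σ on cycles of length ℓ: the forced cycle is a
      -- kth root of σ.
      z-k : ∀ i → z (i + k) ≡ s (z i)
      z-k i = begin
        z (i + k)                  ≡⟨ cong (λ e → z (i + e)) k≡qg ⟩
        z (i + q * g)              ≡⟨ z-shift-* q i ⟩
        iter s (q * u) (z i)       ≡⟨ cong (λ e → iter s e (z i)) (ℕₚ.*-comm q u) ⟩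
        iter s (u * q) (z i)       ≡⟨ iter-inverse U (z i) (z-len i) ⟩
        s (z i)                    ∎

      z-period : ∀ m i → z (i + m * suc M) ≡ z i
      z-period m i = begin
        z (i + m * (g * ℓ))         ≡⟨ cong (λ e → z (i + e)) (trans (cong (m *_) (ℕₚ.*-comm g ℓ)) (sym (ℕₚ.*-assoc m ℓ g))) ⟩
        z (i + m * ℓ * g)           ≡⟨ z-shift-* (m * ℓ) i ⟩
        iter s (m * ℓ * u) (z i)    ≡⟨ cong (λ e → iter s e (z i)) (trans (ℕₚ.*-comm (m * ℓ) u) (sym (ℕₚ.*-assoc u m ℓ))) ⟩
        iter s (u * m * ℓ) (z i)    ≡⟨ iter-* (u * m) ℓ (subst (λ e → iter s e (z i) ≡ z i) (z-len i) (Orbits.iter-len σ injσ (z i))) ⟩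
        z i                         ∎

      -- Equal points lie in one orbit, which determines the index modulo g. Multiplying the
      -- exponents of σ by q then removes the factor u and determines the number of turns, which is
      -- below ℓ.
      z-inj : InjUpTo z M
      z-inj {i} {j} i≤M j≤M eq = begin
        i                    ≡⟨ m≡m%n+[m/n]*n i g ⟩
        i % g + i / g * g    ≡⟨ cong₂ (λ a b → a + b * g) same% same/ ⟩
        j % g + j / g * g    ≡⟨ m≡m%n+[m/n]*n j g ⟨
        j                    ∎
        where
        y : Fin n
        y = Y (i % g)

        same% : i % g ≡ j % g
        same% = Y-dist (%≤ i) (%≤ j) (Orbits.~-trans σ injσ (Y~z i) (subst (_~ Y (j % g)) (sym eq) (Orbits.~-sym σ injσ (Y~z j))))

        /<len : ∀ m → m ≤ M → m / g < len y
        /<len m m≤M = subst (m / g <_) (sym (Y-len (%≤ i))) (m<n*o⇒m/o<n (subst (m <_) (ℕₚ.*-comm g ℓ) (s≤s m≤M)))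

        unwind : ∀ a → iter s (q * (u * a)) y ≡ iter s a y
        unwind a = trans (cong (λ e → iter s e y) (trans (sym (ℕₚ.*-assoc q u a)) (trans (cong (_* a) (ℕₚ.*-comm q u)) (ℕₚ.*-comm (u * q) a))))
          (iter-inverse-* U y (Y-len (%≤ i)) a)

        same/ : i / g ≡ j / g
        same/ = Orbits.iter-injective σ injσ y (/<len i i≤M) (/<len j j≤M) (begin
          iter s (i / g) y               ≡⟨ unwind (i / g) ⟨
          iter s (q * (u * (i / g))) y   ≡⟨ iter-multiple {a = u * (i / g)} {b = u * (j / g)} (λ _ → refl) (trans eq (cong (λ e → iter s (u * (j / g)) (Y e)) (sym same%))) q ⟩
          iter s (q * (u * (j / g))) y   ≡⟨ unwind (j / g) ⟩
          iter s (j / g) y               ∎)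

      -- q turns advance by σ, so σ^e (Y i) is reached from Y i after e q turns.
      z-cover : ∀ {x} → S x ≡ true → T x ≡ false → ∃ λ i → x ≡ z i
      z-cover Sx Tx with cover Sx Tx
      ... | i , i≤r , e , refl = i + e * q * g , sym (begin
        z (i + e * q * g)           ≡⟨ z-shift-* (e * q) i ⟩
        iter s (e * q * u) (z i)    ≡⟨ cong₂ (iter s) (trans (ℕₚ.*-assoc e q u) (cong (e *_) (ℕₚ.*-comm q u))) (z-small i≤r) ⟩
        iter s (e * (u * q)) (Y i)  ≡⟨ iter-inverse-* U (Y i) (Y-len i≤r) e ⟩
        iter s e (Y i)              ∎)

      z-% : ∀ i → z (i % suc M) ≡ z i
      z-% i = trans (sym (z-period (i / suc M) (i % suc M))) (cong z (sym (m≡m%n+[m/n]*n i (suc M))))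

      z-suc-% : ∀ i → z (suc (i % suc M)) ≡ z (suc i)
      z-suc-% i = trans (sym (z-period (i / suc M) (suc (i % suc M)))) (cong (z ∘ suc) (sym (m≡m%n+[m/n]*n i (suc M))))

      γ γ⁻¹ : Fin n → Fin n
      γ   = cyc z M
      γ⁻¹ = cyc⁻¹ z M

      γ-z : ∀ i → γ (z i) ≡ z (suc i)
      γ-z i = begin
        γ (z i)                ≡⟨ cong γ (z-% i) ⟨
        γ (z (i % suc M))      ≡⟨ step (i % suc M) (ℕₚ.≤-pred (m%n<n i (suc M))) ⟩
        z (suc (i % suc M))    ≡⟨ z-suc-% i ⟩
        z (suc i)              ∎
        where
        step : ∀ j → j ≤ M → γ (z j) ≡ z (suc j)
        step j j≤M with j ℕ.≟ M
        ... | no  j≢M  = cyc-step z M z-inj (ℕₚ.≤∧≢⇒< j≤M j≢M)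
        ... | yes refl = trans (cyc-last z M) (trans (sym (z-period 1 0)) (cong z (ℕₚ.*-identityˡ (suc M))))

      Off : Fin n → Set
      Off x = S x ≡ false ⊎ T x ≡ true

      off≢z : ∀ {x} → Off x → ∀ i → x ≢ z i
      off≢z (inj₁ Sx) i refl = true≢false (z∈S i) Sx
      off≢z (inj₂ Tx) i refl = true≢false Tx (z∉T i)

      γ-off : ∀ {x} → Off x → γ x ≡ x
      γ-off off = cyc-other z M (λ i _ → off≢z off i)

      γ⁻¹-off : ∀ {x} → Off x → γ⁻¹ x ≡ x
      γ⁻¹-off {x} off = trans (cong γ⁻¹ (sym (γ-off off))) (cyc-inverseˡ z M x)

      γ⁻¹-z : ∀ i → γ⁻¹ (z (suc i)) ≡ z i
      γ⁻¹-z i = trans (cong γ⁻¹ (sym (γ-z i))) (cyc-inverseˡ z M (z i))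

      locate : ∀ x → Off x ⊎ ∃ λ i → x ≡ z i
      locate x with S x in Sx | T x in Tx
      ... | false | _     = inj₁ (inj₁ refl)
      ... | true  | true  = inj₁ (inj₂ refl)
      ... | true  | false = inj₂ (z-cover Sx Tx)

      target : Fin n
      target = iter s u (Y 0)

      z-g : z g ≡ target
      z-g = trans (z-shift 0) (cong (iter s u) (z-small z≤n))

      Closes : Fun n → Set
      Closes τ = target ≡ lookup τ (Y r) × Root S τ × Compat r Y τ

      -- Composing with γ⁻¹ after τ turns the steps z i ↦ z (i + 1) into fixed points and so removes
      -- the forced cycle; ψ puts it back.
      φ ψ : Fun n → Fun n
      φ τ = tabulate γ⁻¹ ∘F τ
      ψ τ = tabulate γ ∘F τ

      lookup-φ : ∀ τ x → lookup (φ τ) x ≡ γ⁻¹ (lookup τ x)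
      lookup-φ τ x = trans (lookup-∘F (tabulate γ⁻¹) τ x) (Vecₚ.lookup∘tabulate γ⁻¹ (lookup τ x))

      lookup-ψ : ∀ τ x → lookup (ψ τ) x ≡ γ (lookup τ x)
      lookup-ψ τ x = trans (lookup-∘F (tabulate γ) τ x) (Vecₚ.lookup∘tabulate γ (lookup τ x))

      ψφ : ∀ τ → ψ (φ τ) ≡ τ
      ψφ τ = lookup-ext (λ x → trans (lookup-ψ (φ τ) x) (trans (cong γ (lookup-φ τ x)) (cyc-inverseʳ z M (lookup τ x))))

      φψ : ∀ τ → φ (ψ τ) ≡ τ
      φψ τ = lookup-ext (λ x → trans (lookup-φ (ψ τ) x) (trans (cong γ⁻¹ (lookup-ψ τ x)) (cyc-inverseˡ z M (lookup τ x))))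

      iter-agree : ∀ {P : Fin n → Set} {f h : Fin n → Fin n} → (∀ {x} → P x → f x ≡ h x) → (∀ {x} → P x → P (h x)) →
                   ∀ m {x} → P x → iter f m x ≡ iter h m x
      iter-agree fh stay zero    p = refl
      iter-agree {P} {f} {h} fh stay (suc m) p = trans (cong f (iter-agree fh stay m p)) (fh (stays m p))
        where
        stays : ∀ m {x} → P x → P (iter h m x)
        stays zero    p = p
        stays (suc m) p = stay (stays m p)

      -- τ follows z along the chain and at the closing step, hence everywhere, because it commutes
      -- with σ. So γ⁻¹ cancels it on the forced cycle; on T nothing changes, since τ maps T to
      -- itself.
      φ-root : ∀ {τ} → Closes τ → Root T (φ τ)
      φ-root {τ} (hit , root , compat) =
        Inj⇒IsPerm (φ τ) φ-inj , outside , inside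
        where
        t : Fin n → Fin n
        t = lookup τ

        φ-inj : Inj (lookup (φ τ))
        φ-inj {x} {y} eq = root-inj closedS root (cyc⁻¹-inj z M (trans (sym (lookup-φ τ x)) (trans eq (lookup-φ τ y))))

        t-z-small : ∀ {i} → i ≤ r → t (z i) ≡ z (suc i)
        t-z-small {i} i≤r with i ℕ.≟ r
        ... | yes refl = trans (cong t (z-small ℕₚ.≤-refl)) (trans (sym hit) (sym z-g))
        ... | no  i≢r  = trans (cong t (z-small i≤r)) (trans (compat i<r) (sym (z-small i<r)))
          where i<r = ℕₚ.≤∧≢⇒< i≤r i≢r

        t-z : ∀ i → t (z i) ≡ z (suc i)
        t-z i = begin
          t (z i)                                      ≡⟨ cong (t ∘ z) (m≡m%n+[m/n]*n i g) ⟩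
          t (z (i % g + i / g * g))                    ≡⟨ cong t (z-shift-* (i / g) (i % g)) ⟩
          t (iter s (i / g * u) (z (i % g)))           ≡⟨ iter-comm (i / g * u) (sym ∘ root-comm closedS root) ⟨
          iter s (i / g * u) (t (z (i % g)))           ≡⟨ cong (iter s (i / g * u)) (t-z-small (%≤ i)) ⟩
          iter s (i / g * u) (z (suc (i % g)))         ≡⟨ z-shift-* (i / g) (suc (i % g)) ⟨
          z (suc (i % g) + i / g * g)                  ≡⟨ cong (z ∘ suc) (m≡m%n+[m/n]*n i g) ⟨
          z (suc i)                                    ∎

        outside : ∀ x → T x ≡ false → lookup (φ τ) x ≡ x
        outside x Tx with locate x
        ... | inj₁ (inj₁ Sx) = trans (lookup-φ τ x) (trans (cong γ⁻¹ (proj₁ (proj₂ root) x Sx)) (γ⁻¹-off (inj₁ Sx)))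
        ... | inj₁ (inj₂ Tx′) = true≢false Tx′ Tx
        ... | inj₂ (i , refl) = trans (lookup-φ τ (z i)) (trans (cong γ⁻¹ (t-z i)) (γ⁻¹-z i))

        stay : ∀ {x} → T x ≡ true → T (t x) ≡ true
        stay {x} Tx with locate (t x)
        ... | inj₁ (inj₁ Stx) = true≢false (root-stays closedS root (T⊆S Tx)) Stx
        ... | inj₁ (inj₂ Ttx) = Ttx
        -- Going M steps further from z i means going one step back, so τ x = z i would make x a
        -- point of the forced cycle.
        ... | inj₂ (i , tx≡z) = ⊥-elim (off≢z (inj₂ Tx) (i + M) (root-inj closedS root (begin
          t x              ≡⟨ tx≡z ⟩
          z i              ≡⟨ z-period 1 i ⟨
          z (i + 1 * suc M) ≡⟨ cong (λ e → z (i + e)) (ℕₚ.*-identityˡ (suc M)) ⟩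
          z (i + suc M)    ≡⟨ cong z (ℕₚ.+-suc i M) ⟩
          z (suc (i + M))  ≡⟨ t-z (i + M) ⟨
          t (z (i + M))    ∎)))

        inside : ∀ x → T x ≡ true → iter (lookup (φ τ)) k x ≡ s x
        inside x Tx = trans
          (iter-agree {λ y → T y ≡ true} (λ {y} Ty → trans (lookup-φ τ y) (γ⁻¹-off (inj₂ (stay Ty)))) stay k Tx)
          (proj₂ (proj₂ root) x (T⊆S Tx))

      -- τ is the identity on the forced cycle, so ψ τ moves along z there, and k such steps are σ;
      -- on T it agrees with τ.
      ψ-closes : ∀ {τ} → Root T τ → Closes (ψ τ)
      ψ-closes {τ} root = hit , (Inj⇒IsPerm (ψ τ) ψ-inj , outside , inside) , compat
        where
        t : Fin n → Fin n
        t = lookup τ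

        ψ-inj : Inj (lookup (ψ τ))
        ψ-inj {x} {y} eq = root-inj closedT root (cyc-inj z M (trans (sym (lookup-ψ τ x)) (trans eq (lookup-ψ τ y))))

        ψ-z : ∀ i → lookup (ψ τ) (z i) ≡ z (suc i)
        ψ-z i = trans (lookup-ψ τ (z i)) (trans (cong γ (proj₁ (proj₂ root) (z i) (z∉T i))) (γ-z i))

        ψ-z-iter : ∀ m i → iter (lookup (ψ τ)) m (z i) ≡ z (i + m)
        ψ-z-iter zero    i = cong z (sym (ℕₚ.+-identityʳ i))
        ψ-z-iter (suc m) i = trans (cong (lookup (ψ τ)) (ψ-z-iter m i)) (trans (ψ-z (i + m)) (cong z (sym (ℕₚ.+-suc i m))))

        hit : target ≡ lookup (ψ τ) (Y r)
        hit = trans (sym z-g) (trans (sym (ψ-z r)) (cong (lookup (ψ τ)) (z-small ℕₚ.≤-refl)))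

        compat : Compat r Y (ψ τ)
        compat {i} i<r = trans (cong (lookup (ψ τ)) (sym (z-small (ℕₚ.<⇒≤ i<r)))) (trans (ψ-z i) (z-small i<r))

        outside : ∀ x → S x ≡ false → lookup (ψ τ) x ≡ x
        outside x Sx = trans (lookup-ψ τ x) (trans (cong γ (proj₁ (proj₂ root) x Tx)) (γ-off (inj₁ Sx)))
          where
          Tx : T x ≡ false
          Tx with T x in eq
          ... | false = refl
          ... | true  = true≢false (T⊆S eq) Sx

        inside : ∀ x → S x ≡ true → iter (lookup (ψ τ)) k x ≡ s x
        inside x Sx with locate x
        ... | inj₁ (inj₁ Sx′) = true≢false Sx Sx′
        ... | inj₁ (inj₂ Tx) = trans
          (iter-agree {λ y → T y ≡ true} (λ {y} Ty → trans (lookup-ψ τ y) (γ-off (inj₂ (root-stays closedT root Ty)))) (root-stays closedT root) k Tx)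
          (proj₂ (proj₂ root) x Tx)
        ... | inj₂ (i , refl) = trans (ψ-z-iter k i) (z-k i)

-- Weighted sums of roots and their recurrence.

module WeightedRoots where
  open import Defs
  open import Data.Bool as Bool using (Bool; true; false; _∧_; not)
  import Data.Bool.Properties as Boolₚ
  open import Data.Empty using (⊥; ⊥-elim)
  open import Data.Fin as Fin using (Fin; toℕ)
  import Data.Fin.Properties as Finₚ
  open import Data.List using (_∷_; allFin; upTo)
  open import Data.List.Membership.Propositional using (_∈_)
  open import Data.List.Membership.Propositional.Properties using (∈-allFin)
  open import Data.List.Relation.Unary.Any using (here; there)
  open import Data.Nat as ℕ using (ℕ; zero; suc; _≤_; _<_; z≤n; s≤s; NonZero)
  import Data.Nat.Properties as ℕₚ
  open import Data.Nat.GCD using (gcd)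
  open import Data.Product using (∃; _×_; _,_; proj₁; proj₂)
  open import Data.Rational using (ℚ; 0ℚ; 1ℚ; _+_; _*_)
  import Data.Rational.Properties as ℚₚ
  open import Data.Sum using (_⊎_; inj₁; inj₂)
  open import Data.Vec using (Vec; _∷_; lookup; tabulate; replicate; _[_]≔_)
  import Data.Vec.Properties as Vecₚ
  open import Function using (_∘_; id; mk⇔)
  open import Relation.Binary.PropositionalEquality using (_≡_; refl; sym; trans; cong; cong₂; subst; module ≡-Reasoning)
  open import Relation.Nullary using (¬_; Dec; yes; no; does; _×-dec_)
  open import Relation.Nullary.Decidable using (¬?; dec-true; dec-false; does-⇔)
  open Summation
  open Cast
  open Counting
  open PowerSeries
  open Recurrence
  open Iteration
  open Swaps
  open ModularInverse
  open ≡-Reasoning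

  count-0 : ∀ {I : Set} {P : I → Set} (P? : ∀ x → Dec (P x)) {xs x} → x ∈ xs → count P? xs ≡ 0 → ¬ P x
  count-0 P? {xs = x ∷ xs} (here refl) eq p = ℕₚ.1+n≢0 {0} (trans (sym (∑ᴺ.when-yes (P? x) p)) (ℕₚ.m+n≡0⇒m≡0 _ eq))
  count-0 P? {xs = x ∷ xs} (there x∈)  eq p = count-0 P? x∈ (ℕₚ.m+n≡0⇒n≡0 (∑ᴺ.when (P? x) 1) eq) p

  totalDegree-update : ∀ {m} (c : Vec ℕ m) i {p} → p < lookup c i → totalDegree (c [ i ]≔ p) < totalDegree c
  totalDegree-update (x ∷ c) Fin.zero    p<x = ℕₚ.+-monoˡ-< (totalDegree c) p<x
  totalDegree-update (x ∷ c) (Fin.suc i) p<  = ℕₚ.+-monoʳ-< x (totalDegree-update c i p<)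

  vfact-0 : ∀ m → vfact (replicate m 0) ≡ 1
  vfact-0 zero    = refl
  vfact-0 (suc m) = trans (ℕₚ.*-identityˡ _) (vfact-0 m)

  totalDegree-0 : ∀ m → totalDegree (replicate m 0) ≡ 0
  totalDegree-0 zero    = refl
  totalDegree-0 (suc m) = totalDegree-0 m

  module OrbitRemoval (k : ℕ) {n : ℕ} (σ : Fun n) (injσ : Inj (lookup σ)) where
    open Roots.Fixed k σ injσ

    private
      s : Fin n → Fin n
      s = lookup σ

    On : (Fin n → Bool) → ℕ → Fin n → Set
    On T ℓ x = T x ≡ true × len x ≡ ℓ

    on? : ∀ T ℓ x → Dec (On T ℓ x)
    on? T ℓ x = (T x Bool.≟ true) ×-dec (len x ℕ.≟ ℓ)

    -- Points are counted instead of cycles, as in `HasCycleType`, so no list of cycles is formed.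
    HasType : (Fin n → Bool) → Vec ℕ n → Set
    HasType T c = ∀ i → count (on? T (suc (toℕ i))) (allFin n) ≡ suc (toℕ i) ℕ.* lookup c i

    remove : (Fin n → Bool) → Fin n → Fin n → Bool
    remove T y x = T x ∧ not (does (y ~? x))

    remove-true : ∀ T y {x} → remove T y x ≡ true → T x ≡ true × ¬ (y ~ x)
    remove-true T y {x} eq = ∧-true (T x) eq , λ y~x → true≢false eq
        (trans (cong (λ b → T x ∧ not b) (dec-true (y ~? x) y~x)) (Boolₚ.∧-zeroʳ (T x)))
      where
      ∧-true : ∀ a {b} → a ∧ b ≡ true → a ≡ true
      ∧-true true _ = refl

    remove-intro : ∀ T y {x} → T x ≡ true → ¬ (y ~ x) → remove T y x ≡ true
    remove-intro T y {x} Tx ¬y~x = trans (cong (_∧ not (does (y ~? x))) Tx) (cong not (dec-false (y ~? x) ¬y~x))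

    remove-false : ∀ T y {x} → T x ≡ true → remove T y x ≡ false → y ~ x
    remove-false T y {x} Tx eq with y ~? x
    ... | yes y~x  = y~x
    ... | no  ¬y~x = true≢false (remove-intro T y Tx ¬y~x) eq

    remove-closed : ∀ {T} y → Closed T → Closed (remove T y)
    remove-closed {T} y closed x = cong₂ (λ a b → a ∧ not b) (closed x) same
      where
      same : does (y ~? s x) ≡ does (y ~? x)
      same = does-⇔ (mk⇔
        (λ y~sx → Orbits.~-trans σ injσ y~sx (Orbits.~-sym σ injσ (Orbits.~-step σ injσ)))
        (λ y~x → Orbits.~-trans σ injσ y~x (Orbits.~-step σ injσ))) (y ~? s x) (y ~? x)

    count-remove : ∀ {T} → Closed T → ∀ {y} → T y ≡ true → ∀ ℓ →
                   count (on? T ℓ) (allFin n) ≡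
                   count (on? (remove T y) ℓ) (allFin n) ℕ.+ count (λ x → (y ~? x) ×-dec (len x ℕ.≟ ℓ)) (allFin n)
    count-remove {T} closed {y} Ty ℓ = trans (∑ᴺ.∑-cong (allFin n) pointwise) (∑ᴺ.∑-+ (allFin n))
      where
      pointwise : ∀ x → ∑ᴺ.when (on? T ℓ x) 1 ≡ ∑ᴺ.when (on? (remove T y) ℓ x) 1 ℕ.+ ∑ᴺ.when ((y ~? x) ×-dec (len x ℕ.≟ ℓ)) 1
      pointwise x = by-cases (y ~? x)
        where
        by-cases : Dec (y ~ x) → ∑ᴺ.when (on? T ℓ x) 1 ≡ ∑ᴺ.when (on? (remove T y) ℓ x) 1 ℕ.+ ∑ᴺ.when ((y ~? x) ×-dec (len x ℕ.≟ ℓ)) 1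
        by-cases (yes y~x) = trans
          (∑ᴺ.when-cong (on? T ℓ x) ((y ~? x) ×-dec (len x ℕ.≟ ℓ)) (λ { (_ , lx) → y~x , lx })
            (λ { (_ , lx) → trans (closed-~ closed y~x) Ty , lx }) (λ _ → refl))
          (cong (ℕ._+ ∑ᴺ.when ((y ~? x) ×-dec (len x ℕ.≟ ℓ)) 1)
            (sym (∑ᴺ.when-no (on? (remove T y) ℓ x) (λ { (R , _) → proj₂ (remove-true T y R) y~x }))))
        by-cases (no ¬y~x) = trans
          (∑ᴺ.when-cong (on? T ℓ x) (on? (remove T y) ℓ x) (λ { (Tx , lx) → remove-intro T y Tx ¬y~x , lx })
            (λ { (R , lx) → proj₁ (remove-true T y R) , lx }) (λ _ → refl))
          (trans (sym (ℕₚ.+-identityʳ _))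
            (cong (∑ᴺ.when (on? (remove T y) ℓ x) 1 ℕ.+_) (sym (∑ᴺ.when-no ((y ~? x) ×-dec (len x ℕ.≟ ℓ)) (¬y~x ∘ proj₁)))))

    -- The orbit of y has ℓ points, all of cycle length ℓ, so only the entry for ℓ drops, and by
    -- one.
    remove-type : ∀ {T} → Closed T → ∀ (d : Vec ℕ n) i p → HasType T (d [ i ]≔ suc p) →
                  ∀ {y} → On T (suc (toℕ i)) y → HasType (remove T y) (d [ i ]≔ p)
    remove-type {T} closed d i p ht {y} (Ty , ly) j with i Fin.≟ j
    ... | yes refl = ℕₚ.+-cancelʳ-≡ ℓ _ _ (begin
      count (on? (remove T y) ℓ) (allFin n) ℕ.+ ℓ
        ≡⟨ cong (count (on? (remove T y) ℓ) (allFin n) ℕ.+_) orbit ⟨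
      count (on? (remove T y) ℓ) (allFin n) ℕ.+ count (λ x → (y ~? x) ×-dec (len x ℕ.≟ ℓ)) (allFin n)
        ≡⟨ count-remove closed Ty ℓ ⟨
      count (on? T ℓ) (allFin n)
        ≡⟨ ht i ⟩
      ℓ ℕ.* lookup (d [ i ]≔ suc p) i
        ≡⟨ cong (ℓ ℕ.*_) (Vecₚ.lookup∘update i d (suc p)) ⟩
      ℓ ℕ.* suc p
        ≡⟨ trans (ℕₚ.*-suc ℓ p) (ℕₚ.+-comm ℓ (ℓ ℕ.* p)) ⟩
      ℓ ℕ.* p ℕ.+ ℓ
        ≡⟨ cong (λ e → ℓ ℕ.* e ℕ.+ ℓ) (Vecₚ.lookup∘update i d p) ⟨
      ℓ ℕ.* lookup (d [ i ]≔ p) i ℕ.+ ℓ ∎)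
      where
      ℓ = suc (toℕ i)
      orbit : count (λ x → (y ~? x) ×-dec (len x ℕ.≟ ℓ)) (allFin n) ≡ ℓ
      orbit = trans (∑ᴺ.∑-cong (allFin n) (λ x → ∑ᴺ.when-cong ((y ~? x) ×-dec (len x ℕ.≟ ℓ)) (y ~? x) proj₁
          (λ y~x → y~x , trans (sym (Orbits.~-len σ injσ y~x)) ly) (λ _ → refl)))
        (trans (Orbits.orbit-size σ injσ y) ly)
    ... | no i≢j = begin
      count (on? (remove T y) ℓ) (allFin n)
        ≡⟨ ℕₚ.+-identityʳ _ ⟨
      count (on? (remove T y) ℓ) (allFin n) ℕ.+ 0
        ≡⟨ cong (count (on? (remove T y) ℓ) (allFin n) ℕ.+_) (sym none) ⟩
      count (on? (remove T y) ℓ) (allFin n) ℕ.+ count (λ x → (y ~? x) ×-dec (len x ℕ.≟ ℓ)) (allFin n)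
        ≡⟨ count-remove closed Ty ℓ ⟨
      count (on? T ℓ) (allFin n)
        ≡⟨ ht j ⟩
      ℓ ℕ.* lookup (d [ i ]≔ suc p) j
        ≡⟨ cong (ℓ ℕ.*_) (trans (Vecₚ.lookup∘update′ (i≢j ∘ sym) d (suc p)) (sym (Vecₚ.lookup∘update′ (i≢j ∘ sym) d p))) ⟩
      ℓ ℕ.* lookup (d [ i ]≔ p) j ∎
      where
      ℓ = suc (toℕ j)
      none : count (λ x → (y ~? x) ×-dec (len x ℕ.≟ ℓ)) (allFin n) ≡ 0
      none = ∑ᴺ.∑-zero (allFin n) (λ x → ∑ᴺ.when-no ((y ~? x) ×-dec (len x ℕ.≟ ℓ))
        (λ { (y~x , lx) → i≢j (Finₚ.toℕ-injective (ℕₚ.suc-injective (trans (sym ly) (trans (Orbits.~-len σ injσ y~x) lx)))) }))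

    extend : (ℕ → Fin n) → ℕ → Fin n → ℕ → Fin n
    extend Y r y i with i ℕ.≤? r
    ... | yes _ = Y i
    ... | no  _ = y

    extend-old : ∀ {Y r y i} → i ≤ r → extend Y r y i ≡ Y i
    extend-old {r = r} {i = i} i≤r with i ℕ.≤? r
    ... | yes _   = refl
    ... | no  i≰r = ⊥-elim (i≰r i≤r)

    extend-new : ∀ {Y r y} → extend Y r y (suc r) ≡ y
    extend-new {r = r} with suc r ℕ.≤? r
    ... | yes lt = ⊥-elim (ℕₚ.<-irrefl refl lt)
    ... | no  _  = refl

    ≤suc-case : ∀ {i r} → i ≤ suc r → i ≤ r ⊎ i ≡ suc r
    ≤suc-case {i} {r} i≤ with ℕₚ.m≤n⇒m<n∨m≡n i≤
    ... | inj₁ (s≤s lt) = inj₁ lt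
    ... | inj₂ eq       = inj₂ eq

    extend-state : ∀ {S T ℓ Y r y} → State S T ℓ Y r → On T ℓ y → State S (remove T y) ℓ (extend Y r y) (suc r)
    extend-state {S} {T} {ℓ} {Y} {r} {y} st (Ty , ly) = record
      { closedS  = closedS
      ; closedT  = remove-closed y closedT
      ; T⊆S      = λ R → T⊆S (proj₁ (remove-true T y R))
      ; disjoint = λ R i≤ → disjoint′ R (≤suc-case i≤)
      ; cover    = cover′
      ; Y∈S      = λ i≤ → Y′∈S (≤suc-case i≤)
      ; Y-len    = λ i≤ → Y′-len (≤suc-case i≤)
      ; Y-dist   = λ i≤ j≤ → Y′-dist (≤suc-case i≤) (≤suc-case j≤)
      }
      where
      open State st
      Y′ : ℕ → Fin n
      Y′ = extend Y r y

      disjoint′ : ∀ {x i} → remove T y x ≡ true → i ≤ r ⊎ i ≡ suc r → ¬ (Y′ i ~ x)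
      disjoint′ {x} R (inj₁ i≤r)  rel = disjoint (proj₁ (remove-true T y R)) i≤r (subst (_~ x) (extend-old i≤r) rel)
      disjoint′ {x} R (inj₂ refl) rel = proj₂ (remove-true T y R) (subst (_~ x) (extend-new {Y} {r}) rel)

      cover′ : ∀ {x} → S x ≡ true → remove T y x ≡ false → ∃ λ i → i ≤ suc r × Y′ i ~ x
      cover′ {x} Sx R with T x in Tx
      ... | false = let i , i≤r , rel = cover Sx Tx in i , ℕₚ.m≤n⇒m≤1+n i≤r , subst (_~ x) (sym (extend-old i≤r)) rel
      ... | true  = suc r , ℕₚ.≤-refl , subst (_~ x) (sym (extend-new {Y} {r})) (remove-false T y Tx (trans (cong (_∧ not (does (y ~? x))) Tx) R))

      Y′∈S : ∀ {i} → i ≤ r ⊎ i ≡ suc r → S (Y′ i) ≡ true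
      Y′∈S (inj₁ i≤r)  = trans (cong S (extend-old i≤r)) (Y∈S i≤r)
      Y′∈S (inj₂ refl) = trans (cong S (extend-new {Y} {r})) (T⊆S Ty)

      Y′-len : ∀ {i} → i ≤ r ⊎ i ≡ suc r → len (Y′ i) ≡ ℓ
      Y′-len (inj₁ i≤r)  = trans (cong len (extend-old i≤r)) (Y-len i≤r)
      Y′-len (inj₂ refl) = trans (cong len (extend-new {Y} {r})) ly

      Y′-dist : ∀ {i j} → i ≤ r ⊎ i ≡ suc r → j ≤ r ⊎ j ≡ suc r → Y′ i ~ Y′ j → i ≡ j
      Y′-dist {i} {j} (inj₁ i≤r) (inj₁ j≤r) rel = Y-dist i≤r j≤r (subst (Y i ~_) (extend-old j≤r) (subst (_~ Y′ j) (extend-old i≤r) rel))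
      Y′-dist {i} (inj₁ i≤r)  (inj₂ refl) rel = ⊥-elim (disjoint Ty i≤r (subst (Y i ~_) (extend-new {Y} {r}) (subst (_~ Y′ (suc r)) (extend-old i≤r) rel)))
      Y′-dist {j = j} (inj₂ refl) (inj₁ j≤r) rel = ⊥-elim (disjoint Ty j≤r (Orbits.~-sym σ injσ
        (subst (y ~_) (extend-old j≤r) (subst (_~ Y′ j) (extend-new {Y} {r}) rel))))
      Y′-dist (inj₂ refl) (inj₂ refl) rel = refl

    start-state : ∀ {S ℓ x} → Closed S → On S ℓ x → State S (remove S x) ℓ (λ _ → x) 0
    start-state {S} {ℓ} {x} closed (Sx , lx) = record
      { closedS  = closed
      ; closedT  = remove-closed x closed
      ; T⊆S      = λ R → proj₁ (remove-true S x R)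
      ; disjoint = λ R _ → proj₂ (remove-true S x R)
      ; cover    = λ Sy R → 0 , z≤n , remove-false S x Sy R
      ; Y∈S      = λ _ → Sx
      ; Y-len    = λ _ → lx
      ; Y-dist   = λ { z≤n z≤n _ → refl }
      }

  -- `χ-cyc` links the weight of a permutation to the weight in the series: a further cycle of g ℓ
  -- points contributes the factor w ℓ g. The constant χ = 1 leads to E, the sign to D.
  module Weighted (k : ℕ) .{{_ : NonZero k}} {n : ℕ} (σ : Fun n) (injσ : Inj (lookup σ))
                  (χ : Fun n → ℚ) (w : ℕ → ℕ → ℚ) (χ-id : χ idF ≡ 1ℚ)
                  (χ-cyc : ∀ z m → InjUpTo z m → ∀ τ → Inj (lookup τ) → ∀ ℓ g → suc m ≡ g ℕ.* ℓ →
                           χ (tabulate (cyc z m) ∘F τ) ≡ w ℓ g * χ τ) where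
    open Roots.Fixed k σ injσ
    open OrbitRemoval k σ injσ
    open ∑ꟴ

    private
      s : Fin n → Fin n
      s = lookup σ

    W : (Fin n → Bool) → ℚ
    W S = ∑ (allVecs n) (λ τ → when (root? S τ) (χ τ))

    V : (Fin n → Bool) → ℕ → (ℕ → Fin n) → ℚ
    V S r Y = ∑ (allVecs n) (λ τ → when (root? S τ ×-dec compat? r Y τ) (χ τ))

    fibre : (Fin n → Bool) → ℕ → (ℕ → Fin n) → Fin n → ℚ
    fibre S r Y y = ∑ (allVecs n) (λ τ → when (y Fin.≟ lookup τ (Y r)) (when (root? S τ ×-dec compat? r Y τ) (χ τ)))

    fibre-empty : ∀ S r Y y → (∀ τ → y ≡ lookup τ (Y r) → Root S τ → Compat r Y τ → ⊥) → fibre S r Y y ≡ 0ℚ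
    fibre-empty S r Y y empty = ∑-zero (allVecs n) (λ τ → trans
      (sym (when-× (y Fin.≟ lookup τ (Y r)) (root? S τ ×-dec compat? r Y τ)))
      (when-no ((y Fin.≟ lookup τ (Y r)) ×-dec (root? S τ ×-dec compat? r Y τ)) (λ { (eq , root , compat) → empty τ eq root compat })))

    -- Prescribing τ (Y r) = y amounts to prescribing one more step of the chain.
    fibre-open : ∀ S r Y y → fibre S r Y y ≡ V S (suc r) (extend Y r y)
    fibre-open S r Y y = ∑-cong (allVecs n) (λ τ → trans
      (sym (when-× (y Fin.≟ lookup τ (Y r)) (root? S τ ×-dec compat? r Y τ)))
      (when-cong ((y Fin.≟ lookup τ (Y r)) ×-dec (root? S τ ×-dec compat? r Y τ)) (root? S τ ×-dec compat? (suc r) (extend Y r y) τ)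
        (λ { (eq , root , compat) → root , forth τ eq compat }) (λ { (root , compat) → sym (hit τ compat) , root , back τ compat }) (λ _ → refl)))
      where
      Y′ : ℕ → Fin n
      Y′ = extend Y r y

      forth : ∀ τ → y ≡ lookup τ (Y r) → Compat r Y τ → Compat (suc r) Y′ τ
      forth τ eq compat {i} (s≤s i≤r) with ℕₚ.m≤n⇒m<n∨m≡n i≤r
      ... | inj₁ i<r  = trans (cong (lookup τ) (extend-old i≤r)) (trans (compat i<r) (sym (extend-old i<r)))
      ... | inj₂ refl = trans (cong (lookup τ) (extend-old i≤r)) (trans (sym eq) (sym (extend-new {Y} {r})))

      hit : ∀ τ → Compat (suc r) Y′ τ → lookup τ (Y r) ≡ y
      hit τ compat = trans (cong (lookup τ) (sym (extend-old {Y} {r} {y} ℕₚ.≤-refl))) (trans (compat ℕₚ.≤-refl) (extend-new {Y} {r}))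

      back : ∀ τ → Compat (suc r) Y′ τ → Compat r Y τ
      back τ compat {i} i<r = trans (cong (lookup τ) (sym (extend-old (ℕₚ.<⇒≤ i<r)))) (trans (compat (ℕₚ.m≤n⇒m≤1+n i<r)) (extend-old i<r))

    -- At the closing point the whole τ-cycle is forced; its removal by φ is a bijection onto the
    -- roots on T, and `χ-cyc` accounts for the weight.
    fibre-close : ∀ {S T ℓ′ Y r} (st : State S T (suc ℓ′) Y r) (U : Inverse k (suc r) (suc ℓ′)) →
                  fibre S r Y (iter s (Inverse.u U) (Y 0)) ≡ w (suc ℓ′) (suc r) * W T
    fibre-close {S} {T} {ℓ′} {Y} {r} st U = begin
      fibre S r Y target
        ≡⟨ ∑-cong (allVecs n) (λ τ → sym (when-× (target Fin.≟ lookup τ (Y r)) (root? S τ ×-dec compat? r Y τ))) ⟩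
      ∑ (allVecs n) (λ τ → when ((target Fin.≟ lookup τ (Y r)) ×-dec (root? S τ ×-dec compat? r Y τ)) (χ τ))
        ≡⟨ ∑-bijection (enum-allVecs n n) (enum-allVecs n n)
             (λ τ → (target Fin.≟ lookup τ (Y r)) ×-dec (root? S τ ×-dec compat? r Y τ)) (root? T) φ ψ
             φ-root ψ-closes (λ {τ} _ → ψφ τ) (λ {τ} _ → φψ τ) weight ⟩
      ∑ (allVecs n) (λ τ → when (root? T τ) (w (suc ℓ′) (suc r) * χ τ))
        ≡⟨ ∑-cong (allVecs n) (λ τ → sym (*-when (w (suc ℓ′) (suc r)) (root? T τ))) ⟩
      ∑ (allVecs n) (λ τ → w (suc ℓ′) (suc r) * when (root? T τ) (χ τ))
        ≡⟨ *-∑ (w (suc ℓ′) (suc r)) (allVecs n) ⟨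
      w (suc ℓ′) (suc r) * W T ∎
      where
      open ForcedCycle st U

      weight : ∀ {τ} → Closes τ → χ τ ≡ w (suc ℓ′) (suc r) * χ (φ τ)
      weight {τ} closes = trans (cong χ (sym (ψφ τ)))
        (χ-cyc z M z-inj (φ τ) (IsPerm⇒Inj (φ τ) (proj₁ (φ-root closes))) (suc ℓ′) (suc r) refl)

    -- Split by y = τ (Y r): a point of T of cycle length ℓ prolongs the chain, the closing point
    -- ends it, and no other value occurs. Closing is possible only for g in G_k(ℓ), which `κ`
    -- records.
    V-recurrence : ∀ {S T ℓ′ Y r} → State S T (suc ℓ′) Y r →
                   V S r Y ≡ κ k w (suc ℓ′) (suc r) * W T +
                             ∑ (allFin n) (λ y → when (on? T (suc ℓ′) y) (V S (suc r) (extend Y r y)))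
    V-recurrence {S} {T} {ℓ′} {Y} {r} st = trans (∑-fibre (allVecs n) (enum-allFin n) (λ τ → lookup τ (Y r)))
      (by-gcd (gcd (suc r ℕ.* suc ℓ′) k ℕ.≟ suc r))
      where
      open State st
      ℓ g : ℕ
      ℓ = suc ℓ′
      g = suc r

      new : Fin n → ℚ
      new y = when (on? T ℓ y) (V S (suc r) (extend Y r y))

      by-gcd : Dec (gcd (g ℕ.* ℓ) k ≡ g) → ∑ (allFin n) (fibre S r Y) ≡ κ k w ℓ g * W T + ∑ (allFin n) new
      by-gcd (no g∉G) = begin
        ∑ (allFin n) (fibre S r Y)                ≡⟨ ∑-cong (allFin n) (λ y → pointwise y (on? T ℓ y)) ⟩
        ∑ (allFin n) new                          ≡⟨ ℚₚ.+-identityˡ (∑ (allFin n) new) ⟨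
        0ℚ + ∑ (allFin n) new                     ≡⟨ cong (_+ ∑ (allFin n) new) (trans (cong (_* W T) (when-no (gcd (g ℕ.* ℓ) k ℕ.≟ g) g∉G)) (ℚₚ.*-zeroˡ (W T))) ⟨
        κ k w ℓ g * W T + ∑ (allFin n) new        ∎
        where
        pointwise : ∀ y (d : Dec (On T ℓ y)) → fibre S r Y y ≡ when d (V S (suc r) (extend Y r y))
        pointwise y (yes _)  = fibre-open S r Y y
        pointwise y (no ¬on) = fibre-empty S r Y y empty
          where
          empty : ∀ τ → y ≡ lookup τ (Y r) → Root S τ → Compat r Y τ → ⊥
          empty τ refl root compat with next st root compat
          ... | inj₁ on        = ¬on on
          ... | inj₂ (g∈G , _) = g∉G g∈G
      by-gcd (yes g∈G) = begin
        ∑ (allFin n) (fibre S r Y)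
          ≡⟨ ∑-cong (allFin n) (λ y → pointwise y (on? T ℓ y) (y Fin.≟ target)) ⟩
        ∑ (allFin n) (λ y → when (y Fin.≟ target) (w ℓ g * W T) + new y)
          ≡⟨ ∑-+ (allFin n) ⟩
        ∑ (allFin n) (λ y → when (y Fin.≟ target) (w ℓ g * W T)) + ∑ (allFin n) new
          ≡⟨ cong (_+ ∑ (allFin n) new) (∑-allFin-≟ n target (w ℓ g * W T)) ⟩
        w ℓ g * W T + ∑ (allFin n) new
          ≡⟨ cong (λ e → e * W T + ∑ (allFin n) new) (when-yes (gcd (g ℕ.* ℓ) k ℕ.≟ g) g∈G) ⟨
        κ k w ℓ g * W T + ∑ (allFin n) new ∎
        where
        U : Inverse k g ℓ
        U = gcd≡⇒Inverse k g ℓ′ g∈G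

        target : Fin n
        target = iter s (Inverse.u U) (Y 0)

        pointwise : ∀ y (d : Dec (On T ℓ y)) (e : Dec (y ≡ target)) →
                    fibre S r Y y ≡ when e (w ℓ g * W T) + when d (V S (suc r) (extend Y r y))
        -- The closing point is in the orbit of Y 0, which T avoids.
        pointwise y (yes on) (yes refl) = ⊥-elim (disjoint (proj₁ on) z≤n (Inverse.u U , refl))
        pointwise y (yes on) (no _)     = trans (fibre-open S r Y y) (sym (ℚₚ.+-identityˡ _))
        pointwise y (no ¬on) (yes refl) = trans (fibre-close st U) (sym (ℚₚ.+-identityʳ _))
        pointwise y (no ¬on) (no y≢)    = trans (fibre-empty S r Y y empty) (sym (ℚₚ.+-identityˡ 0ℚ))
          where
          empty : ∀ τ → y ≡ lookup τ (Y r) → Root S τ → Compat r Y τ → ⊥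
          empty τ refl root compat with next st root compat
          ... | inj₁ on           = ¬on on
          ... | inj₂ (_ , unique) = y≢ (unique U)

    Counts : Vec ℕ n → Set
    Counts c = ∀ T → Closed T → HasType T c → W T ≡ expc k w c

    -- Each new point uses up one cycle of length ℓ, so p decreases; at p = 0 the chain can only
    -- close. As it may close at any stage, `Counts` is assumed for every p′ ≤ p. All continuations
    -- have the same value, so their number becomes a factor.
    V-value : ∀ (d : Vec ℕ n) i S p r T Y → State S T (suc (toℕ i)) Y r → HasType T (d [ i ]≔ p) →
              (∀ p′ → p′ ≤ p → Counts (d [ i ]≔ p′)) → V S r Y ≡ v k w d i p (suc r)
    V-value d i S zero r T Y st ht ih = begin
      V S r Y
        ≡⟨ V-recurrence st ⟩
      κ k w ℓ (suc r) * W T + ∑ (allFin n) (λ y → when (on? T ℓ y) (V S (suc r) (extend Y r y)))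
        ≡⟨ cong₂ _+_ (cong (κ k w ℓ (suc r) *_) (ih 0 z≤n T closedT ht))
             (∑-zero (allFin n) (λ y → when-no (on? T ℓ y) (count-0 (on? T ℓ) (∈-allFin y)
               (trans (ht i) (trans (cong (ℓ ℕ.*_) (Vecₚ.lookup∘update i d 0)) (ℕₚ.*-zeroʳ ℓ)))))) ⟩
      κ k w ℓ (suc r) * expc k w (d [ i ]≔ 0) + 0ℚ
        ≡⟨ ℚₚ.+-identityʳ _ ⟩
      κ k w ℓ (suc r) * expc k w (d [ i ]≔ 0)
        ≡⟨ v-zero k w d i (suc r) ⟨
      v k w d i 0 (suc r) ∎
      where
      ℓ = suc (toℕ i)
      open State st
    V-value d i S (suc p) r T Y st ht ih = begin
      V S r Y
        ≡⟨ V-recurrence st ⟩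
      κ k w ℓ (suc r) * W T + ∑ (allFin n) (λ y → when (on? T ℓ y) (V S (suc r) (extend Y r y)))
        ≡⟨ cong₂ _+_ (cong (κ k w ℓ (suc r) *_) (ih (suc p) ℕₚ.≤-refl T closedT ht))
             (∑-cong (allFin n) (λ y → when-congʳ (on? T ℓ y) (λ on →
               V-value d i S p (suc r) (remove T y) (extend Y r y) (extend-state st on)
                 (remove-type closedT d i p ht on) (λ p′ p′≤p → ih p′ (ℕₚ.m≤n⇒m≤1+n p′≤p))))) ⟩
      κ k w ℓ (suc r) * expc k w (d [ i ]≔ suc p) + ∑ (allFin n) (λ y → when (on? T ℓ y) (v k w d i p (suc (suc r))))
        ≡⟨ cong (κ k w ℓ (suc r) * expc k w (d [ i ]≔ suc p) +_) (trans (∑-when-const (on? T ℓ) (allFin n) _)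
             (cong (λ e → cast e * v k w d i p (suc (suc r))) (trans (ht i) (cong (ℓ ℕ.*_) (Vecₚ.lookup∘update i d (suc p)))))) ⟩
      κ k w ℓ (suc r) * expc k w (d [ i ]≔ suc p) + cast (ℓ ℕ.* suc p) * v k w d i p (suc (suc r))
        ≡⟨ v-suc k w d i p (suc r) ⟨
      v k w d i (suc p) (suc r) ∎
      where
      ℓ = suc (toℕ i)
      open State st

    expc-0 : expc k w (replicate n 0) ≡ 1ℚ
    expc-0 = begin
      cast (vfact (replicate n 0)) * exp-inner k w (replicate n 0)
        ≡⟨ cong (_* exp-inner k w (replicate n 0)) (trans (cong cast (vfact-0 n)) cast-1) ⟩
      1ℚ * exp-inner k w (replicate n 0)
        ≡⟨ ℚₚ.*-identityˡ _ ⟩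
      exp-inner k w (replicate n 0)
        ≡⟨ cong (λ N → ∑ (upTo (suc N)) (λ m → 1/ m ! * (inner k w ^S m) (replicate n 0))) (totalDegree-0 n) ⟩
      1/ 0 ! * oneS (replicate n 0) + 0ℚ
        ≡⟨ ℚₚ.+-identityʳ _ ⟩
      1/ 0 ! * oneS (replicate n 0)
        ≡⟨ ℚₚ.*-identityˡ _ ⟩
      oneS (replicate n 0)
        ≡⟨ monomial-when (replicate n 0) (replicate n 0) ⟩
      when (Vecₚ.≡-dec ℕ._≟_ (replicate n 0) (replicate n 0)) 1ℚ
        ≡⟨ when-yes (Vecₚ.≡-dec ℕ._≟_ (replicate n 0) (replicate n 0)) refl ⟩
      1ℚ ∎

    W-empty : ∀ S → (∀ x → S x ≡ false) → W S ≡ 1ℚ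
    W-empty S empty = begin
      ∑ (allVecs n) (λ τ → when (root? S τ) (χ τ))
        ≡⟨ ∑-cong (allVecs n) (λ τ → when-cong (root? S τ) (Vecₚ.≡-dec Fin._≟_ τ idF)
             (λ root → lookup-ext (λ x → trans (proj₁ (proj₂ root) x (empty x)) (sym (Vecₚ.lookup∘tabulate id x))))
             (λ { refl → id-root }) (λ _ → refl)) ⟩
      ∑ (allVecs n) (λ τ → when (Vecₚ.≡-dec Fin._≟_ τ idF) (χ τ))
        ≡⟨ enum-pick (enum-allVecs n n) idF χ ⟩
      χ idF
        ≡⟨ χ-id ⟩
      1ℚ ∎
      where
      id-root : Root S idF
      id-root = Inj⇒IsPerm idF (λ {x} {y} eq → trans (sym (Vecₚ.lookup∘tabulate id x)) (trans eq (Vecₚ.lookup∘tabulate id y)))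
              , (λ x _ → Vecₚ.lookup∘tabulate id x)
              , (λ x Sx → true≢false Sx (empty x))

    -- Induction on a bound N for the number of cycles. If some cᵢ is positive, a point x on a cycle
    -- of that length starts a chain with r = 0, which imposes no condition on τ; whatever set is
    -- left when the chain closes has fewer cycles.
    counts : ∀ N c → totalDegree c ≤ N → Counts c
    counts N c deg S closed ht with Finₚ.any? (λ i → ¬? (lookup c i ℕ.≟ 0))
    ... | no c≡0 = trans (W-empty S empty) (sym (trans (cong (expc k w) c≡replicate) expc-0))
      where
      cᵢ≡0 : ∀ i → lookup c i ≡ 0
      cᵢ≡0 i with lookup c i ℕ.≟ 0
      ... | yes eq = eq
      ... | no neq = ⊥-elim (c≡0 (i , neq))

      c≡replicate : c ≡ replicate n 0
      c≡replicate = lookup-ext (λ i → trans (cᵢ≡0 i) (sym (Vecₚ.lookup-replicate i 0)))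

      empty : ∀ x → S x ≡ false
      empty x with S x in Sx
      ... | false = refl
      ... | true  = ⊥-elim (count-0 (on? S (suc (toℕ j))) (∈-allFin x)
                      (trans (ht j) (trans (cong (suc (toℕ j) ℕ.*_) (cᵢ≡0 j)) (ℕₚ.*-zeroʳ (suc (toℕ j)))))
                      (Sx , sym (trans (cong suc (Finₚ.toℕ-fromℕ< pred<n)) (ℕₚ.m+[n∸m]≡n (Orbits.len-pos σ injσ x)))))
        where
        pred<n : len x ℕ.∸ 1 < n
        pred<n = subst (_≤ n) (sym (ℕₚ.m+[n∸m]≡n (Orbits.len-pos σ injσ x))) (Orbits.len-≤ σ injσ x)
        j : Fin n
        j = Fin.fromℕ< pred<n
    ... | yes (i , cᵢ≢0) with lookup c i in cᵢ
    ...   | zero  = ⊥-elim (cᵢ≢0 refl)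
    ...   | suc p with Finₚ.any? (on? S (suc (toℕ i)))
    ...     | no none = ⊥-elim (ℕₚ.1+n≢0 (sym (trans (sym (∑ᴺ.∑-zero (allFin n) (λ x → ∑ᴺ.when-no (on? S (suc (toℕ i)) x) (λ on → none (x , on)))))
                          (trans (ht i) (cong (suc (toℕ i) ℕ.*_) cᵢ)))))
    ...     | yes (x , on) with N
    ...       | zero   = ⊥-elim (ℕₚ.n≮0 (ℕₚ.<-≤-trans (totalDegree-update c i (subst (p <_) (sym cᵢ) ℕₚ.≤-refl)) deg))
    ...       | suc N′ = begin
      W S
        ≡⟨ ∑-cong (allVecs n) (λ τ → when-cong (root? S τ) (root? S τ ×-dec compat? 0 (λ _ → x) τ) (λ root → root , λ ()) proj₁ (λ _ → refl)) ⟩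
      V S 0 (λ _ → x)
        ≡⟨ V-value c i S p 0 (remove S x) (λ _ → x) (start-state closed on) (remove-type closed c i p ht′ on)
             (λ p′ p′≤p → counts N′ (c [ i ]≔ p′) (ℕₚ.≤-pred (ℕₚ.<-≤-trans (totalDegree-update c i (subst (p′ <_) (sym cᵢ) (s≤s p′≤p))) deg))) ⟩
      v k w c i p 1
        ≡⟨ v-start k w c i p ⟩
      expc k w (c [ i ]≔ suc p)
        ≡⟨ cong (expc k w) c-update ⟩
      expc k w c ∎
      where
      c-update : c [ i ]≔ suc p ≡ c
      c-update = trans (cong (c [ i ]≔_) (sym cᵢ)) (Vecₚ.[]≔-lookup c i)

      ht′ : HasType S (c [ i ]≔ suc p)
      ht′ = subst (HasType S) (sym c-update) ht

-- Separating even and odd roots.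

module RootCount where
  open import Defs
  open import Data.Bool using (true)
  open import Data.Fin using (Fin; toℕ)
  import Data.Integer as ℤ
  open import Data.List using (allFin; filter; length)
  open import Data.Nat as ℕ using (ℕ; zero; suc; NonZero; _%_)
  import Data.Nat.Properties as ℕₚ
  open import Data.Product using (_×_; _,_; proj₂)
  open import Data.Rational using (ℚ; 1ℚ; _+_; _*_; -_; _-_; _/_)
  import Data.Rational.Properties as ℚₚ
  open import Data.Sum using (_⊎_; inj₁; inj₂)
  open import Data.Vec using (Vec; lookup; tabulate)
  import Data.Vec.Properties as Vecₚ
  open import Function using (_∘_; id)
  open import Relation.Binary.PropositionalEquality using (_≡_; refl; sym; trans; cong; cong₂; module ≡-Reasoning)
  open import Relation.Nullary using (Dec; _×-dec_)
  open Summation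
  open Cast
  open Counting
  open PowerSeries
  open Recurrence
  open Iteration
  open Swaps
  open Sign
  open WeightedRoots
  open ≡-Reasoning
  open ∑ꟴ

  χ-sign : ∀ {n} → Fun n → ℚ
  χ-sign τ = signℚ (inversions τ)

  w-sign : ℕ → ℕ → ℚ
  w-sign ℓ g = signℚ (ℓ ℕ.* g ℕ.+ 1)

  χ-sign-sgn : ∀ {n} (τ : Fun n) {f} → (∀ x → lookup τ x ≡ f x) → χ-sign τ ≡ sgn f
  χ-sign-sgn τ eq = trans (cong signℚ (inversions-inv τ)) (sgn-cong eq)

  χ-sign-id : ∀ n → χ-sign (idF {n}) ≡ 1ℚ
  χ-sign-id n = trans (χ-sign-sgn (idF {n}) {id} (Vecₚ.lookup∘tabulate id)) (sgn-id n)

  -- A cycle of g ℓ = m + 1 points is a product of m transpositions, and (-1)^m = (-1)^(m+2) is the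
  -- (-1)^(ℓg+1) of D.
  χ-sign-cyc : ∀ {n} (z : ℕ → Fin n) m → InjUpTo z m → ∀ τ → Inj (lookup τ) → ∀ ℓ g → suc m ≡ g ℕ.* ℓ →
               χ-sign (tabulate (cyc z m) ∘F τ) ≡ w-sign ℓ g * χ-sign τ
  χ-sign-cyc z m inj τ injτ ℓ g eq = begin
    χ-sign (tabulate (cyc z m) ∘F τ)
      ≡⟨ χ-sign-sgn (tabulate (cyc z m) ∘F τ) (λ x → trans (lookup-∘F (tabulate (cyc z m)) τ x) (Vecₚ.lookup∘tabulate (cyc z m) (lookup τ x))) ⟩
    sgn (cyc z m ∘ lookup τ)
      ≡⟨ sgn-∘ (cyc-inj z m) injτ ⟩
    sgn (cyc z m) * sgn (lookup τ)
      ≡⟨ cong₂ _*_ (trans (sgn-cyc z m inj) cycle-sign) (sym (χ-sign-sgn τ (λ _ → refl))) ⟩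
    w-sign ℓ g * χ-sign τ ∎
    where
    cycle-sign : signℚ m ≡ w-sign ℓ g
    cycle-sign = begin
      signℚ m                   ≡⟨ -‿involutive (signℚ m) ⟨
      signℚ (suc (suc m))       ≡⟨ cong (signℚ ∘ suc) (trans eq (ℕₚ.*-comm g ℓ)) ⟩
      signℚ (suc (ℓ ℕ.* g))     ≡⟨ cong signℚ (ℕₚ.+-comm 1 (ℓ ℕ.* g)) ⟩
      w-sign ℓ g                ∎

  signℚ-parity : ∀ m → (m % 2 ≡ 0 × signℚ m ≡ 1ℚ) ⊎ (m % 2 ≡ 1 × signℚ m ≡ - 1ℚ)
  signℚ-parity zero          = inj₁ (refl , refl)
  signℚ-parity (suc zero)    = inj₂ (refl , refl)
  signℚ-parity (suc (suc m)) with signℚ-parity m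
  ... | inj₁ (even , eq) = inj₁ (even , trans (-‿involutive (signℚ m)) eq)
  ... | inj₂ (odd  , eq) = inj₂ (odd  , trans (-‿involutive (signℚ m)) eq)

  -- (1 + sgn)/2 is 1 on even and 0 on odd permutations; `half * 1ℚ` is the share of a root in half
  -- of E.
  half-even : ∀ m → half * 1ℚ + half * signℚ m ≡ when (m % 2 ℕ.≟ 0) 1ℚ
  half-even m with signℚ-parity m
  ... | inj₁ (even , eq) = trans (cong (λ e → half * 1ℚ + half * e) eq) (sym (when-yes (m % 2 ℕ.≟ 0) even))
  ... | inj₂ (odd  , eq) = trans (cong (λ e → half * 1ℚ + half * e) eq) (sym (when-no (m % 2 ℕ.≟ 0) (λ even → ℕₚ.1+n≢0 (trans (sym odd) even))))

  half-odd : ∀ m → half * 1ℚ + (- half) * signℚ m ≡ when (m % 2 ℕ.≟ 1) 1ℚ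
  half-odd m with signℚ-parity m
  ... | inj₁ (even , eq) = trans (cong (λ e → half * 1ℚ + (- half) * e) eq) (sym (when-no (m % 2 ℕ.≟ 1) (λ odd → ℕₚ.1+n≢0 (trans (sym odd) even))))
  ... | inj₂ (odd  , eq) = trans (cong (λ e → half * 1ℚ + (- half) * e) eq) (sym (when-yes (m % 2 ℕ.≟ 1) odd))

  module _ (k n : ℕ) .{{_ : NonZero k}} (c : Vec ℕ n) (σ : Fun n) (perm : IsPerm σ) (hct : HasCycleType σ c) where

    private
      injσ : Inj (lookup σ)
      injσ = IsPerm⇒Inj σ perm

    open Roots.Fixed k σ injσ using (Root; root?)

    IsRoot⇒Root : ∀ {τ} → IsRoot k σ τ → Root (λ _ → true) τ
    IsRoot⇒Root {τ} (p , eq) = p , (λ _ ()) , λ x _ → trans (sym (lookup-^F τ k x)) (cong (λ ρ → lookup ρ x) eq)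

    Root⇒IsRoot : ∀ {τ} → Root (λ _ → true) τ → IsRoot k σ τ
    Root⇒IsRoot {τ} (p , _ , eq) = p , lookup-ext (λ x → trans (lookup-^F τ k x) (eq x refl))

    module Instance (χ : Fun n → ℚ) (w : ℕ → ℕ → ℚ) (χ-id : χ idF ≡ 1ℚ)
                    (χ-cyc : ∀ z m → InjUpTo z m → ∀ τ → Inj (lookup τ) → ∀ ℓ g → suc m ≡ g ℕ.* ℓ →
                             χ (tabulate (cyc z m) ∘F τ) ≡ w ℓ g * χ τ) where
      open OrbitRemoval k σ injσ using (HasType; on?)
      open Weighted k σ injσ χ w χ-id χ-cyc using (counts)

      -- The closed set is everything here, so its type is the cycle type of σ and its roots are the
      -- kth roots.
      total : cast (vfact c) * expS (inner k w) c ≡ ∑ (allVecs n) (λ τ → when (isRoot? k σ τ) (χ τ))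
      total = trans (sym (counts (totalDegree c) c ℕₚ.≤-refl (λ _ → true) (λ _ → refl) hasType))
        (∑-cong (allVecs n) (λ τ → when-cong (root? (λ _ → true) τ) (isRoot? k σ τ) Root⇒IsRoot IsRoot⇒Root (λ _ → refl)))
        where
        hasType : HasType (λ _ → true) c
        hasType i = sym (trans (hct i) (trans (length-filter (λ x → cycleLength σ x ℕ.≟ suc (toℕ i)) (allFin n))
          (∑ᴺ.∑-cong (allFin n) (λ x → ∑ᴺ.when-cong (cycleLength σ x ℕ.≟ suc (toℕ i)) (on? (λ _ → true) (suc (toℕ i)) x)
            (refl ,_) proj₂ (λ _ → refl)))))

    total-E : cast (vfact c) * E-series k c ≡ ∑ (allVecs n) (λ τ → when (isRoot? k σ τ) 1ℚ)
    total-E = Instance.total (λ _ → 1ℚ) (λ _ _ → 1ℚ) refl (λ _ _ _ _ _ _ _ _ → sym (ℚₚ.*-identityˡ 1ℚ))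

    total-D : cast (vfact c) * D-series k c ≡ ∑ (allVecs n) (λ τ → when (isRoot? k σ τ) (χ-sign τ))
    total-D = Instance.total χ-sign w-sign (χ-sign-id n) χ-sign-cyc

    -- E weighs a root by 1 and D by its sign. For h = 1/2 or h = -1/2 the two weights combine into
    -- the indicator of one parity, so both claims are instances.
    mixture : ∀ h {P : Fun n → Set} (P? : ∀ τ → Dec (P τ)) → (∀ τ → half * 1ℚ + h * χ-sign τ ≡ when (P? τ) 1ℚ) →
              cast (vfact c) * (half * E-series k c + h * D-series k c) ≡ cast (count (λ τ → isRoot? k σ τ ×-dec P? τ) (allVecs n))
    mixture h P? split = begin
      C * (half * E + h * D)
        ≡⟨ ℚₚ.*-distribˡ-+ C (half * E) (h * D) ⟩
      C * (half * E) + C * (h * D)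
        ≡⟨ cong₂ _+_ (*-swap C half E) (*-swap C h D) ⟩
      half * (C * E) + h * (C * D)
        ≡⟨ cong₂ (λ a b → half * a + h * b) total-E total-D ⟩
      half * ∑ (allVecs n) (λ τ → when (R? τ) 1ℚ) + h * ∑ (allVecs n) (λ τ → when (R? τ) (χ-sign τ))
        ≡⟨ cong₂ _+_ (*-∑ half (allVecs n)) (*-∑ h (allVecs n)) ⟩
      ∑ (allVecs n) (λ τ → half * when (R? τ) 1ℚ) + ∑ (allVecs n) (λ τ → h * when (R? τ) (χ-sign τ))
        ≡⟨ ∑-+ (allVecs n) ⟨
      ∑ (allVecs n) (λ τ → half * when (R? τ) 1ℚ + h * when (R? τ) (χ-sign τ))
        ≡⟨ ∑-cong (allVecs n) pointwise ⟩
      ∑ (allVecs n) (λ τ → when (R? τ ×-dec P? τ) 1ℚ)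
        ≡⟨ cast-count (λ τ → R? τ ×-dec P? τ) (allVecs n) ⟨
      cast (count (λ τ → R? τ ×-dec P? τ) (allVecs n)) ∎
      where
      C = cast (vfact c)
      E = E-series k c
      D = D-series k c
      R? = isRoot? k σ

      pointwise : ∀ τ → half * when (R? τ) 1ℚ + h * when (R? τ) (χ-sign τ) ≡ when (R? τ ×-dec P? τ) 1ℚ
      pointwise τ = begin
        half * when (R? τ) 1ℚ + h * when (R? τ) (χ-sign τ)   ≡⟨ cong₂ _+_ (*-when half (R? τ)) (*-when h (R? τ)) ⟩
        when (R? τ) (half * 1ℚ) + when (R? τ) (h * χ-sign τ) ≡⟨ when-+ (R? τ) ⟨
        when (R? τ) (half * 1ℚ + h * χ-sign τ)               ≡⟨ cong (when (R? τ)) (split τ) ⟩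
        when (R? τ) (when (P? τ) 1ℚ)                         ≡⟨ when-× (R? τ) (P? τ) ⟨
        when (R? τ ×-dec P? τ) 1ℚ                            ∎

    expCoeff-count : ∀ f h {P : Fun n → Set} (P? : ∀ τ → Dec (P τ)) → (∀ τ → half * 1ℚ + h * χ-sign τ ≡ when (P? τ) 1ℚ) →
                     f c ≡ half * E-series k c + h * D-series k c →
                     expCoeff f c ≡ ℤ.+ (length (filter (λ τ → isRoot? k σ τ ×-dec P? τ) (allVecs n))) / 1
    expCoeff-count f h P? split eq = begin
      (ℤ.+ vfact c / 1) * f c                                   ≡⟨ cong₂ _*_ (sym (cast-/ (vfact c))) eq ⟩
      cast (vfact c) * (half * E-series k c + h * D-series k c) ≡⟨ mixture h P? split ⟩
      cast (count Q? (allVecs n))                               ≡⟨ cong cast (length-filter Q? (allVecs n)) ⟨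
      cast (length (filter Q? (allVecs n)))                     ≡⟨ cast-/ _ ⟩
      ℤ.+ (length (filter Q? (allVecs n))) / 1                  ∎
      where
      Q? = λ τ → isRoot? k σ τ ×-dec P? τ

    even-count : expCoeff (λ a → half * E-series k a + half * D-series k a) c ≡ ℤ.+ numEvenRoots k σ / 1
    even-count = expCoeff-count (λ a → half * E-series k a + half * D-series k a) half (λ τ → inversions τ % 2 ℕ.≟ 0) (λ τ → half-even (inversions τ)) refl

    odd-count : expCoeff (λ a → half * E-series k a - half * D-series k a) c ≡ ℤ.+ numOddRoots k σ / 1
    odd-count = expCoeff-count (λ a → half * E-series k a - half * D-series k a) (- half) (λ τ → inversions τ % 2 ℕ.≟ 1) (λ τ → half-odd (inversions τ))
      (cong (half * E-series k c +_) (ℚₚ.neg-distribˡ-* half (D-series k c)))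

open import Defs
open import Data.Nat using (ℕ; NonZero)
open import Data.Vec using (Vec)
open import Data.Integer using (+_)
open import Data.Rational using (ℚ; _+_; _-_; _*_; _/_)
open import Data.Product using (_×_; _,_)
open import Relation.Binary.PropositionalEquality using (_≡_)

theorem1 : (k n : ℕ) → .{{NonZero k}} → .{{NonZero n}}
    → (c : Vec ℕ n) → weightedSum c ≡ n
    → (σ : Fun n) → IsPerm σ → HasCycleType σ c
    → (expCoeff (λ a → half * E-series k a + half * D-series k a) c ≡ (+ numEvenRoots k σ) / 1)
    × (expCoeff (λ a → half * E-series k a - half * D-series k a) c ≡ (+ numOddRoots k σ) / 1)
theorem1 k n c _ σ perm hct = RootCount.even-count k n c σ perm hct , RootCount.odd-count k n c σ perm hct
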